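{- Let $\beta=\frac{1+\sqrt5}{2}$, $K=\mathbb{Q}(\sqrt5)$, $\mathcal{O}_K=\mathbb{Z}[\beta]$, and let $\sigma$ be the nontrivial element of $\mathrm{Gal}(K/\mathbb{Q})$. Let $\xi$ be a real quartic irrational contained in a quadratic extension of $K$, all of whose algebraic conjugates over $\mathbb{Q}$ are real. Let $Ax^2+Bx+C$, with $A,B,C\in\mathcal{O}_K$, be a minimal polynomial of $\xi$ over $K$, and let $\xi'$ be any chosen root of $\sigma(A)x^2+\sigma(B)x+\sigma(C)=0$. Let $P=[a_0,a_1,a_2,\dots]$, $a_n\in\mathcal{O}_K$, be a continued fraction produced from the pair $(\xi,\xi')$ by the expansion algorithm described in the context. Then $P$ is ultimately periodic; moreover $P$ converges to $\xi$, and $\sigma(P)=[\sigma(a_0),\sigma(a_1),\sigma(a_2),\dots]$ converges to $\xi'$.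
   Context: Expansion algorithm for $(\xi,\xi')$: set $\xi_0=\xi$, $\xi_0'=\xi'$. For each $n\ge 0$, choose $a_n\in\mathcal{O}_K$ with $$|\xi_n-a_n|^2+|\xi_n'-\sigma(a_n)|^2<\tfrac{9}{10}$$ (such an $a_n$ always exists; if there are several, any one may be chosen arbitrarily), and set $$\xi_{n+1}=\frac{1}{\xi_n-a_n},\qquad \xi_{n+1}'=\frac{1}{\xi_n'-\sigma(a_n)}.$$ The output is the sequence $[a_0,a_1,a_2,\dots]$. A continued fraction $[a_0,a_1,\dots]$ converges to a real number $x$ if $Q_n\neq0$ for all large $n$ and $P_n/Q_n\to x$, where $P_{ -1}=1,\ P_0=a_0,\ P_{n+1}=a_{n+1}P_n+P_{n-1}$ and $Q_{ -1}=0,\ Q_0=1,\ Q_{n+1}=a_{n+1}Q_n+Q_{n-1}$. It is ultimately periodic if $(a_n)$ is eventually periodic. A real quartic irrational is a real algebraic number of degree $4$ over $\mathbb{Q}$. "Minimal polynomial over $K$" means an irreducible quadratic polynomial over $K$ with root $\xi$ (not necessarily monic), scaled to have coefficients in $\mathcal{O}_K$.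
   Formalization: Ultimate periodicity is proved when the arbitrary choice of a_n depends only on the current pair (ξ_n, ξ'_n); for choices that may also vary with n it is false. Convergence of P and σ(P) is proved for all choices. -}

module Defs where

open import Algebra.Bundles using (RawRing; RawSemiring)
import Algebra.Definitions.RawSemiring as RawSemiringDefs
open import Data.Integer.Base as ℤ using (ℤ; +_)
open import Data.List.Base using (List; []; _∷_; map; foldr)
open import Data.Nat.Base as ℕ using (ℕ; zero; suc)
import Data.Nat.Properties as ℕ
import Data.Nat.Solver as ℕ-Solver
import Data.Integer.Properties as ℤ
import Data.Integer.Solver as ℤ-Solver
open import Data.Product.Base using (∃-syntax; _×_; _,_; proj₁; proj₂)
open import Data.Rational.Base as ℚ using (ℚ; 0ℚ; 1ℚ; ½)
import Data.Rational.Properties as ℚ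
import Data.Rational.Solver as ℚ-Solver
import Data.Rational.Unnormalised.Base as ℚᵘ
import Data.Rational.Unnormalised.Properties as ℚᵘ
open import Data.Sum.Base using (inj₁; inj₂)
open import Level using (0ℓ)
open import Relation.Binary.PropositionalEquality
  using (_≡_; _≢_; refl; sym; trans; cong; subst; subst₂)
open import Relation.Nullary using (yes; no)
open import Relation.Unary using (Pred)

------------------------------------------------------------------------
-- Real numbers: Cauchy sequences of rationals, up to _≃_

IsCauchy : (ℕ → ℚ) → Set
IsCauchy x = ∀ ε → 0ℚ ℚ.< ε →
  ∃[ N ] (∀ m n → N ℕ.≤ m → N ℕ.≤ n → ℚ.∣ x m ℚ.- x n ∣ ℚ.< ε)

record ℝ : Set where
  constructor mkℝ
  field
    seq    : ℕ → ℚ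
    cauchy : IsCauchy seq

open ℝ public

infix 4 _≃_ _<_

record _≃_ (x y : ℝ) : Set where
  constructor mk≃
  field
    vanishing : ∀ ε → 0ℚ ℚ.< ε →
      ∃[ N ] (∀ n → N ℕ.≤ n → ℚ.∣ seq x n ℚ.- seq y n ∣ ℚ.< ε)

record _<_ (x y : ℝ) : Set where
  constructor mk<
  field
    separation : ∃[ ε ] (0ℚ ℚ.< ε × ∃[ N ] (∀ n → N ℕ.≤ n → seq x n ℚ.+ ε ℚ.< seq y n))

module Lemmas where
  open ℚ-Solver.+-*-Solver using (solve; _:+_; _:*_; _:-_; :-_; _:=_; con)

  half-pos : ∀ {ε} → 0ℚ ℚ.< ε → 0ℚ ℚ.< ½ ℚ.* ε
  half-pos {ε} p = subst (ℚ._< ½ ℚ.* ε) (ℚ.*-zeroʳ ½) (ℚ.*-monoʳ-<-pos ½ p)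

  half+half : ∀ ε → ½ ℚ.* ε ℚ.+ ½ ℚ.* ε ≡ ε
  half+half ε = trans (sym (ℚ.*-distribʳ-+ ε ½ ½)) (ℚ.*-identityˡ ε)

  abs< : ∀ {p ε} → p ℚ.< ε → ℚ.- p ℚ.< ε → ℚ.∣ p ∣ ℚ.< ε
  abs< {p} {ε} a b with ℚ.∣p∣≡p∨∣p∣≡-p p
  ... | inj₁ e = subst (ℚ._< ε) (sym e) a
  ... | inj₂ e = subst (ℚ._< ε) (sym e) b

  p≤∣p∣ : ∀ p → p ℚ.≤ ℚ.∣ p ∣
  p≤∣p∣ p with ℚ.∣p∣≡p∨∣p∣≡-p p
  ... | inj₁ e = ℚ.≤-reflexive (sym e)
  ... | inj₂ e = ℚ.≤-trans p≤0 (ℚ.0≤∣p∣ p)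
    where
    p≤0 : p ℚ.≤ 0ℚ
    p≤0 = subst (ℚ._≤ 0ℚ) (trans (cong ℚ.-_ e) (solve 1 (λ x → :- (:- x) := x) refl p))
            (ℚ.neg-antimono-≤ (ℚ.0≤∣p∣ p))

  swap-∣-∣ : ∀ p q → ℚ.∣ p ℚ.- q ∣ ≡ ℚ.∣ q ℚ.- p ∣
  swap-∣-∣ p q = trans (sym (ℚ.∣-p∣≡∣p∣ (p ℚ.- q)))
    (cong ℚ.∣_∣ (solve 2 (λ x y → :- (x :- y) := y :- x) refl p q))

  abs-diff : ∀ p q → ℚ.∣ ℚ.∣ p ∣ ℚ.- ℚ.∣ q ∣ ∣ ℚ.≤ ℚ.∣ p ℚ.- q ∣
  abs-diff p q with ℚ.∣p∣≡p∨∣p∣≡-p (ℚ.∣ p ∣ ℚ.- ℚ.∣ q ∣)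
  ... | inj₁ e = ℚ.≤-trans (ℚ.≤-reflexive e) (half p q)
    where
    half : ∀ p q → ℚ.∣ p ∣ ℚ.- ℚ.∣ q ∣ ℚ.≤ ℚ.∣ p ℚ.- q ∣
    half p q = begin
      ℚ.∣ p ∣ ℚ.- ℚ.∣ q ∣
        ≡⟨ cong (λ t → ℚ.∣ t ∣ ℚ.- ℚ.∣ q ∣) (solve 2 (λ x y → x := (x :- y) :+ y) refl p q) ⟩
      ℚ.∣ (p ℚ.- q) ℚ.+ q ∣ ℚ.- ℚ.∣ q ∣
        ≤⟨ ℚ.+-monoˡ-≤ (ℚ.- ℚ.∣ q ∣) (ℚ.∣p+q∣≤∣p∣+∣q∣ (p ℚ.- q) q) ⟩
      (ℚ.∣ p ℚ.- q ∣ ℚ.+ ℚ.∣ q ∣) ℚ.- ℚ.∣ q ∣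
        ≡⟨ solve 2 (λ x y → (x :+ y) :- y := x) refl ℚ.∣ p ℚ.- q ∣ ℚ.∣ q ∣ ⟩
      ℚ.∣ p ℚ.- q ∣ ∎
      where open ℚ.≤-Reasoning
  ... | inj₂ e = ℚ.≤-trans (ℚ.≤-reflexive e) (begin
      ℚ.- (ℚ.∣ p ∣ ℚ.- ℚ.∣ q ∣)
        ≡⟨ solve 2 (λ x y → :- (x :- y) := y :- x) refl ℚ.∣ p ∣ ℚ.∣ q ∣ ⟩
      ℚ.∣ q ∣ ℚ.- ℚ.∣ p ∣
        ≡⟨ cong (λ t → ℚ.∣ t ∣ ℚ.- ℚ.∣ p ∣) (solve 2 (λ x y → y := (y :- x) :+ x) refl p q) ⟩
      ℚ.∣ (q ℚ.- p) ℚ.+ p ∣ ℚ.- ℚ.∣ p ∣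
        ≤⟨ ℚ.+-monoˡ-≤ (ℚ.- ℚ.∣ p ∣) (ℚ.∣p+q∣≤∣p∣+∣q∣ (q ℚ.- p) p) ⟩
      (ℚ.∣ q ℚ.- p ∣ ℚ.+ ℚ.∣ p ∣) ℚ.- ℚ.∣ p ∣
        ≡⟨ solve 2 (λ x y → (x :+ y) :- y := x) refl ℚ.∣ q ℚ.- p ∣ ℚ.∣ p ∣ ⟩
      ℚ.∣ q ℚ.- p ∣
        ≡⟨ swap-∣-∣ q p ⟩
      ℚ.∣ p ℚ.- q ∣ ∎)
      where open ℚ.≤-Reasoning

  0<1 : 0ℚ ℚ.< 1ℚ
  0<1 = ℚ.positive⁻¹ 1ℚ

  bound : ∀ x → IsCauchy x → ∃[ B ] (0ℚ ℚ.< B × ∃[ N ] (∀ n → N ℕ.≤ n → ℚ.∣ x n ∣ ℚ.≤ B))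
  bound x c with c 1ℚ 0<1
  ... | N , h = ℚ.∣ x N ∣ ℚ.+ 1ℚ , ℚ.+-mono-≤-< (ℚ.0≤∣p∣ (x N)) 0<1 , N , λ n N≤n → begin
      ℚ.∣ x n ∣
        ≡⟨ cong ℚ.∣_∣ (solve 2 (λ a b → a := b :+ (a :- b)) refl (x n) (x N)) ⟩
      ℚ.∣ x N ℚ.+ (x n ℚ.- x N) ∣
        ≤⟨ ℚ.∣p+q∣≤∣p∣+∣q∣ (x N) (x n ℚ.- x N) ⟩
      ℚ.∣ x N ∣ ℚ.+ ℚ.∣ x n ℚ.- x N ∣
        ≤⟨ ℚ.+-monoʳ-≤ ℚ.∣ x N ∣ (ℚ.<⇒≤ (h n N N≤n ℕ.≤-refl)) ⟩
      ℚ.∣ x N ∣ ℚ.+ 1ℚ ∎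
    where open ℚ.≤-Reasoning

  shrink : ∀ B ε → 0ℚ ℚ.< B → 0ℚ ℚ.< ε → ∃[ δ ] (0ℚ ℚ.< δ × B ℚ.* δ ≡ ε)
  shrink B ε B>0 ε>0 = δ , δ>0 , eq
    where
    instance
      B⁺ : ℚ.Positive B
      B⁺ = ℚ.positive B>0
      B≠0 : ℚ.NonZero B
      B≠0 = ℚ.pos⇒nonZero B
      1/B⁺ : ℚ.Positive (ℚ.1/ B)
      1/B⁺ = ℚ.1/pos⇒pos B
    δ : ℚ
    δ = ℚ.1/ B ℚ.* ε
    δ>0 : 0ℚ ℚ.< δ
    δ>0 = subst (ℚ._< δ) (ℚ.*-zeroʳ (ℚ.1/ B)) (ℚ.*-monoʳ-<-pos (ℚ.1/ B) ε>0)
    eq : B ℚ.* δ ≡ ε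
    eq = trans (sym (ℚ.*-assoc B (ℚ.1/ B) ε))
           (trans (cong (ℚ._* ε) (ℚ.*-inverseʳ B)) (ℚ.*-identityˡ ε))

  *-abs-mono : ∀ {a b B δ} → ℚ.∣ a ∣ ℚ.≤ B → 0ℚ ℚ.< B → ℚ.∣ b ∣ ℚ.< δ →
               ℚ.∣ a ℚ.* b ∣ ℚ.< B ℚ.* δ
  *-abs-mono {a} {b} {B} {δ} a≤B B>0 b<δ = begin-strict
      ℚ.∣ a ℚ.* b ∣          ≡⟨ ℚ.∣p*q∣≡∣p∣*∣q∣ a b ⟩
      ℚ.∣ a ∣ ℚ.* ℚ.∣ b ∣    ≤⟨ ℚ.*-monoʳ-≤-nonNeg ℚ.∣ b ∣ a≤B ⟩
      B ℚ.* ℚ.∣ b ∣          <⟨ ℚ.*-monoʳ-<-pos B b<δ ⟩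
      B ℚ.* δ ∎
    where
    open ℚ.≤-Reasoning
    instance
      B⁺ : ℚ.Positive B
      B⁺ = ℚ.positive B>0
      b⁺ : ℚ.NonNegative ℚ.∣ b ∣
      b⁺ = ℚ.∣-∣-nonNeg b

  triangle : ∀ {p q ε} → ℚ.∣ p ∣ ℚ.< ½ ℚ.* ε → ℚ.∣ q ∣ ℚ.< ½ ℚ.* ε → ℚ.∣ p ℚ.+ q ∣ ℚ.< ε
  triangle {p} {q} {ε} a b = begin-strict
      ℚ.∣ p ℚ.+ q ∣           ≤⟨ ℚ.∣p+q∣≤∣p∣+∣q∣ p q ⟩
      ℚ.∣ p ∣ ℚ.+ ℚ.∣ q ∣     <⟨ ℚ.+-mono-< a b ⟩
      ½ ℚ.* ε ℚ.+ ½ ℚ.* ε     ≡⟨ half+half ε ⟩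
      ε ∎
    where open ℚ.≤-Reasoning

  const-cauchy : ∀ q → IsCauchy (λ _ → q)
  const-cauchy q ε ε>0 =
    0 , λ _ _ _ _ → subst (λ t → ℚ.∣ t ∣ ℚ.< ε) (sym (ℚ.+-inverseʳ q)) ε>0

  interchange : ∀ a b c d → (a ℚ.- b) ℚ.+ (c ℚ.- d) ≡ (a ℚ.+ c) ℚ.- (b ℚ.+ d)
  interchange = solve 4 (λ a b c d → (a :- b) :+ (c :- d) := (a :+ c) :- (b :+ d)) refl

  neg-diff : ∀ a b → b ℚ.- a ≡ ℚ.- a ℚ.- (ℚ.- b)
  neg-diff = solve 2 (λ a b → b :- a := :- a :- (:- b)) refl

  product-diff : ∀ a b c d → a ℚ.* (c ℚ.- d) ℚ.+ d ℚ.* (a ℚ.- b) ≡ a ℚ.* c ℚ.- b ℚ.* d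
  product-diff = solve 4 (λ a b c d → a :* (c :- d) :+ d :* (a :- b) := a :* c :- b :* d) refl

  +-cauchy : ∀ x y → IsCauchy x → IsCauchy y → IsCauchy (λ n → x n ℚ.+ y n)
  +-cauchy x y cx cy ε ε>0 = M ℕ.⊔ N , λ m n le le′ →
    subst (λ t → ℚ.∣ t ∣ ℚ.< ε) (interchange (x m) (x n) (y m) (y n))
      (triangle (proj₂ X m n (ℕ.m⊔n≤o⇒m≤o M N le) (ℕ.m⊔n≤o⇒m≤o M N le′))
                (proj₂ Y m n (ℕ.m⊔n≤o⇒n≤o M N le) (ℕ.m⊔n≤o⇒n≤o M N le′)))
    where
    X = cx (½ ℚ.* ε) (half-pos ε>0)
    Y = cy (½ ℚ.* ε) (half-pos ε>0)
    M N : ℕ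
    M = proj₁ X
    N = proj₁ Y

  -‿cauchy : ∀ x → IsCauchy x → IsCauchy (λ n → ℚ.- x n)
  -‿cauchy x cx ε ε>0 = proj₁ X , λ m n le le′ →
    subst (λ t → ℚ.∣ t ∣ ℚ.< ε) (neg-diff (x m) (x n)) (proj₂ X n m le′ le)
    where X = cx ε ε>0

  ∣-∣-cauchy : ∀ x → IsCauchy x → IsCauchy (λ n → ℚ.∣ x n ∣)
  ∣-∣-cauchy x cx ε ε>0 = proj₁ X , λ m n le le′ →
    ℚ.≤-<-trans (abs-diff (x m) (x n)) (proj₂ X m n le le′)
    where X = cx ε ε>0

  *-cauchy : ∀ x y → IsCauchy x → IsCauchy y → IsCauchy (λ n → x n ℚ.* y n)
  *-cauchy x y cx cy ε ε>0 = go (bound x cx) (bound y cy)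
    where
    Goal : Set
    Goal = ∃[ N ] (∀ m n → N ℕ.≤ m → N ℕ.≤ n → ℚ.∣ x m ℚ.* y m ℚ.- x n ℚ.* y n ∣ ℚ.< ε)

    EventualBound : (ℕ → ℚ) → Set
    EventualBound z = ∃[ B ] (0ℚ ℚ.< B × ∃[ N ] (∀ n → N ℕ.≤ n → ℚ.∣ z n ∣ ℚ.≤ B))

    go : EventualBound x → EventualBound y → Goal
    go (B , B>0 , M₁ , bx) (C , C>0 , M₂ , by) = M ℕ.⊔ N , λ m n le le′ →
      subst (λ t → ℚ.∣ t ∣ ℚ.< ε) (product-diff (x m) (x n) (y m) (y n))
        (triangle
          (subst (ℚ.∣ x m ℚ.* (y m ℚ.- y n) ∣ ℚ.<_) (proj₂ (proj₂ δ))
            (*-abs-mono (bx m (p₁ le)) B>0 (proj₂ Y m n (p₃ le) (p₃ le′))))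
          (subst (ℚ.∣ y n ℚ.* (x m ℚ.- x n) ∣ ℚ.<_) (proj₂ (proj₂ η))
            (*-abs-mono (by n (p₂ le′)) C>0 (proj₂ X m n (p₄ le) (p₄ le′)))))
      where
      δ = shrink B (½ ℚ.* ε) B>0 (half-pos ε>0)
      η = shrink C (½ ℚ.* ε) C>0 (half-pos ε>0)
      Y = cy (proj₁ δ) (proj₁ (proj₂ δ))
      X = cx (proj₁ η) (proj₁ (proj₂ η))
      M N : ℕ
      M = M₁ ℕ.⊔ M₂
      N = proj₁ Y ℕ.⊔ proj₁ X
      p₁ : ∀ {n} → M ℕ.⊔ N ℕ.≤ n → M₁ ℕ.≤ n
      p₁ le = ℕ.m⊔n≤o⇒m≤o M₁ M₂ (ℕ.m⊔n≤o⇒m≤o M N le)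
      p₂ : ∀ {n} → M ℕ.⊔ N ℕ.≤ n → M₂ ℕ.≤ n
      p₂ le = ℕ.m⊔n≤o⇒n≤o M₁ M₂ (ℕ.m⊔n≤o⇒m≤o M N le)
      p₃ : ∀ {n} → M ℕ.⊔ N ℕ.≤ n → proj₁ Y ℕ.≤ n
      p₃ le = ℕ.m⊔n≤o⇒m≤o (proj₁ Y) (proj₁ X) (ℕ.m⊔n≤o⇒n≤o M N le)
      p₄ : ∀ {n} → M ℕ.⊔ N ℕ.≤ n → proj₁ X ℕ.≤ n
      p₄ le = ℕ.m⊔n≤o⇒n≤o (proj₁ Y) (proj₁ X) (ℕ.m⊔n≤o⇒n≤o M N le)

-- Opaque, since unfolding these proofs makes type checking very slow.
opaque
  fromℚ-cauchy : ∀ q → IsCauchy (λ _ → q)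
  fromℚ-cauchy = Lemmas.const-cauchy

  +-cauchy : ∀ x y → IsCauchy x → IsCauchy y → IsCauchy (λ n → x n ℚ.+ y n)
  +-cauchy = Lemmas.+-cauchy

  *-cauchy : ∀ x y → IsCauchy x → IsCauchy y → IsCauchy (λ n → x n ℚ.* y n)
  *-cauchy = Lemmas.*-cauchy

  -‿cauchy : ∀ x → IsCauchy x → IsCauchy (λ n → ℚ.- x n)
  -‿cauchy = Lemmas.-‿cauchy

  ∣-∣-cauchy : ∀ x → IsCauchy x → IsCauchy (λ n → ℚ.∣ x n ∣)
  ∣-∣-cauchy = Lemmas.∣-∣-cauchy

infixl 6 _+_ _-_
infixl 7 _*_
infix  8 -_

fromℚ : ℚ → ℝ
fromℚ q = mkℝ (λ _ → q) (fromℚ-cauchy q)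

_+_ _*_ : ℝ → ℝ → ℝ
x + y = mkℝ (λ n → seq x n ℚ.+ seq y n) (+-cauchy (seq x) (seq y) (cauchy x) (cauchy y))
x * y = mkℝ (λ n → seq x n ℚ.* seq y n) (*-cauchy (seq x) (seq y) (cauchy x) (cauchy y))

-_ : ℝ → ℝ
- x = mkℝ (λ n → ℚ.- seq x n) (-‿cauchy (seq x) (cauchy x))

_-_ : ℝ → ℝ → ℝ
x - y = x + (- y)

∣_∣ : ℝ → ℝ
∣ x ∣ = mkℝ (λ n → ℚ.∣ seq x n ∣) (∣-∣-cauchy (seq x) (cauchy x))

_² : ℝ → ℝ
x ² = x * x

0ℝ 1ℝ : ℝ
0ℝ = fromℚ 0ℚ
1ℝ = fromℚ 1ℚ

ℝ-rawRing : RawRing 0ℓ 0ℓ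
ℝ-rawRing = record
  { _≈_ = _≃_ ; _+_ = _+_ ; _*_ = _*_ ; -_ = -_ ; 0# = 0ℝ ; 1# = 1ℝ }

------------------------------------------------------------------------
-- Square roots of natural numbers

-- isqrt n is the largest k with k * k ≤ n.
isqrt : ℕ → ℕ
isqrt zero    = zero
isqrt (suc n) with suc (isqrt n) ℕ.* suc (isqrt n) ℕ.≤? suc n
... | yes _ = suc (isqrt n)
... | no  _ = isqrt n

-- The n-th term is √m rounded down to a multiple of 1 / (n + 1).
-- Opaque, since normalising _/_ on open terms is expensive.
opaque
  √-seq : ℕ → ℕ → ℚ
  √-seq m n = + isqrt (m ℕ.* (suc n ℕ.* suc n)) ℚ./ suc n

  √-seq-def : ∀ m n → √-seq m n ≡ + isqrt (m ℕ.* (suc n ℕ.* suc n)) ℚ./ suc n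
  √-seq-def m n = refl

module √-Lemmas where

  isqrt-lower : ∀ n → isqrt n ℕ.* isqrt n ℕ.≤ n
  isqrt-lower zero = ℕ.z≤n
  isqrt-lower (suc n) with suc (isqrt n) ℕ.* suc (isqrt n) ℕ.≤? suc n
  ... | yes p = p
  ... | no  _ = ℕ.m≤n⇒m≤1+n (isqrt-lower n)

  isqrt-upper : ∀ n → n ℕ.< suc (isqrt n) ℕ.* suc (isqrt n)
  isqrt-upper zero = ℕ.s≤s ℕ.z≤n
  isqrt-upper (suc n) with suc (isqrt n) ℕ.* suc (isqrt n) ℕ.≤? suc n
  ... | yes _ = ℕ.≤-<-trans (isqrt-upper n)
                  (ℕ.*-mono-< (ℕ.n<1+n (suc (isqrt n))) (ℕ.n<1+n (suc (isqrt n))))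
  ... | no ¬p = ℕ.≰⇒> ¬p

  sq-cancel-< : ∀ {a b} → a ℕ.* a ℕ.< b ℕ.* b → a ℕ.< b
  sq-cancel-< {a} {b} p = ℕ.≰⇒> λ b≤a → ℕ.<⇒≱ p (ℕ.*-mono-≤ b≤a b≤a)

  cross : ∀ m M-1 N-1 → let M = suc M-1 ; N = suc N-1 in
          isqrt (m ℕ.* (M ℕ.* M)) ℕ.* N ℕ.< suc (isqrt (m ℕ.* (N ℕ.* N))) ℕ.* M
  cross m M-1 N-1 = sq-cancel-< (begin-strict
      (k ℕ.* N) ℕ.* (k ℕ.* N)
        ≡⟨ solve 2 (λ k N → (k :* N) :* (k :* N) := (k :* k) :* (N :* N)) refl k N ⟩
      (k ℕ.* k) ℕ.* (N ℕ.* N)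
        ≤⟨ ℕ.*-monoˡ-≤ (N ℕ.* N) (isqrt-lower (m ℕ.* (M ℕ.* M))) ⟩
      (m ℕ.* (M ℕ.* M)) ℕ.* (N ℕ.* N)
        ≡⟨ solve 3 (λ m M N → (m :* (M :* M)) :* (N :* N) := (m :* (N :* N)) :* (M :* M)) refl m M N ⟩
      (m ℕ.* (N ℕ.* N)) ℕ.* (M ℕ.* M)
        <⟨ ℕ.*-monoˡ-< (M ℕ.* M) (isqrt-upper (m ℕ.* (N ℕ.* N))) ⟩
      (l ℕ.* l) ℕ.* (M ℕ.* M)
        ≡⟨ solve 2 (λ l M → (l :* l) :* (M :* M) := (l :* M) :* (l :* M)) refl l M ⟩
      (l ℕ.* M) ℕ.* (l ℕ.* M) ∎)
    where
    open ℕ.≤-Reasoning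
    open ℕ-Solver.+-*-Solver using (solve; _:*_; _:=_)
    M N k l : ℕ
    M = suc M-1
    N = suc N-1
    k = isqrt (m ℕ.* (M ℕ.* M))
    l = suc (isqrt (m ℕ.* (N ℕ.* N)))

  /-< : ∀ {k l M-1 N-1} → k ℕ.* suc N-1 ℕ.< l ℕ.* suc M-1 →
        + k ℚ./ suc M-1 ℚ.< + l ℚ./ suc N-1
  /-< {k} {l} {M-1} {N-1} p = ℚ.toℚᵘ-cancel-< (begin-strict
      ℚ.toℚᵘ (+ k ℚ./ suc M-1)  ≃⟨ ℚ.toℚᵘ-fromℚᵘ (ℚᵘ.mkℚᵘ (+ k) M-1) ⟩
      ℚᵘ.mkℚᵘ (+ k) M-1         <⟨ ℚᵘ.*<* (subst₂ ℤ._<_ (ℤ.pos-* k (suc N-1)) (ℤ.pos-* l (suc M-1)) (ℤ.+<+ p)) ⟩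
      ℚᵘ.mkℚᵘ (+ l) N-1         ≃⟨ ℚ.toℚᵘ-fromℚᵘ (ℚᵘ.mkℚᵘ (+ l) N-1) ⟨
      ℚ.toℚᵘ (+ l ℚ./ suc N-1)  ∎)
    where open ℚᵘ.≤-Reasoning

  /-suc : ∀ l N-1 → + suc l ℚ./ suc N-1 ≡ + l ℚ./ suc N-1 ℚ.+ + 1 ℚ./ suc N-1
  /-suc l N-1 = ℚ.toℚᵘ-injective (begin-equality
      ℚ.toℚᵘ (+ suc l ℚ./ suc N-1)
        ≃⟨ ℚ.toℚᵘ-fromℚᵘ (ℚᵘ.mkℚᵘ (+ suc l) N-1) ⟩
      ℚᵘ.mkℚᵘ (+ suc l) N-1
        ≃⟨ ℚᵘ.*≡* (identity (+ l) (+ suc N-1)) ⟩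
      ℚᵘ.mkℚᵘ (+ l) N-1 ℚᵘ.+ ℚᵘ.mkℚᵘ (+ 1) N-1
        ≃⟨ ℚᵘ.+-cong (ℚ.toℚᵘ-fromℚᵘ (ℚᵘ.mkℚᵘ (+ l) N-1)) (ℚ.toℚᵘ-fromℚᵘ (ℚᵘ.mkℚᵘ (+ 1) N-1)) ⟨
      ℚ.toℚᵘ (+ l ℚ./ suc N-1) ℚᵘ.+ ℚ.toℚᵘ (+ 1 ℚ./ suc N-1)
        ≃⟨ ℚ.toℚᵘ-homo-+ (+ l ℚ./ suc N-1) (+ 1 ℚ./ suc N-1) ⟨
      ℚ.toℚᵘ (+ l ℚ./ suc N-1 ℚ.+ + 1 ℚ./ suc N-1) ∎)
    where
    open ℚᵘ.≤-Reasoning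
    open ℤ-Solver.+-*-Solver using (solve; _:*_; _:+_; _:=_; con)
    identity : ∀ l N → (ℤ.1ℤ ℤ.+ l) ℤ.* (N ℤ.* N) ≡ (l ℤ.* N ℤ.+ ℤ.1ℤ ℤ.* N) ℤ.* N
    identity = solve 2 (λ l N →
      (con ℤ.1ℤ :+ l) :* (N :* N) := (l :* N :+ con ℤ.1ℤ :* N) :* N) refl

  opaque
    unfolding √-seq

    √-seq-close : ∀ m M N → √-seq m M ℚ.- √-seq m N ℚ.< + 1 ℚ./ suc N
    √-seq-close m M N = begin-strict
        x ℚ.- y
          <⟨ ℚ.+-monoˡ-< (ℚ.- y)
               (/-< {isqrt (m ℕ.* (suc M ℕ.* suc M))} {suc l} {M} {N} (cross m M N)) ⟩
        + suc l ℚ./ suc N ℚ.- y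
          ≡⟨ cong (ℚ._- y) (/-suc l N) ⟩
        (y ℚ.+ + 1 ℚ./ suc N) ℚ.- y
          ≡⟨ cancel y (+ 1 ℚ./ suc N) ⟩
        + 1 ℚ./ suc N ∎
      where
      open ℚ.≤-Reasoning
      open ℚ-Solver.+-*-Solver using (solve; _:+_; _:-_; _:=_)
      x y : ℚ
      x = √-seq m M
      y = √-seq m N
      l : ℕ
      l = isqrt (m ℕ.* (suc N ℕ.* suc N))
      cancel : ∀ y z → (y ℚ.+ z) ℚ.- y ≡ z
      cancel = solve 2 (λ y z → (y :+ z) :- y := z) refl

  archimedean : ∀ ε → 0ℚ ℚ.< ε → ∃[ N ] (∀ n → N ℕ.≤ n → + 1 ℚ./ suc n ℚ.< ε)
  archimedean ε@(ℚ.mkℚ (+ zero) _ _) (ℚ.*<* (ℤ.+<+ ()))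
  archimedean ε@(ℚ.mkℚ (+ suc k) d _) _ = suc d , λ n d<n →
    subst (+ 1 ℚ./ suc n ℚ.<_) (ℚ.fromℚᵘ-toℚᵘ ε)
      (/-< {1} {suc k} {n} {d} (begin-strict
        1 ℕ.* suc d      ≡⟨ ℕ.*-identityˡ (suc d) ⟩
        suc d            ≤⟨ d<n ⟩
        n                <⟨ ℕ.n<1+n n ⟩
        suc n            ≤⟨ ℕ.m≤m+n (suc n) (k ℕ.* suc n) ⟩
        suc k ℕ.* suc n  ∎))
    where open ℕ.≤-Reasoning
  archimedean ε@(ℚ.mkℚ ℤ.-[1+ _ ] _ _) (ℚ.*<* ())

  √-cauchy : ∀ m → IsCauchy (√-seq m)
  √-cauchy m ε ε>0 = proj₁ A , λ i j N≤i N≤j → Lemmas.abs<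
    (ℚ.<-trans (√-seq-close m i j) (proj₂ A j N≤j))
    (subst (ℚ._< ε) (flip-diff (√-seq m i) (√-seq m j))
      (ℚ.<-trans (√-seq-close m j i) (proj₂ A i N≤i)))
    where
    A = archimedean ε ε>0
    open ℚ-Solver.+-*-Solver using (solve; _:-_; :-_; _:=_)
    flip-diff : ∀ x y → y ℚ.- x ≡ ℚ.- (x ℚ.- y)
    flip-diff = solve 2 (λ x y → y :- x := :- (x :- y)) refl

opaque
  √-cauchy : ∀ m → IsCauchy (√-seq m)
  √-cauchy = √-Lemmas.√-cauchy

√_ : ℕ → ℝ
√ m = mkℝ (√-seq m) (√-cauchy m)

β : ℝ
β = fromℚ ½ * (1ℝ + √ 5)

------------------------------------------------------------------------
-- Complex numbers

record ℂ : Set where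
  constructor _+i_
  field
    re im : ℝ

open ℂ public

ℂ-rawRing : RawRing 0ℓ 0ℓ
ℂ-rawRing = record
  { Carrier = ℂ
  ; _≈_ = λ z w → re z ≃ re w × im z ≃ im w
  ; _+_ = λ z w → (re z + re w) +i (im z + im w)
  ; _*_ = λ z w → (re z * re w - im z * im w) +i (re z * im w + im z * re w)
  ; -_  = λ z → (- re z) +i (- im z)
  ; 0#  = 0ℝ +i 0ℝ
  ; 1#  = 1ℝ +i 0ℝ
  }

------------------------------------------------------------------------
-- The ring A[β] with β² = β + 1, for A = ℤ and A = ℚ

-- ⟨ a , b ⟩ stands for a + b β.
record Golden (A : Set) : Set where
  constructor ⟨_,_⟩
  field
    rat gold : A

open Golden public

module GoldenRing (A : Set) (_+ᴬ_ _*ᴬ_ : A → A → A) (-ᴬ_ : A → A) (0ᴬ 1ᴬ : A) where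

  rawRing : RawRing 0ℓ 0ℓ
  rawRing = record
    { Carrier = Golden A
    ; _≈_ = _≡_
    ; _+_ = λ x y → ⟨ rat x +ᴬ rat y , gold x +ᴬ gold y ⟩
    ; _*_ = λ x y → ⟨ (rat x *ᴬ rat y) +ᴬ (gold x *ᴬ gold y)
                    , ((rat x *ᴬ gold y) +ᴬ (gold x *ᴬ rat y)) +ᴬ (gold x *ᴬ gold y) ⟩
    ; -_  = λ x → ⟨ -ᴬ rat x , -ᴬ gold x ⟩
    ; 0#  = ⟨ 0ᴬ , 0ᴬ ⟩
    ; 1#  = ⟨ 1ᴬ , 0ᴬ ⟩
    }

K 𝒪 : Set
K = Golden ℚ
𝒪 = Golden ℤ

K-rawRing 𝒪-rawRing : RawRing 0ℓ 0ℓ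
K-rawRing = GoldenRing.rawRing ℚ ℚ._+_ ℚ._*_ ℚ.-_ 0ℚ 1ℚ
𝒪-rawRing = GoldenRing.rawRing ℤ ℤ._+_ ℤ._*_ ℤ.-_ ℤ.0ℤ ℤ.1ℤ

-- √5 ↦ - √5, that is β ↦ 1 - β.
σ : 𝒪 → 𝒪
σ ⟨ a , b ⟩ = ⟨ a ℤ.+ b , ℤ.- b ⟩

𝒪→K : 𝒪 → K
𝒪→K ⟨ a , b ⟩ = ⟨ a ℚ./ 1 , b ℚ./ 1 ⟩

K→ℝ : K → ℝ
K→ℝ ⟨ p , q ⟩ = fromℚ p + fromℚ q * β

𝒪→ℝ : 𝒪 → ℝ
𝒪→ℝ a = K→ℝ (𝒪→K a)

------------------------------------------------------------------------
-- Polynomials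

-- Lists of coefficients, constant term first; trailing zeros are allowed.
module Polynomial (R : RawRing 0ℓ 0ℓ) where

  private module R = RawRing R

  Poly : Set
  Poly = List R.Carrier

  coeff : Poly → ℕ → R.Carrier
  coeff []      _       = R.0#
  coeff (c ∷ p) zero    = c
  coeff (c ∷ p) (suc n) = coeff p n

  _+ᴾ_ : Poly → Poly → Poly
  []      +ᴾ q       = q
  (c ∷ p) +ᴾ []      = c ∷ p
  (c ∷ p) +ᴾ (d ∷ q) = (c R.+ d) ∷ (p +ᴾ q)

  _*ᴾ_ : Poly → Poly → Poly
  []      *ᴾ q = []
  (c ∷ p) *ᴾ q = map (c R.*_) q +ᴾ (R.0# ∷ (p *ᴾ q))

  rawSemiring : RawSemiring 0ℓ 0ℓ
  rawSemiring = record
    { Carrier = Poly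
    ; _≈_ = λ p q → ∀ n → coeff p n R.≈ coeff q n
    ; _+_ = _+ᴾ_
    ; _*_ = _*ᴾ_
    ; 0#  = []
    ; 1#  = R.1# ∷ []
    }

  open RawSemiringDefs rawSemiring public using (Irreducible)

  HasDegree : Poly → ℕ → Set
  HasDegree p d = (coeff p d R.≉ R.0#) × (∀ n → d ℕ.< n → coeff p n R.≈ R.0#)

module Evaluation (S : RawRing 0ℓ 0ℓ) where

  private module S = RawRing S

  eval : {A : Set} → (A → S.Carrier) → List A → S.Carrier → S.Carrier
  eval φ p x = foldr (λ c r → φ c S.+ x S.* r) S.0# p

open Evaluation ℝ-rawRing public using (eval)
open Evaluation ℂ-rawRing public using () renaming (eval to evalᶜ)

-- Minimal polynomials are determined up to a nonzero constant factor; they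
-- need not be monic.
module MinimalPolynomial (F : RawRing 0ℓ 0ℓ) (φ : RawRing.Carrier F → ℝ) where

  open Polynomial F public

  record IsMinimalPolynomial (p : Poly) (x : ℝ) : Set where
    field
      irreducible : Irreducible p
      root        : eval φ p x ≃ 0ℝ

  record HasAlgebraicDegree (x : ℝ) (d : ℕ) : Set where
    field
      poly      : Poly
      isMinimal : IsMinimalPolynomial poly x
      degree    : HasDegree poly d

module Overℚ = MinimalPolynomial ℚ.+-*-rawRing fromℚ
module OverK = MinimalPolynomial K-rawRing K→ℝ

IsQuarticIrrational : ℝ → Set
IsQuarticIrrational x = Overℚ.HasAlgebraicDegree x 4

IsConjugate : ℝ → ℂ → Set
IsConjugate x z = ∃[ p ] (Overℚ.IsMinimalPolynomial p x × evalᶜ (λ q → fromℚ q +i 0ℝ) p z ≈ 0#)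
  where open RawRing ℂ-rawRing using (_≈_; 0#)

AllConjugatesReal : ℝ → Set
AllConjugatesReal x = ∀ z → IsConjugate x z → im z ≃ 0ℝ

quadratic : 𝒪 → 𝒪 → 𝒪 → List 𝒪
quadratic A B C = C ∷ B ∷ A ∷ []

record IsMinimalQuadratic (A B C : 𝒪) (x : ℝ) : Set where
  field
    isMinimal : OverK.IsMinimalPolynomial (map 𝒪→K (quadratic A B C)) x
    degree    : OverK.HasDegree (map 𝒪→K (quadratic A B C)) 2

-- A subfield L of ℝ containing K with [L : K] = 2.
record IsQuadraticExtension (L : Pred ℝ 0ℓ) : Set where
  field
    respects-≃  : ∀ {x y} → x ≃ y → L x → L y
    contains-K  : ∀ k → L (K→ℝ k)
    +-closed    : ∀ {x y} → L x → L y → L (x + y)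
    -‿closed    : ∀ {x} → L x → L (- x)
    *-closed    : ∀ {x y} → L x → L y → L (x * y)
    ⁻¹-closed   : ∀ {x y} → L x → x * y ≃ 1ℝ → L y
    e₁ e₂       : ℝ
    e₁∈L        : L e₁
    e₂∈L        : L e₂
    independent : ∀ k l → K→ℝ k * e₁ + K→ℝ l * e₂ ≃ 0ℝ →
                  k ≡ ⟨ 0ℚ , 0ℚ ⟩ × l ≡ ⟨ 0ℚ , 0ℚ ⟩
    spanning    : ∀ {x} → L x → ∃[ k ] ∃[ l ] (x ≃ K→ℝ k * e₁ + K→ℝ l * e₂)

------------------------------------------------------------------------
-- Continued fractions

module _ where
  open RawRing 𝒪-rawRing using (0#; 1#) renaming (_+_ to _+ᴼ_; _*_ to _*ᴼ_)

  -- The solution of X (n + 1) = a (n + 1) X n + X (n - 1) with X (-1) = u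
  -- and X 0 = v.
  recurrence : (ℕ → 𝒪) → 𝒪 → 𝒪 → ℕ → 𝒪
  recurrence a u v zero          = v
  recurrence a u v (suc zero)    = (a 1 *ᴼ v) +ᴼ u
  recurrence a u v (suc (suc n)) =
    (a (suc (suc n)) *ᴼ recurrence a u v (suc n)) +ᴼ recurrence a u v n

  P Q : (ℕ → 𝒪) → ℕ → 𝒪
  P a = recurrence a 1# (a 0)
  Q a = recurrence a 0# 1#

_⟶_ : (ℕ → ℝ) → ℝ → Set
s ⟶ x = ∀ ε → 0ℝ < ε → ∃[ N ] (∀ n → N ℕ.≤ n → ∣ s n - x ∣ < ε)

-- The sequence q of quotients P n / Q n is only constrained where Q n ≠ 0 is
-- known, i.e. from N on.
ConvergesTo : (ℕ → 𝒪) → ℝ → Set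
ConvergesTo a x = ∃[ N ] ((∀ n → N ℕ.≤ n → Q a n ≢ ⟨ ℤ.0ℤ , ℤ.0ℤ ⟩) ×
  ∃[ q ] ((∀ n → N ℕ.≤ n → q n * 𝒪→ℝ (Q a n) ≃ 𝒪→ℝ (P a n)) × q ⟶ x))

UltimatelyPeriodic : (ℕ → 𝒪) → Set
UltimatelyPeriodic a = ∃[ N ] ∃[ p ] (0 ℕ.< p × (∀ n → N ℕ.≤ n → a (n ℕ.+ p) ≡ a n))

-- A run of the expansion algorithm on (ξ , ξ′), with output a.  The division
-- y = 1 / x is stated as y * x ≃ 1, which also says that x is invertible.
record Expansion (ξ ξ′ : ℝ) (a : ℕ → 𝒪) : Set where
  field
    x x′     : ℕ → ℝ
    start    : x 0 ≃ ξ
    start′   : x′ 0 ≃ ξ′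
    close    : ∀ n → ∣ x n - 𝒪→ℝ (a n) ∣ ² + ∣ x′ n - 𝒪→ℝ (σ (a n)) ∣ ² < fromℚ (+ 9 ℚ./ 10)
    step     : ∀ n → x  (suc n) * (x  n - 𝒪→ℝ (a n))     ≃ 1ℝ
    step′    : ∀ n → x′ (suc n) * (x′ n - 𝒪→ℝ (σ (a n))) ≃ 1ℝ

-- The choice of a n, arbitrary among the admissible values, depends only on
-- the current pair (x n , x′ n).  Periodicity fails for choices that also
-- depend on n: if ξ and ξ′ are the larger roots of x² - 3x - (2 - β) and of its
-- image under σ, then the digit blocks 3, 3 + 3β and 4, - 3 + β, 4, 3 + 3β both
-- lead from (ξ , ξ′) back to itself and can be interleaved in any order.
ChoiceByCurrentPair : ∀ {ξ ξ′ a} → Expansion ξ ξ′ a → Set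
ChoiceByCurrentPair {a = a} e = ∀ m n → x m ≃ x n → x′ m ≃ x′ n → a m ≡ a n
  where open Expansion e

module Submission where

-- Write ε n = x n - a n and let A n be the leading coefficient of the quadratic
-- equation of x n obtained by substituting x = a n + 1 / x (n + 1) at every step.
-- The derivative η n = 2 A n x n + B n only changes its sign with n, and
-- A (n + 1) = A n (ε n)² - η n ε n.  Since (ε n)² < 9 / 10, the A n and B n are
-- bounded; the same holds for their conjugates, so only finitely many pairs (A n , B n)
-- occur.  Such a pair and the parity of n determine x n, and likewise x′ n, so some
-- pair (x n , x′ n) recurs.
--
-- For convergence put t n = Q (n - 1) ξ - P (n - 1), so that t (n + 1) = - ε n t n tends
-- to 0.  Evaluating the form of the minimal polynomial at (P (n - 1) , Q (n - 1)) gives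
-- A n = A 0 (t n)² - t n Q (n - 1) η 0.  As A n ≠ 0 is an algebraic integer with bounded
-- conjugate, it is bounded away from 0, and hence so is t n Q (n - 1).  Therefore
-- P / Q - ξ = - t² / (t Q) tends to 0.

open import Algebra.Bundles using (CommutativeRing; RawRing)
open import Algebra.Definitions.RawMagma using (_,_)
import Algebra.Definitions.RawSemiring as RawSemiringDefs
import Algebra.Solver.Ring
import Algebra.Solver.Ring.AlmostCommutativeRing as ACR
import Algebra.Solver.Ring.NaturalCoefficients.Default
open import Algebra.Structures using (IsCommutativeRing)
open import Data.Fin.Base as Fin using (Fin; toℕ; fromℕ<; combine)
import Data.Fin.Properties as Fin
open import Data.Integer.Base as ℤ using (ℤ; +_; -[1+_])
import Data.Integer.Properties as ℤ
import Data.Integer.Solver as ℤ-Solver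
open import Data.List.Base using ([]; _∷_; map)
open import Data.Maybe.Base using (Maybe; just; nothing)
open import Data.Nat.Base as ℕ using (ℕ; zero; suc)
open import Data.Nat.Divisibility using (divides; _∣_)
open import Data.Nat.Primality using (Prime; prime?; euclidsLemma)
import Data.Nat.Properties as ℕ
import Data.Nat.Solver as ℕ-Solver
open import Data.Product.Base using (∃-syntax; _×_; _,_; proj₁; proj₂)
open import Data.Rational.Base as ℚ using (ℚ; 0ℚ; 1ℚ; ½)
import Data.Rational.Properties as ℚ
import Data.Rational.Solver as ℚ-Solver
import Data.Rational.Unnormalised.Base as ℚᵘ
import Data.Rational.Unnormalised.Properties as ℚᵘ
open import Data.Sign.Base as Sign using (Sign)
open import Data.Sum.Base using (inj₁; inj₂; [_,_]′; reduce)
open import Defs using (module Polynomial; module Evaluation; module GoldenRing; Golden; ⟨_,_⟩)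
open import Function.Base using (_∘_; id)
open import Level using (0ℓ)
open import Relation.Binary.Bundles using (Preorder)
open import Relation.Binary.Definitions using (DecidableEquality)
import Relation.Binary.Reasoning.Preorder
import Relation.Binary.Reasoning.Setoid
open import Relation.Nullary using (¬_; Dec; yes; no; contradiction)
open import Relation.Nullary.Decidable using (from-yes)
open import Relation.Unary using (Pred; _∈_)

-- The constant 9/10 < 1 acts twice: it makes |A (n + 1)| ≤ 9/10 |A n| + |η 0| preserve a bounded
-- range, and it makes t n decay geometrically. A bound under one embedding alone would leave
-- infinitely many candidates, since 𝒪 is dense in ℝ. Bounds under both leave finitely many, and
-- integrality of the norm turns the upper bound on σ(A n) into a lower bound on A n. Irreducibility
-- enters through A n ≠ 0: A n is a value of a form that has only the trivial zero over 𝒪.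
--
-- η n equals A n times the difference between x n and the other root, so it is a square root of the
-- discriminant, which the substitutions preserve; inversion reverses the difference and flips the
-- sign. Given η, the equation 2 A n x n + B n = η n is linear in x n, and no choice between two
-- roots arises. This matters because equality of Cauchy reals is undecidable: a repetition is
-- detected among coefficients in 𝒪 and only then transferred to ℝ, and division is always backed by
-- an explicit inverse or by a lower bound.

module QuadraticForm (R : RawRing 0ℓ 0ℓ) where
  open RawRing R

  form : (A B C p q : Carrier) → Carrier
  form A B C p q = A * p * p + B * p * q + C * q * q

  -- The bilinear form F(u + v) - F(u) - F(v) attached to `form`, at u = (p , q) and v = (r , s).
  -- Doubling is a repeated summand because a raw ring has no numerals.
  polar : (A B C p q r s : Carrier) → Carrier
  polar A B C p q r s = (A * p * r + A * p * r) + B * (p * s + q * r) + (C * q * s + C * q * s)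

module QuadraticFormProperties (R : CommutativeRing 0ℓ 0ℓ) where
  open CommutativeRing R
  open QuadraticForm rawRing
  open Algebra.Solver.Ring.NaturalCoefficients.Default commutativeSemiring
    using (solve; _:+_; _:*_; _:=_; con)
  open Relation.Binary.Reasoning.Setoid setoid

  -- This and the next two identities are the base case of `orbit-coefficients`, where the
  -- convergent pairs are (1 , 0) and (a 0 , 1).
  form-1-0 : ∀ A B C → form A B C 1# 0# ≈ A
  form-1-0 = solve 3 (λ A B C → A :* con 1 :* con 1 :+ B :* con 1 :* con 0
    :+ C :* con 0 :* con 0 := A) refl

  form-a-1 : ∀ A B C a → form A B C a 1# ≈ A * a * a + B * a + C
  form-a-1 = solve 4 (λ A B C a → A :* a :* a :+ B :* a :* con 1
    :+ C :* con 1 :* con 1 := A :* a :* a :+ B :* a :+ C) refl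

  polar-a-1-1-0 : ∀ A B C a → polar A B C a 1# 1# 0# ≈ (A * a + A * a) + B
  polar-a-1-1-0 = solve 4 (λ A B C a →
    (A :* a :* con 1 :+ A :* a :* con 1) :+ B :* (a :* con 0 :+ con 1 :* con 1)
      :+ (C :* con 1 :* con 0 :+ C :* con 1 :* con 0)
    := (A :* a :+ A :* a) :+ B) refl

  -- Together with `polar-combine`, the induction step of `orbit-coefficients`: the arguments on the
  -- left follow the recurrence for P and Q, and the right sides have the shape of the coefficients
  -- produced by `shift`.
  form-combine : ∀ A B C a p q r s → form A B C (a * p + r) (a * q + s) ≈
    form A B C p q * a * a + polar A B C p q r s * a + form A B C r s
  form-combine = solve 8 (λ A B C a p q r s →
    A :* (a :* p :+ r) :* (a :* p :+ r) :+ B :* (a :* p :+ r) :* (a :* q :+ s)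
      :+ C :* (a :* q :+ s) :* (a :* q :+ s) :=
    (A :* p :* p :+ B :* p :* q :+ C :* q :* q) :* a :* a
    :+ ((A :* p :* r :+ A :* p :* r) :+ B :* (p :* s :+ q :* r)
      :+ (C :* q :* s :+ C :* q :* s)) :* a
    :+ (A :* r :* r :+ B :* r :* s :+ C :* s :* s)) refl

  polar-combine : ∀ A B C a p q r s → polar A B C (a * p + r) (a * q + s) p q ≈
    (form A B C p q * a + form A B C p q * a) + polar A B C p q r s
  polar-combine = solve 8 (λ A B C a p q r s →
    (A :* (a :* p :+ r) :* p :+ A :* (a :* p :+ r) :* p)
      :+ B :* ((a :* p :+ r) :* q :+ (a :* q :+ s) :* p)
      :+ (C :* (a :* q :+ s) :* q :+ C :* (a :* q :+ s) :* q) :=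
    ((A :* p :* p :+ B :* p :* q :+ C :* q :* q) :* a
      :+ (A :* p :* p :+ B :* p :* q :+ C :* q :* q) :* a)
    :+ ((A :* p :* r :+ A :* p :* r) :+ B :* (p :* s :+ q :* r)
      :+ (C :* q :* s :+ C :* q :* s))) refl

  -- F(p , 0) = A p² is a unit with inverse f e², so it could vanish only in the trivial ring.
  form-0≉0 : ¬ (0# ≈ 1#) → ∀ A B C f p e → A * f ≈ 1# → p * e ≈ 1# → ¬ (form A B C p 0# ≈ 0#)
  form-0≉0 0≉1 A B C f p e Af≈1 pe≈1 F≈0 = 0≉1 (begin
    0#                                      ≈⟨ zeroˡ (f * (e * e)) ⟨
    0# * (f * (e * e))                      ≈⟨ *-congʳ F≈0 ⟨
    form A B C p 0# * (f * (e * e))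
      ≈⟨ solve 6 (λ A B C f p e →
           (A :* p :* p :+ B :* p :* con 0 :+ C :* con 0 :* con 0) :* (f :* (e :* e)) :=
           (A :* f) :* ((p :* e) :* (p :* e))) refl A B C f p e ⟩
    (A * f) * ((p * e) * (p * e))           ≈⟨ *-cong Af≈1 (*-cong pe≈1 pe≈1) ⟩
    1# * (1# * 1#)                          ≈⟨ trans (*-identityˡ _) (*-identityˡ 1#) ⟩
    1#                                      ∎)

-- Evaluation of polynomials; irreducible quadratics have no zeros.

module PolynomialProperties (R : CommutativeRing 0ℓ 0ℓ) where
  open CommutativeRing R
  open Polynomial rawRing
  open Evaluation rawRing using () renaming (eval to evalᴿ)
  open QuadraticForm rawRing
  open Algebra.Solver.Ring.NaturalCoefficients.Default commutativeSemiring
    using (solve; _:+_; _:*_; _:=_; con)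
  open Relation.Binary.Reasoning.Setoid setoid

  infix 4 _≈ᴾ_
  _≈ᴾ_ : Poly → Poly → Set
  p ≈ᴾ q = ∀ n → coeff p n ≈ coeff q n

  ev = evalᴿ id

  ev-0 : ∀ p x → p ≈ᴾ [] → ev p x ≈ 0#
  ev-0 []      x h = refl
  ev-0 (c ∷ p) x h = begin
    c + x * ev p x   ≈⟨ +-cong (h 0) (*-congˡ (ev-0 p x (λ n → h (suc n)))) ⟩
    0# + x * 0#      ≈⟨ solve 1 (λ x → con 0 :+ x :* con 0 := con 0) refl x ⟩
    0#               ∎

  ev-cong : ∀ p q x → p ≈ᴾ q → ev p x ≈ ev q x
  ev-cong []      q       x h = sym (ev-0 q x (λ n → sym (h n)))
  ev-cong (c ∷ p) []      x h = ev-0 (c ∷ p) x h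
  ev-cong (c ∷ p) (d ∷ q) x h =
    +-cong (h 0) (*-congˡ (ev-cong p q x (λ n → h (suc n))))

  ev-+ : ∀ p q x → ev (p +ᴾ q) x ≈ ev p x + ev q x
  ev-+ []      q       x = sym (+-identityˡ _)
  ev-+ (c ∷ p) []      x = sym (+-identityʳ _)
  ev-+ (c ∷ p) (d ∷ q) x = begin
    c + d + x * ev (p +ᴾ q) x             ≈⟨ +-congˡ (*-congˡ (ev-+ p q x)) ⟩
    c + d + x * (ev p x + ev q x)
      ≈⟨ solve 5 (λ c d x u v → c :+ d :+ x :* (u :+ v) := (c :+ x :* u) :+ (d :+ x :* v))
           refl c d x (ev p x) (ev q x) ⟩
    (c + x * ev p x) + (d + x * ev q x)   ∎

  ev-map : ∀ c q x → ev (map (c *_) q) x ≈ c * ev q x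
  ev-map c []      x = sym (zeroʳ c)
  ev-map c (d ∷ q) x = begin
    c * d + x * ev (map (c *_) q) x   ≈⟨ +-congˡ (*-congˡ (ev-map c q x)) ⟩
    c * d + x * (c * ev q x)
      ≈⟨ solve 4 (λ c d x u → c :* d :+ x :* (c :* u) := c :* (d :+ x :* u)) refl c d x (ev q x) ⟩
    c * (d + x * ev q x)              ∎

  ev-* : ∀ p q x → ev (p *ᴾ q) x ≈ ev p x * ev q x
  ev-* []      q x = sym (zeroˡ _)
  ev-* (c ∷ p) q x = begin
    ev (map (c *_) q +ᴾ (0# ∷ (p *ᴾ q))) x
      ≈⟨ ev-+ (map (c *_) q) (0# ∷ (p *ᴾ q)) x ⟩
    ev (map (c *_) q) x + (0# + x * ev (p *ᴾ q) x)
      ≈⟨ +-cong (ev-map c q x) (+-congˡ (*-congˡ (ev-* p q x))) ⟩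
    c * ev q x + (0# + x * (ev p x * ev q x))
      ≈⟨ solve 4 (λ c x u v → c :* v :+ (con 0 :+ x :* (u :* v)) := (c :+ x :* u) :* v)
           refl c x (ev p x) (ev q x) ⟩
    (c + x * ev p x) * ev q x   ∎

  -- A linear polynomial with unit leading coefficient has the root - c / d, and evaluating the
  -- product there gives 0 = 1. Hence such a factor is not a unit, which is what contradicts
  -- irreducibility.
  linear∤1 : ¬ (0# ≈ 1#) → ∀ c d e → d * e ≈ 1# →
             ∀ p → ¬ (p *ᴾ (c ∷ d ∷ []) ≈ᴾ 1# ∷ [])
  linear∤1 0≉1 c d e de≈1 p h = 0≉1 (begin
    0#                       ≈⟨ sym (zeroʳ _) ⟩
    ev p x * 0#              ≈⟨ *-congˡ (sym root) ⟩
    ev p x * ev l x          ≈⟨ sym (ev-* p l x) ⟩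
    ev (p *ᴾ l) x            ≈⟨ ev-cong (p *ᴾ l) (1# ∷ []) x h ⟩
    1# + x * 0#              ≈⟨ +-congˡ (zeroʳ x) ⟩
    1# + 0#                  ≈⟨ +-identityʳ 1# ⟩
    1#                       ∎)
    where
    l : Poly
    l = c ∷ d ∷ []
    x : Carrier
    x = e * - c
    root : ev l x ≈ 0#
    root = begin
      c + x * (d + x * 0#)
        ≈⟨ solve 4 (λ c d e n → c :+ (e :* n) :* (d :+ (e :* n) :* con 0) := c :+ (d :* e) :* n)
             refl c d e (- c) ⟩
      c + (d * e) * - c   ≈⟨ +-congˡ (trans (*-congʳ de≈1) (*-identityˡ (- c))) ⟩
      c + - c             ≈⟨ -‿inverseʳ c ⟩
      0#                  ∎

  -- A zero (p , q) of the form with q invertible gives the factor q x - p.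
  irreducible⇒form≉0 : ¬ (0# ≈ 1#) → ∀ A B C → Irreducible (C ∷ B ∷ A ∷ []) →
    ∀ f p q e → A * f ≈ 1# → q * e ≈ 1# → ¬ (form A B C p q ≈ 0#)
  irreducible⇒form≉0 0≉1 A B C irr f p q e Af≈1 qe≈1 F≈0 =
    [ (λ { (r , h) → linear∤1 0≉1 (- p) q e qe≈1 r h })
    , (λ { (r , h) → linear∤1 0≉1 u v (q * f) leading r h })
    ]′ (RawSemiringDefs.Irreducible.split-∣1 irr {x = - p ∷ q ∷ []} {y = u ∷ v ∷ []} factorization)
    where
    -- Division by q x - p with e = 1 / q: the quotient v x + u has v = A / q and u = (A p + B q) /
    -- q². Writing both over e² lets `scaled` cancel every q e in pairs.
    u v : Carrier
    u = e * e * (A * p + B * q)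
    v = e * e * (A * q)

    scaled : ∀ x → x * (q * e) * (q * e) ≈ x
    scaled x = trans (*-cong (trans (*-congˡ qe≈1) (*-identityʳ x)) qe≈1) (*-identityʳ x)

    leading : v * (q * f) ≈ 1#
    leading = trans
      (solve 4 (λ A q e f → (e :* e :* (A :* q)) :* (q :* f) := (A :* f) :* (q :* e) :* (q :* e))
        refl A q e f)
      (trans (scaled (A * f)) Af≈1)

    factorization : C ∷ B ∷ A ∷ [] ≈ᴾ (- p ∷ q ∷ []) *ᴾ (u ∷ v ∷ [])
    factorization 0 = sym (begin
      - p * u + 0#
        -- The remainder of the division is F(p , q) / q²; the hypothesis that it vanishes is
        -- inserted here.
        ≈⟨ +-cong refl (sym (trans (*-congʳ F≈0) (zeroˡ (e * e)))) ⟩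
      - p * u + form A B C p q * (e * e)
        ≈⟨ solve 7 (λ A B C p q e n →
             n :* (e :* e :* (A :* p :+ B :* q))
               :+ (A :* p :* p :+ B :* p :* q :+ C :* q :* q) :* (e :* e) :=
             C :* (q :* e) :* (q :* e) :+ (p :+ n) :* (e :* e :* (A :* p :+ B :* q)))
             refl A B C p q e (- p) ⟩
      C * (q * e) * (q * e) + (p + - p) * u
        ≈⟨ +-cong (scaled C) (trans (*-congʳ (-‿inverseʳ p)) (zeroˡ u)) ⟩
      C + 0#
        ≈⟨ +-identityʳ C ⟩
      C ∎)
    factorization 1 = sym (begin
      - p * v + (q * u + 0#)
        ≈⟨ solve 6 (λ A B p q e n →
             n :* (e :* e :* (A :* q)) :+ (q :* (e :* e :* (A :* p :+ B :* q)) :+ con 0) :=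
             B :* (q :* e) :* (q :* e) :+ (p :+ n) :* (e :* e :* (A :* q)))
             refl A B p q e (- p) ⟩
      B * (q * e) * (q * e) + (p + - p) * v
        ≈⟨ +-cong (scaled B) (trans (*-congʳ (-‿inverseʳ p)) (zeroˡ v)) ⟩
      B + 0#
        ≈⟨ +-identityʳ B ⟩
      B ∎)
    factorization 2 = sym (begin
      q * v
        ≈⟨ solve 3 (λ A q e → q :* (e :* e :* (A :* q)) := A :* (q :* e) :* (q :* e)) refl A q e ⟩
      A * (q * e) * (q * e)
        ≈⟨ scaled A ⟩
      A ∎)
    factorization (suc (suc (suc n))) = refl

open import Relation.Binary.PropositionalEquality
  using (_≡_; _≢_; refl; sym; trans; cong; cong₂; subst; subst₂; isEquivalence; module ≡-Reasoning)

-- The commutative rings A[β].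

module GoldenCommutativeRing
  {A : Set} {_+_ _*_ : A → A → A} { -_ : A → A} {0# 1# : A}
  (isCommutativeRing : IsCommutativeRing _≡_ _+_ _*_ -_ 0# 1#)
  where

  private
    R : CommutativeRing 0ℓ 0ℓ
    R = record { isCommutativeRing = isCommutativeRing }

    module R = CommutativeRing R

    open Algebra.Solver.Ring.NaturalCoefficients.Default R.commutativeSemiring
      using (solve; _:+_; _:*_; _:=_; con)

    rawRing = GoldenRing.rawRing A _+_ _*_ -_ 0# 1#
    module G = RawRing rawRing

    *-comm : ∀ x y → x G.* y ≡ y G.* x
    *-comm ⟨ a , b ⟩ ⟨ c , d ⟩ = cong₂ ⟨_,_⟩
      (solve 4 (λ a b c d → a :* c :+ b :* d := c :* a :+ d :* b) refl a b c d)
      (solve 4 (λ a b c d → a :* d :+ b :* c :+ b :* d := c :* b :+ d :* a :+ d :* b) refl a b c d)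

    *-assoc : ∀ x y z → (x G.* y) G.* z ≡ x G.* (y G.* z)
    *-assoc ⟨ a , b ⟩ ⟨ c , d ⟩ ⟨ e , f ⟩ = cong₂ ⟨_,_⟩
      (solve 6 (λ a b c d e f →
        (a :* c :+ b :* d) :* e :+ (a :* d :+ b :* c :+ b :* d) :* f :=
        a :* (c :* e :+ d :* f) :+ b :* (c :* f :+ d :* e :+ d :* f)) refl a b c d e f)
      (solve 6 (λ a b c d e f →
        (a :* c :+ b :* d) :* f :+ (a :* d :+ b :* c :+ b :* d) :* e
          :+ (a :* d :+ b :* c :+ b :* d) :* f :=
        a :* (c :* f :+ d :* e :+ d :* f) :+ b :* (c :* e :+ d :* f)
          :+ b :* (c :* f :+ d :* e :+ d :* f)) refl a b c d e f)

    *-identityˡ : ∀ x → G.1# G.* x ≡ x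
    *-identityˡ ⟨ a , b ⟩ = cong₂ ⟨_,_⟩
      (solve 2 (λ a b → con 1 :* a :+ con 0 :* b := a) refl a b)
      (solve 2 (λ a b → con 1 :* b :+ con 0 :* a :+ con 0 :* b := b) refl a b)

    *-distribˡ : ∀ x y z → x G.* (y G.+ z) ≡ (x G.* y) G.+ (x G.* z)
    *-distribˡ ⟨ a , b ⟩ ⟨ c , d ⟩ ⟨ e , f ⟩ = cong₂ ⟨_,_⟩
      (solve 6 (λ a b c d e f → a :* (c :+ e) :+ b :* (d :+ f) :=
        (a :* c :+ b :* d) :+ (a :* e :+ b :* f)) refl a b c d e f)
      (solve 6 (λ a b c d e f → a :* (d :+ f) :+ b :* (c :+ e) :+ b :* (d :+ f) :=
        (a :* d :+ b :* c :+ b :* d) :+ (a :* f :+ b :* e :+ b :* f)) refl a b c d e f)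

  golden-commutativeRing : CommutativeRing 0ℓ 0ℓ
  golden-commutativeRing = record
    { Carrier = Golden A
    ; _≈_ = _≡_ ; _+_ = G._+_ ; _*_ = G._*_ ; -_ = G.-_ ; 0# = G.0# ; 1# = G.1#
    ; isCommutativeRing = record
      { isRing = record
        { +-isAbelianGroup = record
          { isGroup = record
            { isMonoid = record
              { isSemigroup = record
                { isMagma = record { isEquivalence = isEquivalence ; ∙-cong = cong₂ G._+_ }
                ; assoc = λ x y z → cong₂ ⟨_,_⟩ (R.+-assoc _ _ _) (R.+-assoc _ _ _)
                }
              ; identity = (λ x → cong₂ ⟨_,_⟩ (R.+-identityˡ _) (R.+-identityˡ _))
                         , (λ x → cong₂ ⟨_,_⟩ (R.+-identityʳ _) (R.+-identityʳ _))
              }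
            ; inverse = (λ x → cong₂ ⟨_,_⟩ (R.-‿inverseˡ _) (R.-‿inverseˡ _))
                      , (λ x → cong₂ ⟨_,_⟩ (R.-‿inverseʳ _) (R.-‿inverseʳ _))
            ; ⁻¹-cong = cong G.-_
            }
          ; comm = λ x y → cong₂ ⟨_,_⟩ (R.+-comm _ _) (R.+-comm _ _)
          }
        ; *-cong = cong₂ G._*_
        ; *-assoc = *-assoc
        ; *-identity = *-identityˡ , λ x → trans (*-comm x G.1#) (*-identityˡ x)
        ; distrib = *-distribˡ , λ x y z → trans (*-comm (y G.+ z) x)
            (trans (*-distribˡ x y z) (cong₂ G._+_ (*-comm x y) (*-comm x z)))
        }
      ; *-comm = *-comm
      }
    }

open import Defs

open RawRing 𝒪-rawRing using (0#; 1#) renaming (_+_ to _+ᴼ_; _*_ to _*ᴼ_; -_ to -ᴼ_)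
open RawRing K-rawRing using () renaming (_+_ to _+ᴷ_; _*_ to _*ᴷ_; -_ to -ᴷ_; 0# to 0ᴷ; 1# to 1ᴷ)
open QuadraticForm 𝒪-rawRing using (form; polar)
open QuadraticForm K-rawRing using () renaming (form to formᴷ)
open QuadraticForm ℝ-rawRing using () renaming (form to formᴿ)

golden-≟ : {A : Set} → DecidableEquality A → DecidableEquality (Golden A)
golden-≟ _≟_ ⟨ a , b ⟩ ⟨ c , d ⟩ with a ≟ c | b ≟ d
... | yes a≡c | yes b≡d = yes (cong₂ ⟨_,_⟩ a≡c b≡d)
... | no  a≢c | _       = no λ eq → a≢c (cong rat eq)
... | yes _   | no  b≢d = no λ eq → b≢d (cong gold eq)

𝒪-commutativeRing K-commutativeRing : CommutativeRing 0ℓ 0ℓ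
𝒪-commutativeRing = GoldenCommutativeRing.golden-commutativeRing ℤ.+-*-isCommutativeRing
K-commutativeRing = GoldenCommutativeRing.golden-commutativeRing ℚ.+-*-isCommutativeRing

_≟ᴼ_ : DecidableEquality 𝒪
_≟ᴼ_ = golden-≟ ℤ._≟_

-- Integers inside the rationals.

ι : ℤ → ℚ
ι z = z ℚ./ 1

-- The laws of `ι` are proved on unnormalised fractions, where z / 1 involves no gcd, and carried
-- back along `toℚᵘ`.
toℚᵘ-ι : ∀ z → ℚ.toℚᵘ (ι z) ℚᵘ.≃ ℚᵘ.mkℚᵘ z 0
toℚᵘ-ι z = ℚ.toℚᵘ-fromℚᵘ (ℚᵘ.mkℚᵘ z 0)

ι-+ : ∀ x y → ι (x ℤ.+ y) ≡ ι x ℚ.+ ι y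
ι-+ x y = ℚ.toℚᵘ-injective (begin-equality
  ℚ.toℚᵘ (ι (x ℤ.+ y))               ≃⟨ toℚᵘ-ι (x ℤ.+ y) ⟩
  ℚᵘ.mkℚᵘ (x ℤ.+ y) 0                ≃⟨ ℚᵘ.*≡* (identity x y) ⟩
  ℚᵘ.mkℚᵘ x 0 ℚᵘ.+ ℚᵘ.mkℚᵘ y 0       ≃⟨ ℚᵘ.+-cong (toℚᵘ-ι x) (toℚᵘ-ι y) ⟨
  ℚ.toℚᵘ (ι x) ℚᵘ.+ ℚ.toℚᵘ (ι y)     ≃⟨ ℚ.toℚᵘ-homo-+ (ι x) (ι y) ⟨
  ℚ.toℚᵘ (ι x ℚ.+ ι y)               ∎)
  where
  open ℚᵘ.≤-Reasoning
  open ℤ-Solver.+-*-Solver using (solve; _:*_; _:+_; _:=_; con)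
  identity : ∀ x y → (x ℤ.+ y) ℤ.* + 1 ≡ (x ℤ.* + 1 ℤ.+ y ℤ.* + 1) ℤ.* + 1
  identity = solve 2 (λ x y → (x :+ y) :* con (+ 1) :=
    (x :* con (+ 1) :+ y :* con (+ 1)) :* con (+ 1)) refl

ι-* : ∀ x y → ι (x ℤ.* y) ≡ ι x ℚ.* ι y
ι-* x y = ℚ.toℚᵘ-injective (begin-equality
  ℚ.toℚᵘ (ι (x ℤ.* y))               ≃⟨ toℚᵘ-ι (x ℤ.* y) ⟩
  ℚᵘ.mkℚᵘ x 0 ℚᵘ.* ℚᵘ.mkℚᵘ y 0       ≃⟨ ℚᵘ.*-cong (toℚᵘ-ι x) (toℚᵘ-ι y) ⟨
  ℚ.toℚᵘ (ι x) ℚᵘ.* ℚ.toℚᵘ (ι y)     ≃⟨ ℚ.toℚᵘ-homo-* (ι x) (ι y) ⟨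
  ℚ.toℚᵘ (ι x ℚ.* ι y)               ∎)
  where open ℚᵘ.≤-Reasoning

ι-neg : ∀ x → ι (ℤ.- x) ≡ ℚ.- ι x
ι-neg x = ℚ.toℚᵘ-injective (begin-equality
  ℚ.toℚᵘ (ι (ℤ.- x))      ≃⟨ toℚᵘ-ι (ℤ.- x) ⟩
  ℚᵘ.- ℚᵘ.mkℚᵘ x 0        ≃⟨ ℚᵘ.-‿cong (toℚᵘ-ι x) ⟨
  ℚᵘ.- ℚ.toℚᵘ (ι x)       ≃⟨ ℚ.toℚᵘ-homo‿- (ι x) ⟨
  ℚ.toℚᵘ (ℚ.- ι x)        ∎)
  where open ℚᵘ.≤-Reasoning

ι-mono-≤ : ∀ {x y} → x ℤ.≤ y → ι x ℚ.≤ ι y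
ι-mono-≤ {x} {y} x≤y = ℚ.toℚᵘ-cancel-≤ (begin
  ℚ.toℚᵘ (ι x)     ≃⟨ toℚᵘ-ι x ⟩
  ℚᵘ.mkℚᵘ x 0      ≤⟨ ℚᵘ.*≤* (ℤ.*-monoʳ-≤-nonNeg (+ 1) x≤y) ⟩
  ℚᵘ.mkℚᵘ y 0      ≃⟨ toℚᵘ-ι y ⟨
  ℚ.toℚᵘ (ι y)     ∎)
  where open ℚᵘ.≤-Reasoning

ι-cancel-≤ : ∀ {x y} → ι x ℚ.≤ ι y → x ℤ.≤ y
ι-cancel-≤ {x} {y} ιx≤ιy = ℤ.*-cancelʳ-≤-pos x y (+ 1) (ℚᵘ.drop-*≤* (begin
  ℚᵘ.mkℚᵘ x 0      ≃⟨ toℚᵘ-ι x ⟨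
  ℚ.toℚᵘ (ι x)     ≤⟨ ℚ.toℚᵘ-mono-≤ ιx≤ιy ⟩
  ℚ.toℚᵘ (ι y)     ≃⟨ toℚᵘ-ι y ⟩
  ℚᵘ.mkℚᵘ y 0      ∎))
  where open ℚᵘ.≤-Reasoning

ι-injective : ∀ {x y} → ι x ≡ ι y → x ≡ y
ι-injective eq = ℤ.≤-antisym (ι-cancel-≤ (ℚ.≤-reflexive eq)) (ι-cancel-≤ (ℚ.≤-reflexive (sym eq)))

-- Irrationality of √5.

module _ where
  open ℕ-Solver.+-*-Solver using (solve; _:*_; _:=_; con)

  prime[5] : Prime 5
  prime[5] = from-yes (prime? 5)

  m*m≡0⇒m≡0 : ∀ m → m ℕ.* m ≡ 0 → m ≡ 0
  m*m≡0⇒m≡0 zero _ = refl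

  -- Infinite descent: 5 divides m, say m = 5 l, and then n * n ≡ 5 * (l * l) with n < m.
  m*m≡5n*n⇒m≡0 : ∀ m n → m ℕ.* m ≡ 5 ℕ.* (n ℕ.* n) → m ≡ 0
  m*m≡5n*n⇒m≡0 m n = descent m m n ℕ.≤-refl
    where
    descent : ∀ k m n → m ℕ.≤ k → m ℕ.* m ≡ 5 ℕ.* (n ℕ.* n) → m ≡ 0
    descent zero    m n m≤k eq = ℕ.n≤0⇒n≡0 m≤k
    descent (suc k) m n m≤k eq = step (n ℕ.≤? k)
      (reduce
        (euclidsLemma m m prime[5] (divides (n ℕ.* n) (trans eq (ℕ.*-comm 5 (n ℕ.* n))))))
      where
      n≡0⇒m≡0 : n ≡ 0 → m ≡ 0
      n≡0⇒m≡0 n≡0 = m*m≡0⇒m≡0 m (trans eq (cong (λ z → 5 ℕ.* (z ℕ.* z)) n≡0))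

      n²≡5l² : ∀ l → m ≡ l ℕ.* 5 → n ℕ.* n ≡ 5 ℕ.* (l ℕ.* l)
      n²≡5l² l m≡l*5 = ℕ.*-cancelˡ-≡ (n ℕ.* n) (5 ℕ.* (l ℕ.* l)) 5
        (trans (sym eq) (trans (cong₂ ℕ._*_ m≡l*5 m≡l*5)
          (solve 1 (λ l → (l :* con 5) :* (l :* con 5) := con 5 :* (con 5 :* (l :* l))) refl l)))

      step : Dec (n ℕ.≤ k) → 5 ∣ m → m ≡ 0
      step (yes n≤k) (divides l m≡l*5) = n≡0⇒m≡0 (descent k n l n≤k (n²≡5l² l m≡l*5))
      -- In this case 1 ≤ n and m ≤ n, so 5 n * n would exceed m * m.
      step (no  n≰k) _ = contradiction (begin-strict
          m ℕ.* m          ≤⟨ ℕ.*-mono-≤ m≤k m≤k ⟩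
          suc k ℕ.* suc k  ≤⟨ ℕ.*-mono-≤ (ℕ.≰⇒> n≰k) (ℕ.≰⇒> n≰k) ⟩
          n ℕ.* n          <⟨ ℕ.m<m+n (n ℕ.* n) {4 ℕ.* (n ℕ.* n)}
                                (ℕ.≤-trans (ℕ.s≤s ℕ.z≤n) (ℕ.*-monoʳ-≤ 4 (ℕ.*-mono-≤ 1≤n 1≤n))) ⟩
          5 ℕ.* (n ℕ.* n)  ≡⟨ sym eq ⟩
          m ℕ.* m          ∎) (ℕ.<-irrefl refl)
        where
        open ℕ.≤-Reasoning
        1≤n : 1 ℕ.≤ n
        1≤n = ℕ.≤-trans (ℕ.s≤s ℕ.z≤n) (ℕ.≰⇒> n≰k)

-- Norms and conjugates in 𝒪

norm : 𝒪 → ℤ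
norm ⟨ a , b ⟩ = a ℤ.* a ℤ.+ a ℤ.* b ℤ.- b ℤ.* b

module _ where
  open ℤ-Solver.+-*-Solver using (solve; _:*_; _:+_; _:-_; :-_; _:=_; con)

  -- Completing the square gives 4 N(α) = (2 a + b)² - 5 b², so the irrationality of √5 applies to 2
  -- a + b and b.
  norm≡0⇒≡0 : ∀ α → norm α ≡ + 0 → α ≡ ⟨ + 0 , + 0 ⟩
  norm≡0⇒≡0 ⟨ a , b ⟩ N≡0 = cong₂ ⟨_,_⟩ a≡0 b≡0
    where
    m : ℤ
    m = + 2 ℤ.* a ℤ.+ b

    m²≡5b² : m ℤ.* m ≡ + 5 ℤ.* (b ℤ.* b)
    m²≡5b² = trans
      (solve 2 (λ a b → (con (+ 2) :* a :+ b) :* (con (+ 2) :* a :+ b) :=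
        con (+ 4) :* (a :* a :+ a :* b :- b :* b) :+ con (+ 5) :* (b :* b)) refl a b)
      (trans (cong (λ N → + 4 ℤ.* N ℤ.+ + 5 ℤ.* (b ℤ.* b)) N≡0) (ℤ.+-identityˡ _))

    ∣m∣²≡5∣b∣² : ℤ.∣ m ∣ ℕ.* ℤ.∣ m ∣ ≡ 5 ℕ.* (ℤ.∣ b ∣ ℕ.* ℤ.∣ b ∣)
    ∣m∣²≡5∣b∣² = trans (sym (ℤ.abs-* m m)) (trans (cong ℤ.∣_∣ m²≡5b²)
      (trans (ℤ.abs-* (+ 5) (b ℤ.* b)) (cong (5 ℕ.*_) (ℤ.abs-* b b))))

    m≡0 : m ≡ + 0
    m≡0 = ℤ.∣i∣≡0⇒i≡0 (m*m≡5n*n⇒m≡0 ℤ.∣ m ∣ ℤ.∣ b ∣ ∣m∣²≡5∣b∣²)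

    b≡0 : b ≡ + 0
    b≡0 = reduce (ℤ.i*j≡0⇒i≡0∨j≡0 b
      (ℤ.*-cancelˡ-≡ (+ 5) (b ℤ.* b) (+ 0) (trans (sym m²≡5b²) (cong₂ ℤ._*_ m≡0 m≡0))))

    a≡0 : a ≡ + 0
    a≡0 = ℤ.*-cancelˡ-≡ (+ 2) a (+ 0) (trans
      (trans (sym (ℤ.+-identityʳ (+ 2 ℤ.* a))) (cong (λ z → + 2 ℤ.* a ℤ.+ z) (sym b≡0))) m≡0)

  *-σ : ∀ α → α *ᴼ σ α ≡ ⟨ norm α , + 0 ⟩
  *-σ ⟨ a , b ⟩ = cong₂ ⟨_,_⟩
    (solve 2 (λ a b → a :* (a :+ b) :+ b :* (:- b) := a :* a :+ a :* b :- b :* b) refl a b)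
    (solve 2 (λ a b → a :* (:- b) :+ b :* (a :+ b) :+ b :* (:- b) := con (+ 0)) refl a b)

  σ-+ : ∀ α γ → σ (α +ᴼ γ) ≡ σ α +ᴼ σ γ
  σ-+ ⟨ a , b ⟩ ⟨ c , d ⟩ = cong₂ ⟨_,_⟩
    (solve 4 (λ a b c d → (a :+ c) :+ (b :+ d) := (a :+ b) :+ (c :+ d)) refl a b c d)
    (ℤ.neg-distrib-+ b d)

  σ-* : ∀ α γ → σ (α *ᴼ γ) ≡ σ α *ᴼ σ γ
  σ-* ⟨ a , b ⟩ ⟨ c , d ⟩ = cong₂ ⟨_,_⟩
    (solve 4 (λ a b c d → (a :* c :+ b :* d) :+ (a :* d :+ b :* c :+ b :* d) :=
      (a :+ b) :* (c :+ d) :+ (:- b) :* (:- d)) refl a b c d)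
    (solve 4 (λ a b c d → :- (a :* d :+ b :* c :+ b :* d) :=
      (a :+ b) :* (:- d) :+ (:- b) :* (c :+ d) :+ (:- b) :* (:- d)) refl a b c d)

  σ-neg : ∀ α → σ (-ᴼ α) ≡ -ᴼ σ α
  σ-neg ⟨ a , b ⟩ = cong₂ ⟨_,_⟩ (sym (ℤ.neg-distrib-+ a b)) refl

  σ≡0⇒≡0 : ∀ α → σ α ≡ 0# → α ≡ 0#
  σ≡0⇒≡0 ⟨ a , b ⟩ eq = cong₂ ⟨_,_⟩
    (trans (solve 2 (λ a b → a := (a :+ b) :+ (:- b)) refl a b)
      (cong₂ ℤ._+_ (cong rat eq) (cong gold eq)))
    (trans (sym (ℤ.neg-involutive b)) (cong ℤ.-_ (cong gold eq)))

𝒪→K-+ : ∀ α γ → 𝒪→K (α +ᴼ γ) ≡ 𝒪→K α +ᴷ 𝒪→K γ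
𝒪→K-+ ⟨ a , b ⟩ ⟨ c , d ⟩ = cong₂ ⟨_,_⟩ (ι-+ a c) (ι-+ b d)

𝒪→K-* : ∀ α γ → 𝒪→K (α *ᴼ γ) ≡ 𝒪→K α *ᴷ 𝒪→K γ
𝒪→K-* ⟨ a , b ⟩ ⟨ c , d ⟩ = cong₂ ⟨_,_⟩
  (trans (ι-+ (a ℤ.* c) (b ℤ.* d)) (cong₂ ℚ._+_ (ι-* a c) (ι-* b d)))
  (trans (ι-+ (a ℤ.* d ℤ.+ b ℤ.* c) (b ℤ.* d))
    (cong₂ ℚ._+_ (trans (ι-+ (a ℤ.* d) (b ℤ.* c)) (cong₂ ℚ._+_ (ι-* a d) (ι-* b c))) (ι-* b d)))

-- The inverse is σ(α) / N(α), and the integer N(α) is nonzero.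
𝒪→K-inverse : ∀ α → α ≢ 0# → ∃[ e ] (𝒪→K α *ᴷ e ≡ 1ᴷ)
𝒪→K-inverse α α≢0 = 𝒪→K (σ α) *ᴷ ⟨ ℚ.1/ N , 0ℚ ⟩ , (begin
  𝒪→K α *ᴷ (𝒪→K (σ α) *ᴷ ⟨ ℚ.1/ N , 0ℚ ⟩)
    ≡⟨ K.*-assoc (𝒪→K α) (𝒪→K (σ α)) ⟨ ℚ.1/ N , 0ℚ ⟩ ⟨
  (𝒪→K α *ᴷ 𝒪→K (σ α)) *ᴷ ⟨ ℚ.1/ N , 0ℚ ⟩
    ≡⟨ cong (_*ᴷ ⟨ ℚ.1/ N , 0ℚ ⟩) (trans (sym (𝒪→K-* α (σ α))) (cong 𝒪→K (*-σ α))) ⟩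
  ⟨ N , 0ℚ ⟩ *ᴷ ⟨ ℚ.1/ N , 0ℚ ⟩
    ≡⟨ cong₂ ⟨_,_⟩
         (trans (ℚ.+-identityʳ (N ℚ.* (ℚ.1/ N))) (ℚ.*-inverseʳ N))
         (trans (ℚ.+-identityʳ _) (cong₂ ℚ._+_ (ℚ.*-zeroʳ N) (ℚ.*-zeroˡ (ℚ.1/ N)))) ⟩
  1ᴷ ∎)
  where
  open ≡-Reasoning
  module K = CommutativeRing K-commutativeRing
  N : ℚ
  N = ι (norm α)
  instance
    N≢0 : ℚ.NonZero N
    N≢0 = ℚ.≢-nonZero λ N≡0 → α≢0 (norm≡0⇒≡0 α (ι-injective N≡0))

𝒪→K-form : ∀ A B C p q →
  𝒪→K (form A B C p q) ≡ formᴷ (𝒪→K A) (𝒪→K B) (𝒪→K C) (𝒪→K p) (𝒪→K q)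
𝒪→K-form A B C p q = trans (𝒪→K-+ (A *ᴼ p *ᴼ p +ᴼ B *ᴼ p *ᴼ q) (C *ᴼ q *ᴼ q)) (cong₂ _+ᴷ_
  (trans (𝒪→K-+ (A *ᴼ p *ᴼ p) (B *ᴼ p *ᴼ q)) (cong₂ _+ᴷ_ (cubic A p p) (cubic B p q)))
  (cubic C q q))
  where
  cubic : ∀ x y z → 𝒪→K (x *ᴼ y *ᴼ z) ≡ 𝒪→K x *ᴷ 𝒪→K y *ᴷ 𝒪→K z
  cubic x y z = trans (𝒪→K-* (x *ᴼ y) z) (cong (_*ᴷ 𝒪→K z) (𝒪→K-* x y))

-- Anisotropy of the form of a minimal polynomial.

0≢1 : 0ᴷ ≢ 1ᴷ
0≢1 ()

Anisotropic : (A B C : 𝒪) → Set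
Anisotropic A B C = ∀ p q → form A B C p q ≡ 0# → p ≡ 0# × q ≡ 0#

-- A zero with q ≠ 0 would give a root p / q in K and hence a factorization. With q = 0 the value is
-- A p², and A ≠ 0 because the degree is 2.
minimal⇒anisotropic : ∀ {A B C x} → IsMinimalQuadratic A B C x → Anisotropic A B C
minimal⇒anisotropic {A} {B} {C} min p q F≡0 = p≡0 , q≡0
  where
  A≢0 : A ≢ 0#
  A≢0 refl = proj₁ (IsMinimalQuadratic.degree min) refl

  f = 𝒪→K-inverse A A≢0

  formᴷ≡0 : formᴷ (𝒪→K A) (𝒪→K B) (𝒪→K C) (𝒪→K p) (𝒪→K q) ≡ 0ᴷ
  formᴷ≡0 = trans (sym (𝒪→K-form A B C p q)) (cong 𝒪→K F≡0)

  q≡0 : q ≡ 0#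
  q≡0 with q ≟ᴼ 0#
  ... | yes eq  = eq
  ... | no  q≢0 = contradiction formᴷ≡0
    (PolynomialProperties.irreducible⇒form≉0 K-commutativeRing 0≢1 (𝒪→K A) (𝒪→K B) (𝒪→K C)
      (OverK.IsMinimalPolynomial.irreducible (IsMinimalQuadratic.isMinimal min))
      (proj₁ f) (𝒪→K p) (𝒪→K q) (proj₁ e) (proj₂ f) (proj₂ e))
    where e = 𝒪→K-inverse q q≢0

  p≡0 : p ≡ 0#
  p≡0 with p ≟ᴼ 0#
  ... | yes eq  = eq
  ... | no  p≢0 = contradiction
      (trans (cong (formᴷ (𝒪→K A) (𝒪→K B) (𝒪→K C) (𝒪→K p)) (cong 𝒪→K (sym q≡0))) formᴷ≡0)
      (QuadraticFormProperties.form-0≉0 K-commutativeRing 0≢1 (𝒪→K A) (𝒪→K B) (𝒪→K C)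
        (proj₁ f) (𝒪→K p) (proj₁ e) (proj₂ f) (proj₂ e))
    where e = 𝒪→K-inverse p p≢0

-- Finiteness of boxes in 𝒪

natural-bound : ∀ q → ∃[ T ] (q ℚ.≤ ι (+ T))
natural-bound q@(ℚ.mkℚ n d _) = ℤ.∣ n ∣ , ℚ.toℚᵘ-cancel-≤ (begin
  ℚᵘ.mkℚᵘ n d                ≤⟨ ℚᵘ.*≤* (ℤ.≤-trans (ℤ.≤-reflexive (ℤ.*-identityʳ n)) (n≤ n)) ⟩
  ℚᵘ.mkℚᵘ (+ ℤ.∣ n ∣) 0      ≃⟨ toℚᵘ-ι (+ ℤ.∣ n ∣) ⟨
  ℚ.toℚᵘ (ι (+ ℤ.∣ n ∣))     ∎)
  where
  open ℚᵘ.≤-Reasoning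
  n≤ : ∀ n → n ℤ.≤ + ℤ.∣ n ∣ ℤ.* + suc d
  n≤ (+ n)    = subst (+ n ℤ.≤_) (ℤ.pos-* n (suc d)) (ℤ.+≤+ (ℕ.m≤m*n n (suc d)))
  n≤ -[1+ n ] = ℤ.-≤+

i*i≡+∣i∣*∣i∣ : ∀ i → i ℤ.* i ≡ + (ℤ.∣ i ∣ ℕ.* ℤ.∣ i ∣)
i*i≡+∣i∣*∣i∣ (+ n)    = sym (ℤ.pos-* n n)
i*i≡+∣i∣*∣i∣ -[1+ n ] = refl

m≤m*m : ∀ m → m ℕ.≤ m ℕ.* m
m≤m*m zero    = ℕ.z≤n
m≤m*m (suc m) = ℕ.m≤m*n (suc m) (suc m)

-- The trace of α², that is α² + σ(α)², written as a sum of squares in which both coordinates of α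
-- occur. It converts bounds under the two embeddings into bounds on coordinates.
sumOfSquares : 𝒪 → ℕ
sumOfSquares ⟨ a , b ⟩ =
  (ℤ.∣ a ∣ ℕ.* ℤ.∣ a ∣ ℕ.+ ℤ.∣ b ∣ ℕ.* ℤ.∣ b ∣) ℕ.+
  (ℤ.∣ a ℤ.+ b ∣ ℕ.* ℤ.∣ a ℤ.+ b ∣ ℕ.+ ℤ.∣ b ∣ ℕ.* ℤ.∣ b ∣)

α²+σα² : ∀ α → α *ᴼ α +ᴼ σ α *ᴼ σ α ≡ ⟨ + sumOfSquares α , + 0 ⟩
α²+σα² ⟨ a , b ⟩ = cong₂ ⟨_,_⟩
  (trans
    (solve 2 (λ a b →
      (a :* a :+ b :* b) :+ ((a :+ b) :* (a :+ b) :+ (:- b) :* (:- b)) :=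
      (a :* a :+ b :* b) :+ ((a :+ b) :* (a :+ b) :+ b :* b)) refl a b)
    (cong₂ ℤ._+_ (cong₂ ℤ._+_ (i*i≡+∣i∣*∣i∣ a) (i*i≡+∣i∣*∣i∣ b))
      (cong₂ ℤ._+_ (i*i≡+∣i∣*∣i∣ (a ℤ.+ b)) (i*i≡+∣i∣*∣i∣ b))))
  (solve 2 (λ a b →
    (a :* b :+ b :* a :+ b :* b) :+
    ((a :+ b) :* (:- b) :+ (:- b) :* (a :+ b) :+ (:- b) :* (:- b)) :=
    con (+ 0)) refl a b)
  where open ℤ-Solver.+-*-Solver using (solve; _:*_; _:+_; :-_; _:=_; con)

Box : ℕ → 𝒪 → Set
Box T α = ℤ.∣ rat α ∣ ℕ.≤ T × ℤ.∣ gold α ∣ ℕ.≤ T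

sign-code : Sign → Fin 2
sign-code Sign.+ = Fin.zero
sign-code Sign.- = Fin.suc Fin.zero

sign-code-injective : ∀ {s t} → sign-code s ≡ sign-code t → s ≡ t
sign-code-injective {Sign.+} {Sign.+} _ = refl
sign-code-injective { Sign.- } { Sign.- } _ = refl

ℤ-code : ∀ {T} i → ℤ.∣ i ∣ ℕ.≤ T → Fin (2 ℕ.* suc T)
ℤ-code i le = combine (sign-code (ℤ.sign i)) (fromℕ< (ℕ.s≤s le))

ℤ-code-injective : ∀ {T} i j (le : ℤ.∣ i ∣ ℕ.≤ T) (le′ : ℤ.∣ j ∣ ℕ.≤ T) →
  ℤ-code i le ≡ ℤ-code j le′ → i ≡ j
ℤ-code-injective i j le le′ eq =
  let s≡ , n≡ = Fin.combine-injective (sign-code (ℤ.sign i)) (fromℕ< (ℕ.s≤s le))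
                  (sign-code (ℤ.sign j)) (fromℕ< (ℕ.s≤s le′)) eq
  in trans (sym (ℤ.signᵢ◃∣i∣≡i i)) (trans
       (cong₂ ℤ._◃_ (sign-code-injective s≡) (Fin.fromℕ<-injective _ _ (ℕ.s≤s le) (ℕ.s≤s le′) n≡))
       (ℤ.signᵢ◃∣i∣≡i j))

𝒪-size : ℕ → ℕ
𝒪-size T = (2 ℕ.* suc T) ℕ.* (2 ℕ.* suc T)

𝒪-code : ∀ {T} α → Box T α → Fin (𝒪-size T)
𝒪-code α (le₁ , le₂) = combine (ℤ-code (rat α) le₁) (ℤ-code (gold α) le₂)

𝒪-code-injective : ∀ {T} α γ (b : Box T α) (b′ : Box T γ) → 𝒪-code α b ≡ 𝒪-code γ b′ → α ≡ γ
𝒪-code-injective α γ (le₁ , le₂) (le₁′ , le₂′) eq =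
  let r≡ , g≡ = Fin.combine-injective (ℤ-code (rat α) le₁) (ℤ-code (gold α) le₂)
                  (ℤ-code (rat γ) le₁′) (ℤ-code (gold γ) le₂′) eq
  in cong₂ ⟨_,_⟩ (ℤ-code-injective (rat α) (rat γ) le₁ le₁′ r≡)
                 (ℤ-code-injective (gold α) (gold γ) le₂ le₂′ g≡)

-- Pigeonhole principle, with pairs from the box coded injectively in a finite set.
repetition : ∀ {T} (u v : ℕ → 𝒪) → (∀ n → Box T (u n)) → (∀ n → Box T (v n)) →
  ∃[ i ] ∃[ j ] (i ℕ.< j × u i ≡ u j × v i ≡ v j)
repetition {T} u v bu bv = go (Fin.pigeonhole (ℕ.n<1+n size) (code ∘ toℕ))
  where
  size : ℕ
  size = 𝒪-size T ℕ.* 𝒪-size T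

  code : ℕ → Fin size
  code n = combine (𝒪-code (u n) (bu n)) (𝒪-code (v n) (bv n))

  go : ∃[ i ] ∃[ j ] (i Fin.< j × code (toℕ i) ≡ code (toℕ j)) →
       ∃[ i ] ∃[ j ] (i ℕ.< j × u i ≡ u j × v i ≡ v j)
  go (i , j , i<j , eq) =
    let u≡ , v≡ = Fin.combine-injective
                    (𝒪-code (u (toℕ i)) (bu (toℕ i))) (𝒪-code (v (toℕ i)) (bv (toℕ i)))
                    (𝒪-code (u (toℕ j)) (bu (toℕ j))) (𝒪-code (v (toℕ j)) (bv (toℕ j))) eq
    in toℕ i , toℕ j , i<j , 
       𝒪-code-injective (u (toℕ i)) (u (toℕ j)) (bu (toℕ i)) (bu (toℕ j)) u≡ ,
       𝒪-code-injective (v (toℕ i)) (v (toℕ j)) (bv (toℕ i)) (bv (toℕ j)) v≡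

-- Lets the convergents of `σ ∘ a` be studied as the images under the second embedding of those of
-- `a`.
recurrence-σ : ∀ a u v n → recurrence (σ ∘ a) (σ u) (σ v) n ≡ σ (recurrence a u v n)
recurrence-σ a u v zero          = refl
recurrence-σ a u v (suc zero)    =
  trans (cong (_+ᴼ σ u) (sym (σ-* (a 1) v))) (sym (σ-+ (a 1 *ᴼ v) u))
recurrence-σ a u v (suc (suc n)) =
  trans (cong₂ (λ α γ → σ (a (2 ℕ.+ n)) *ᴼ α +ᴼ γ)
      (recurrence-σ a u v (suc n)) (recurrence-σ a u v n))
    (trans (cong (_+ᴼ σ (recurrence a u v n)) (sym (σ-* (a (2 ℕ.+ n)) (recurrence a u v (suc n)))))
      (sym (σ-+ (a (2 ℕ.+ n) *ᴼ recurrence a u v (suc n)) (recurrence a u v n))))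

-- The ring of real numbers

Vanishing : (ℕ → ℚ) → Set
Vanishing s = ∀ ε → 0ℚ ℚ.< ε → ∃[ N ] (∀ n → N ℕ.≤ n → ℚ.∣ s n ∣ ℚ.< ε)

vanishing-resp : ∀ {s t} → (∀ n → s n ≡ t n) → Vanishing s → Vanishing t
vanishing-resp eq v ε ε>0 = proj₁ (v ε ε>0) , λ n N≤n →
  subst (λ r → ℚ.∣ r ∣ ℚ.< ε) (eq n) (proj₂ (v ε ε>0) n N≤n)

vanishing-dominated : ∀ {s t} → (∀ n → ℚ.∣ t n ∣ ℚ.≤ ℚ.∣ s n ∣) → Vanishing s → Vanishing t
vanishing-dominated le v ε ε>0 = proj₁ (v ε ε>0) , λ n N≤n →
  ℚ.≤-<-trans (le n) (proj₂ (v ε ε>0) n N≤n)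

vanishing-0 : Vanishing (λ _ → 0ℚ)
vanishing-0 ε ε>0 = 0 , λ _ _ → ε>0

vanishing-+ : ∀ {s t} → Vanishing s → Vanishing t → Vanishing (λ n → s n ℚ.+ t n)
vanishing-+ v w ε ε>0 = M ℕ.⊔ N , λ n le → Lemmas.triangle
    (proj₂ V n (ℕ.m⊔n≤o⇒m≤o M N le)) (proj₂ W n (ℕ.m⊔n≤o⇒n≤o M N le))
  where
  V = v (½ ℚ.* ε) (Lemmas.half-pos ε>0)
  W = w (½ ℚ.* ε) (Lemmas.half-pos ε>0)
  M N : ℕ
  M = proj₁ V
  N = proj₁ W

-- A Cauchy sequence is eventually bounded by some B, so ε / B is the accuracy to ask of t.
vanishing-* : ∀ {s t} → IsCauchy s → Vanishing t → Vanishing (λ n → s n ℚ.* t n)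
vanishing-* {s} {t} c v ε ε>0 = go (Lemmas.bound s c)
  where
  go : ∃[ B ] (0ℚ ℚ.< B × ∃[ M ] (∀ n → M ℕ.≤ n → ℚ.∣ s n ∣ ℚ.≤ B)) →
       ∃[ N ] (∀ n → N ℕ.≤ n → ℚ.∣ s n ℚ.* t n ∣ ℚ.< ε)
  go (B , B>0 , M , s≤B) = M ℕ.⊔ N , λ n le →
      subst (ℚ.∣ s n ℚ.* t n ∣ ℚ.<_) (proj₂ (proj₂ δ))
        (Lemmas.*-abs-mono (s≤B n (ℕ.m⊔n≤o⇒m≤o M N le)) B>0
          (proj₂ V n (ℕ.m⊔n≤o⇒n≤o M N le)))
    where
    δ = Lemmas.shrink B ε B>0 ε>0
    V = v (proj₁ δ) (proj₁ (proj₂ δ))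
    N : ℕ
    N = proj₁ V

module _ where
  open ℚ-Solver.+-*-Solver using (solve; _:+_; _:*_; _:-_; :-_; _:=_)

  pointwise : ∀ {x y} → (∀ n → seq x n ≡ seq y n) → x ≃ y
  pointwise {x} {y} eq = mk≃ (vanishing-resp
    (λ n → trans (sym (ℚ.+-inverseʳ (seq x n))) (cong (λ r → seq x n ℚ.- r) (eq n))) vanishing-0)

  ≃-refl : ∀ {x} → x ≃ x
  ≃-refl = pointwise (λ _ → refl)

  ≃-sym : ∀ {x y} → x ≃ y → y ≃ x
  ≃-sym {x} {y} (mk≃ v) = mk≃ (vanishing-dominated
    (λ n → ℚ.≤-reflexive (Lemmas.swap-∣-∣ (seq y n) (seq x n))) v)

  ≃-trans : ∀ {x y z} → x ≃ y → y ≃ z → x ≃ z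
  ≃-trans {x} {y} {z} (mk≃ v) (mk≃ w) = mk≃ (vanishing-resp
    (λ n → solve 3 (λ a b c → (a :- b) :+ (b :- c) := a :- c) refl (seq x n) (seq y n) (seq z n))
    (vanishing-+ v w))

  +-cong : ∀ {x y u v} → x ≃ y → u ≃ v → x + u ≃ y + v
  +-cong {x} {y} {u} {v} (mk≃ p) (mk≃ q) = mk≃ (vanishing-resp
    (λ n → Lemmas.interchange (seq x n) (seq y n) (seq u n) (seq v n)) (vanishing-+ p q))

  *-cong : ∀ {x y u v} → x ≃ y → u ≃ v → x * u ≃ y * v
  *-cong {x} {y} {u} {v} (mk≃ p) (mk≃ q) = mk≃ (vanishing-resp
    (λ n → Lemmas.product-diff (seq x n) (seq y n) (seq u n) (seq v n))
    (vanishing-+ {λ n → seq x n ℚ.* (seq u n ℚ.- seq v n)} {λ n → seq v n ℚ.* (seq x n ℚ.- seq y n)}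
      (vanishing-* {seq x} {λ n → seq u n ℚ.- seq v n} (cauchy x) q)
      (vanishing-* {seq v} {λ n → seq x n ℚ.- seq y n} (cauchy v) p)))

  -‿cong : ∀ {x y} → x ≃ y → - x ≃ - y
  -‿cong {x} {y} (mk≃ p) = mk≃ (vanishing-dominated
    (λ n → ℚ.≤-reflexive (trans (cong ℚ.∣_∣ (sym (Lemmas.neg-diff (seq x n) (seq y n))))
      (Lemmas.swap-∣-∣ (seq y n) (seq x n)))) p)

  ∣-∣-cong : ∀ {x y} → x ≃ y → ∣ x ∣ ≃ ∣ y ∣
  ∣-∣-cong {x} {y} (mk≃ p) = mk≃ (vanishing-dominated
    (λ n → Lemmas.abs-diff (seq x n) (seq y n)) p)

ℝ-commutativeRing : CommutativeRing 0ℓ 0ℓ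
ℝ-commutativeRing = record
  { Carrier = ℝ ; _≈_ = _≃_ ; _+_ = _+_ ; _*_ = _*_ ; -_ = -_ ; 0# = 0ℝ ; 1# = 1ℝ
  ; isCommutativeRing = record
    { isRing = record
      { +-isAbelianGroup = record
        { isGroup = record
          { isMonoid = record
            { isSemigroup = record
              { isMagma = record
                { isEquivalence = record { refl = ≃-refl ; sym = ≃-sym ; trans = ≃-trans }
                ; ∙-cong = +-cong
                }
              ; assoc = λ x y z → pointwise λ n → ℚ.+-assoc (seq x n) (seq y n) (seq z n)
              }
            ; identity = (λ x → pointwise λ n → ℚ.+-identityˡ (seq x n))
                       , (λ x → pointwise λ n → ℚ.+-identityʳ (seq x n))
            }
          ; inverse = (λ x → pointwise λ n → ℚ.+-inverseˡ (seq x n))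
                    , (λ x → pointwise λ n → ℚ.+-inverseʳ (seq x n))
          ; ⁻¹-cong = -‿cong
          }
        ; comm = λ x y → pointwise λ n → ℚ.+-comm (seq x n) (seq y n)
        }
      ; *-cong = *-cong
      ; *-assoc = λ x y z → pointwise λ n → ℚ.*-assoc (seq x n) (seq y n) (seq z n)
      ; *-identity = (λ x → pointwise λ n → ℚ.*-identityˡ (seq x n))
                   , (λ x → pointwise λ n → ℚ.*-identityʳ (seq x n))
      ; distrib = (λ x y z → pointwise λ n → ℚ.*-distribˡ-+ (seq x n) (seq y n) (seq z n))
                , (λ x y z → pointwise λ n → ℚ.*-distribʳ-+ (seq x n) (seq y n) (seq z n))
      }
    ; *-comm = λ x y → pointwise λ n → ℚ.*-comm (seq x n) (seq y n)
    }
  }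

fromℚ-cong : ∀ {p q} → p ≡ q → fromℚ p ≃ fromℚ q
fromℚ-cong refl = ≃-refl

ℝ-almostCommutativeRing : ACR.AlmostCommutativeRing 0ℓ 0ℓ
ℝ-almostCommutativeRing = ACR.fromCommutativeRing ℝ-commutativeRing

-- With rational coefficients the ring solver can compute with constants such as ½ and 9/10.
fromℚ-morphism : ℚ.+-*-rawRing ACR.-Raw-AlmostCommutative⟶ ℝ-almostCommutativeRing
fromℚ-morphism = record
  { ⟦_⟧    = fromℚ
  ; +-homo = λ p q → pointwise λ _ → refl
  ; *-homo = λ p q → pointwise λ _ → refl
  ; -‿homo = λ p → pointwise λ _ → refl
  ; 0-homo = ≃-refl
  ; 1-homo = ≃-refl
  }

ℚ-weaklyDecidable : ∀ p q → Maybe (fromℚ p ≃ fromℚ q)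
ℚ-weaklyDecidable p q with p ℚ.≟ q
... | yes eq = just (fromℚ-cong eq)
... | no  _  = nothing

module ℝ-Solver = Algebra.Solver.Ring
  ℚ.+-*-rawRing ℝ-almostCommutativeRing fromℚ-morphism ℚ-weaklyDecidable

-- The square root of 5

fraction : ∀ k n → + k ℚ./ suc n ≡ ι (+ k) ℚ.* (+ 1 ℚ./ suc n)
fraction k n = ℚ.toℚᵘ-injective (begin-equality
  ℚ.toℚᵘ (+ k ℚ./ suc n)
    ≃⟨ ℚ.toℚᵘ-fromℚᵘ (ℚᵘ.mkℚᵘ (+ k) n) ⟩
  ℚᵘ.mkℚᵘ (+ k) n
    ≃⟨ ℚᵘ.*≡* (trans (cong (λ m → + k ℤ.* + suc m) (ℕ.+-identityʳ n))
         (cong (ℤ._* + suc n) (sym (ℤ.*-identityʳ (+ k))))) ⟩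
  ℚᵘ.mkℚᵘ (+ k) 0 ℚᵘ.* ℚᵘ.mkℚᵘ (+ 1) n
    ≃⟨ ℚᵘ.*-cong (toℚᵘ-ι (+ k)) (ℚ.toℚᵘ-fromℚᵘ (ℚᵘ.mkℚᵘ (+ 1) n)) ⟨
  ℚ.toℚᵘ (ι (+ k)) ℚᵘ.* ℚ.toℚᵘ (+ 1 ℚ./ suc n)
    ≃⟨ ℚ.toℚᵘ-homo-* (ι (+ k)) (+ 1 ℚ./ suc n) ⟨
  ℚ.toℚᵘ (ι (+ k) ℚ.* (+ 1 ℚ./ suc n)) ∎)
  where open ℚᵘ.≤-Reasoning

n*1/n≡1 : ∀ n → ι (+ suc n) ℚ.* (+ 1 ℚ./ suc n) ≡ 1ℚ
n*1/n≡1 n = trans (sym (fraction (suc n) n)) (ℚ.toℚᵘ-injective (ℚᵘ.≃-trans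
  (ℚ.toℚᵘ-fromℚᵘ (ℚᵘ.mkℚᵘ (+ suc n) n)) (ℚᵘ.*≡* (ℤ.*-comm (+ suc n) (+ 1)))))

0≤1/ : ∀ n → 0ℚ ℚ.≤ + 1 ℚ./ suc n
0≤1/ n = ℚ.toℚᵘ-cancel-≤ (ℚᵘ.≤-respʳ-≃ (ℚᵘ.≃-sym (ℚ.toℚᵘ-fromℚᵘ (ℚᵘ.mkℚᵘ (+ 1) n)))
  (ℚᵘ.nonNegative⁻¹ (ℚᵘ.mkℚᵘ (+ 1) n)))

1/-vanishing : Vanishing (λ n → + 1 ℚ./ suc n)
1/-vanishing ε ε>0 = proj₁ A , λ n N≤n →
  subst (ℚ._< ε) (sym (ℚ.0≤p⇒∣p∣≡p (0≤1/ n))) (proj₂ A n N≤n)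
  where A = √-Lemmas.archimedean ε ε>0

isqrt-error : ∀ m k → k ℕ.* k ℕ.≤ m → m ℕ.< suc k ℕ.* suc k →
  ∃[ r ] (m ≡ k ℕ.* k ℕ.+ r × r ℕ.≤ 2 ℕ.* k)
isqrt-error m k k²≤m m<[1+k]² = r , sym (ℕ.m+[n∸m]≡n k²≤m) ,
  ℕ.+-cancelˡ-≤ (suc (k ℕ.* k)) r (2 ℕ.* k) (begin
    suc (k ℕ.* k) ℕ.+ r          ≡⟨ cong suc (ℕ.m+[n∸m]≡n k²≤m) ⟩
    suc m                        ≤⟨ m<[1+k]² ⟩
    suc k ℕ.* suc k              ≡⟨ solve 1 (λ k → (con 1 :+ k) :* (con 1 :+ k) :=
                                      (con 1 :+ k :* k) :+ con 2 :* k) refl k ⟩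
    suc (k ℕ.* k) ℕ.+ 2 ℕ.* k    ∎)
  where
  open ℕ.≤-Reasoning
  open ℕ-Solver.+-*-Solver using (solve; _:*_; _:+_; _:=_; con)
  r : ℕ
  r = m ℕ.∸ k ℕ.* k

-- With N = n + 1, k = isqrt (5 N²) and 5 N² = k² + r, the error 5 - (k / N)² is
-- r / N², where r ≤ 2 k ≤ 6 N.
√5-error : ∀ n → ∃[ e ] (√-seq 5 n ℚ.* √-seq 5 n ℚ.+ e ≡ ι (+ 5) ×
                         ℚ.∣ e ∣ ℚ.≤ ι (+ 6) ℚ.* (+ 1 ℚ./ suc n))
√5-error n = e , square , error≤
  where
  N k r : ℕ
  N = suc n
  k = isqrt (5 ℕ.* (N ℕ.* N))
  error = isqrt-error (5 ℕ.* (N ℕ.* N)) k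
    (√-Lemmas.isqrt-lower (5 ℕ.* (N ℕ.* N))) (√-Lemmas.isqrt-upper (5 ℕ.* (N ℕ.* N)))
  r = proj₁ error

  u e : ℚ
  u = + 1 ℚ./ N
  e = ι (+ r) ℚ.* (u ℚ.* u)

  u²-nonNeg : ℚ.NonNegative (u ℚ.* u)
  u²-nonNeg = ℚ.nonNegative (subst (ℚ._≤ u ℚ.* u) (ℚ.*-zeroˡ u)
    (ℚ.*-monoʳ-≤-nonNeg u {{ℚ.nonNegative (0≤1/ n)}} (0≤1/ n)))

  Nu≡1 : ι (+ N) ℚ.* u ≡ 1ℚ
  Nu≡1 = n*1/n≡1 n

  ι5N² : ι (+ 5) ℚ.* (ι (+ N) ℚ.* ι (+ N)) ≡ ι (+ k) ℚ.* ι (+ k) ℚ.+ ι (+ r)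
  ι5N² = begin
    ι (+ 5) ℚ.* (ι (+ N) ℚ.* ι (+ N))       ≡⟨ cong (ι (+ 5) ℚ.*_) (ι-* (+ N) (+ N)) ⟨
    ι (+ 5) ℚ.* ι (+ N ℤ.* + N)             ≡⟨ ι-* (+ 5) (+ N ℤ.* + N) ⟨
    ι (+ 5 ℤ.* (+ N ℤ.* + N))               ≡⟨ cong ι (trans (cong (+ 5 ℤ.*_) (sym (ℤ.pos-* N N)))
                                                 (sym (ℤ.pos-* 5 (N ℕ.* N)))) ⟩
    ι (+ (5 ℕ.* (N ℕ.* N)))                 ≡⟨ cong (λ m → ι (+ m)) (proj₁ (proj₂ error)) ⟩
    ι (+ (k ℕ.* k) ℤ.+ + r)                 ≡⟨ ι-+ (+ (k ℕ.* k)) (+ r) ⟩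
    ι (+ (k ℕ.* k)) ℚ.+ ι (+ r)             ≡⟨ cong (λ z → ι z ℚ.+ ι (+ r)) (ℤ.pos-* k k) ⟩
    ι (+ k ℤ.* + k) ℚ.+ ι (+ r)             ≡⟨ cong (ℚ._+ ι (+ r)) (ι-* (+ k) (+ k)) ⟩
    ι (+ k) ℚ.* ι (+ k) ℚ.+ ι (+ r)         ∎
    where open ≡-Reasoning

  square : √-seq 5 n ℚ.* √-seq 5 n ℚ.+ e ≡ ι (+ 5)
  square = begin
    √-seq 5 n ℚ.* √-seq 5 n ℚ.+ e
      ≡⟨ cong (λ s → s ℚ.* s ℚ.+ e) (trans (√-seq-def 5 n) (fraction k n)) ⟩
    (ι (+ k) ℚ.* u) ℚ.* (ι (+ k) ℚ.* u) ℚ.+ e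
      ≡⟨ collect (ι (+ k)) (ι (+ r)) u ⟩
    (ι (+ k) ℚ.* ι (+ k) ℚ.+ ι (+ r)) ℚ.* (u ℚ.* u)
      ≡⟨ cong (ℚ._* (u ℚ.* u)) ι5N² ⟨
    ι (+ 5) ℚ.* (ι (+ N) ℚ.* ι (+ N)) ℚ.* (u ℚ.* u)
      ≡⟨ regroup (ι (+ 5)) (ι (+ N)) u ⟩
    ι (+ 5) ℚ.* ((ι (+ N) ℚ.* u) ℚ.* (ι (+ N) ℚ.* u))
      ≡⟨ cong (λ z → ι (+ 5) ℚ.* (z ℚ.* z)) Nu≡1 ⟩
    ι (+ 5) ∎
    where
    open ≡-Reasoning
    open ℚ-Solver.+-*-Solver using (solve; _:*_; _:+_; _:=_)
    collect : ∀ k r u → (k ℚ.* u) ℚ.* (k ℚ.* u) ℚ.+ r ℚ.* (u ℚ.* u) ≡ (k ℚ.* k ℚ.+ r) ℚ.* (u ℚ.* u)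
    collect = solve 3 (λ k r u → (k :* u) :* (k :* u) :+ r :* (u :* u) :=
      (k :* k :+ r) :* (u :* u)) refl
    regroup : ∀ c N u → c ℚ.* (N ℚ.* N) ℚ.* (u ℚ.* u) ≡ c ℚ.* ((N ℚ.* u) ℚ.* (N ℚ.* u))
    regroup = solve 3 (λ c N u → c :* (N :* N) :* (u :* u) := c :* ((N :* u) :* (N :* u))) refl

  k≤3N : k ℕ.≤ 3 ℕ.* N
  k≤3N = ℕ.<⇒≤ (√-Lemmas.sq-cancel-< (begin-strict
    k ℕ.* k                        ≤⟨ √-Lemmas.isqrt-lower (5 ℕ.* (N ℕ.* N)) ⟩
    5 ℕ.* (N ℕ.* N)                <⟨ ℕ.*-monoˡ-< (N ℕ.* N) {5} {9} (ℕ.s≤s (ℕ.m≤m+n 5 3)) ⟩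
    9 ℕ.* (N ℕ.* N)                ≡⟨ solve 1 (λ N → con 9 :* (N :* N) :=
                                        (con 3 :* N) :* (con 3 :* N)) refl N ⟩
    (3 ℕ.* N) ℕ.* (3 ℕ.* N)        ∎))
    where
    open ℕ.≤-Reasoning
    open ℕ-Solver.+-*-Solver using (solve; _:*_; _:=_; con)

  r≤6N : + r ℤ.≤ + 6 ℤ.* + N
  r≤6N = subst (+ r ℤ.≤_) (ℤ.pos-* 6 N) (ℤ.+≤+ (ℕ.≤-trans (proj₂ (proj₂ error))
    (ℕ.≤-trans (ℕ.*-monoʳ-≤ 2 k≤3N) (ℕ.≤-reflexive (sym (ℕ.*-assoc 2 3 N))))))

  error≤ : ℚ.∣ e ∣ ℚ.≤ ι (+ 6) ℚ.* u
  error≤ = begin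
    ℚ.∣ e ∣
      ≡⟨ ℚ.0≤p⇒∣p∣≡p 0≤e ⟩
    ι (+ r) ℚ.* (u ℚ.* u)
      ≤⟨ ℚ.*-monoʳ-≤-nonNeg (u ℚ.* u) {{u²-nonNeg}} (ι-mono-≤ {+ r} {+ 6 ℤ.* + N} r≤6N) ⟩
    ι (+ 6 ℤ.* + N) ℚ.* (u ℚ.* u)
      ≡⟨ cong (ℚ._* (u ℚ.* u)) (ι-* (+ 6) (+ N)) ⟩
    ι (+ 6) ℚ.* ι (+ N) ℚ.* (u ℚ.* u)
      ≡⟨ regroup (ι (+ 6)) (ι (+ N)) u ⟩
    ι (+ 6) ℚ.* ((ι (+ N) ℚ.* u) ℚ.* u)
      ≡⟨ cong (λ z → ι (+ 6) ℚ.* (z ℚ.* u)) Nu≡1 ⟩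
    ι (+ 6) ℚ.* (1ℚ ℚ.* u)
      ≡⟨ cong (ι (+ 6) ℚ.*_) (ℚ.*-identityˡ u) ⟩
    ι (+ 6) ℚ.* u ∎
    where
    open ℚ.≤-Reasoning
    open ℚ-Solver.+-*-Solver using (solve; _:*_; _:+_; _:=_)
    regroup : ∀ c N u → c ℚ.* N ℚ.* (u ℚ.* u) ≡ c ℚ.* ((N ℚ.* u) ℚ.* u)
    regroup = solve 3 (λ c N u → c :* N :* (u :* u) := c :* ((N :* u) :* u)) refl
    0≤e : 0ℚ ℚ.≤ e
    0≤e = subst (ℚ._≤ e) (ℚ.*-zeroˡ (u ℚ.* u))
      (ℚ.*-monoʳ-≤-nonNeg (u ℚ.* u) {{u²-nonNeg}} (ι-mono-≤ {+ 0} {+ r} (ℤ.+≤+ ℕ.z≤n)))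

9/10 1/10 : ℚ
9/10 = + 9 ℚ./ 10
1/10 = + 1 ℚ./ 10

-- Geometric decay

decay : ℕ → ℚ
decay zero    = 1ℚ
decay (suc n) = 9/10 ℚ.* decay n

0≤decay : ∀ n → 0ℚ ℚ.≤ decay n
0≤decay zero    = ℚ.<⇒≤ Lemmas.0<1
0≤decay (suc n) = subst (ℚ._≤ 9/10 ℚ.* decay n) (ℚ.*-zeroʳ 9/10)
  (ℚ.*-monoˡ-≤-nonNeg 9/10 (0≤decay n))

-- The shift by 9 makes the induction work: 9 (n + 10) ≤ 10 (n + 9).
decay*[9+n]≤9 : ∀ n → decay n ℚ.* ι (+ (9 ℕ.+ n)) ℚ.≤ ι (+ 9)
decay*[9+n]≤9 zero    = ℚ.≤-refl
decay*[9+n]≤9 (suc n) = begin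
  9/10 ℚ.* decay n ℚ.* ι (+ (10 ℕ.+ n))
    ≡⟨ cong (9/10 ℚ.* decay n ℚ.*_) (ι-+ (+ 10) (+ n)) ⟩
  9/10 ℚ.* decay n ℚ.* (ι (+ 10) ℚ.+ ι (+ n))
    ≡⟨ regroup (decay n) (ι (+ n)) ⟩
  decay n ℚ.* (ι (+ 9) ℚ.+ 9/10 ℚ.* ι (+ n))
    ≤⟨ ℚ.*-monoˡ-≤-nonNeg (decay n) {{ℚ.nonNegative (0≤decay n)}}
         (ℚ.+-monoʳ-≤ (ι (+ 9)) (ℚ.*-monoʳ-≤-nonNeg (ι (+ n)) {{ℚ.nonNegative 0≤n}} 9/10≤1)) ⟩
  decay n ℚ.* (ι (+ 9) ℚ.+ 1ℚ ℚ.* ι (+ n))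
    ≡⟨ cong (λ z → decay n ℚ.* (ι (+ 9) ℚ.+ z)) (ℚ.*-identityˡ (ι (+ n))) ⟩
  decay n ℚ.* (ι (+ 9) ℚ.+ ι (+ n))
    ≡⟨ cong (decay n ℚ.*_) (ι-+ (+ 9) (+ n)) ⟨
  decay n ℚ.* ι (+ (9 ℕ.+ n))
    ≤⟨ decay*[9+n]≤9 n ⟩
  ι (+ 9) ∎
  where
  open ℚ.≤-Reasoning
  0≤n : 0ℚ ℚ.≤ ι (+ n)
  0≤n = ι-mono-≤ {+ 0} {+ n} (ℤ.+≤+ ℕ.z≤n)
  9/10≤1 : 9/10 ℚ.≤ 1ℚ
  9/10≤1 = ℚ.≤ᵇ⇒≤ _
  regroup : ∀ d z → 9/10 ℚ.* d ℚ.* (ι (+ 10) ℚ.+ z) ≡ d ℚ.* (ι (+ 9) ℚ.+ 9/10 ℚ.* z)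
  regroup = solve 2 (λ d z → con 9/10 :* d :* (con (ι (+ 10)) :+ z) :=
    d :* (con (ι (+ 9)) :+ con 9/10 :* z)) refl
    where open ℚ-Solver.+-*-Solver using (solve; _:*_; _:+_; _:=_; con)

-- Comparison with a harmonic sequence avoids logarithms: (n + 1) decay n ≤ (n + 9) decay n ≤ 9.
decay-vanishing : Vanishing decay
decay-vanishing = vanishing-dominated {λ n → ι (+ 9) ℚ.* (+ 1 ℚ./ suc n)} {decay}
  (λ n → ℚ.≤-trans (ℚ.≤-reflexive (ℚ.0≤p⇒∣p∣≡p (0≤decay n)))
    (ℚ.≤-trans (bound n) (Lemmas.p≤∣p∣ (ι (+ 9) ℚ.* (+ 1 ℚ./ suc n)))))
  (vanishing-* {λ _ → ι (+ 9)} {λ n → + 1 ℚ./ suc n} (Lemmas.const-cauchy (ι (+ 9))) 1/-vanishing)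
  where
  open ℚ.≤-Reasoning
  bound : ∀ n → decay n ℚ.≤ ι (+ 9) ℚ.* (+ 1 ℚ./ suc n)
  bound n = begin
    decay n
      ≡⟨ ℚ.*-identityʳ (decay n) ⟨
    decay n ℚ.* 1ℚ
      ≡⟨ cong (decay n ℚ.*_) (n*1/n≡1 n) ⟨
    decay n ℚ.* (ι (+ suc n) ℚ.* u)
      ≡⟨ ℚ.*-assoc (decay n) (ι (+ suc n)) u ⟨
    decay n ℚ.* ι (+ suc n) ℚ.* u
      ≤⟨ ℚ.*-monoʳ-≤-nonNeg u {{u≥0}} (ℚ.*-monoˡ-≤-nonNeg (decay n) {{ℚ.nonNegative (0≤decay n)}}
           (ι-mono-≤ {+ suc n} {+ (9 ℕ.+ n)} (ℤ.+≤+ (ℕ.+-monoˡ-≤ n {1} {9} (ℕ.s≤s ℕ.z≤n))))) ⟩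
    decay n ℚ.* ι (+ (9 ℕ.+ n)) ℚ.* u
      ≤⟨ ℚ.*-monoʳ-≤-nonNeg u {{u≥0}} (decay*[9+n]≤9 n) ⟩
    ι (+ 9) ℚ.* u ∎
    where
    u : ℚ
    u = + 1 ℚ./ suc n
    u≥0 : ℚ.NonNegative u
    u≥0 = ℚ.nonNegative (0≤1/ n)

decay-small : ∀ c δ → 0ℚ ℚ.< δ → ∃[ N ] (∀ n → N ℕ.≤ n → c ℚ.* decay n ℚ.≤ δ)
decay-small c δ δ>0 = proj₁ V , λ n N≤n →
  ℚ.≤-trans (Lemmas.p≤∣p∣ (c ℚ.* decay n)) (ℚ.<⇒≤ (proj₂ V n N≤n))
  where V = vanishing-* {λ _ → c} {decay} (Lemmas.const-cauchy c) decay-vanishing δ δ>0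

module _ where
  open ℚ-Solver.+-*-Solver using (solve; _:+_; _:*_; _:-_; :-_; _:=_)

  q-[q-p]≡p : ∀ p q → q ℚ.- (q ℚ.- p) ≡ p
  q-[q-p]≡p = solve 2 (λ p q → q :- (q :- p) := p) refl

  q+[p-q]≡p : ∀ p q → q ℚ.+ (p ℚ.- q) ≡ p
  q+[p-q]≡p = solve 2 (λ p q → q :+ (p :- q) := p) refl

  -p*-p≡p*p : ∀ p → ℚ.- p ℚ.* ℚ.- p ≡ p ℚ.* p
  -p*-p≡p*p = solve 1 (λ p → :- p :* :- p := p :* p) refl

module ≃-Reasoning = Relation.Binary.Reasoning.Setoid (CommutativeRing.setoid ℝ-commutativeRing)

√5*√5≃5 : √ 5 * √ 5 ≃ fromℚ (ι (+ 5))
√5*√5≃5 = mk≃ (vanishing-dominated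
  {λ n → ι (+ 6) ℚ.* (+ 1 ℚ./ suc n)} {λ n → √-seq 5 n ℚ.* √-seq 5 n ℚ.- ι (+ 5)}
  (λ n → let e , square , e≤ = √5-error n in
    subst (ℚ._≤ ℚ.∣ ι (+ 6) ℚ.* (+ 1 ℚ./ suc n) ∣)
      (trans (sym (ℚ.∣-p∣≡∣p∣ e)) (cong ℚ.∣_∣
        (trans (shift (√-seq 5 n ℚ.* √-seq 5 n) e)
          (cong (λ z → √-seq 5 n ℚ.* √-seq 5 n ℚ.- z) square))))
      (ℚ.≤-trans e≤ (Lemmas.p≤∣p∣ (ι (+ 6) ℚ.* (+ 1 ℚ./ suc n)))))
  (vanishing-* {λ _ → ι (+ 6)} {λ n → + 1 ℚ./ suc n} (Lemmas.const-cauchy (ι (+ 6))) 1/-vanishing))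
  where
  open ℚ-Solver.+-*-Solver using (solve; _:+_; _:-_; :-_; _:=_)
  shift : ∀ s e → ℚ.- e ≡ s ℚ.- (s ℚ.+ e)
  shift = solve 2 (λ s e → :- e := s :- (s :+ e)) refl

-- The order of the real numbers

infix 4 _≤_

-- Order is expressed through absolute values, so that sums and products of
-- nonnegative reals are handled by congruence from their rational counterparts.
record NonNegative (x : ℝ) : Set where
  constructor mkNonNegative
  field ∣x∣≃x : ∣ x ∣ ≃ x

record _≤_ (x y : ℝ) : Set where
  constructor mk≤
  field difference : NonNegative (y - x)

open _≤_

open ℝ-Solver using (solve; _:+_; _:*_; _:-_; :-_; _:=_; con)
open ACR._-Raw-AlmostCommutative⟶_

nonNeg-pointwise : ∀ {x} → (∀ n → 0ℚ ℚ.≤ seq x n) → NonNegative x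
nonNeg-pointwise h = mkNonNegative (pointwise λ n → ℚ.0≤p⇒∣p∣≡p (h n))

nonNeg-resp : ∀ {x y} → x ≃ y → NonNegative x → NonNegative y
nonNeg-resp eq (mkNonNegative p) =
  mkNonNegative (≃-trans (∣-∣-cong (≃-sym eq)) (≃-trans p eq))

∣x*y∣≃∣x∣*∣y∣ : ∀ x y → ∣ x * y ∣ ≃ ∣ x ∣ * ∣ y ∣
∣x*y∣≃∣x∣*∣y∣ x y = pointwise λ n → ℚ.∣p*q∣≡∣p∣*∣q∣ (seq x n) (seq y n)

∣-x∣≃∣x∣ : ∀ x → ∣ - x ∣ ≃ ∣ x ∣
∣-x∣≃∣x∣ x = pointwise λ n → ℚ.∣-p∣≡∣p∣ (seq x n)

∣x∣²≃x² : ∀ x → ∣ x ∣ ² ≃ x ²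
∣x∣²≃x² x = ≃-trans (≃-sym (∣x*y∣≃∣x∣*∣y∣ x x)) (pointwise square)
  where
  square : ∀ n → ℚ.∣ seq x n ℚ.* seq x n ∣ ≡ seq x n ℚ.* seq x n
  square n with ℚ.∣p∣≡p∨∣p∣≡-p (seq x n)
  ... | inj₁ e = trans (ℚ.∣p*q∣≡∣p∣*∣q∣ (seq x n) (seq x n)) (cong₂ ℚ._*_ e e)
  ... | inj₂ e = trans (ℚ.∣p*q∣≡∣p∣*∣q∣ (seq x n) (seq x n))
      (trans (cong₂ ℚ._*_ e e) (-p*-p≡p*p (seq x n)))

nonNeg-∣-∣ : ∀ x → NonNegative ∣ x ∣
nonNeg-∣-∣ x = nonNeg-pointwise λ n → ℚ.0≤∣p∣ (seq x n)

nonNeg-+ : ∀ {x y} → NonNegative x → NonNegative y → NonNegative (x + y)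
nonNeg-+ {x} {y} (mkNonNegative p) (mkNonNegative q) = nonNeg-resp (+-cong p q)
  (nonNeg-pointwise λ n → ℚ.+-mono-≤ (ℚ.0≤∣p∣ (seq x n)) (ℚ.0≤∣p∣ (seq y n)))

nonNeg-* : ∀ {x y} → NonNegative x → NonNegative y → NonNegative (x * y)
nonNeg-* {x} {y} (mkNonNegative p) (mkNonNegative q) =
  nonNeg-resp (≃-trans (∣x*y∣≃∣x∣*∣y∣ x y) (*-cong p q)) (nonNeg-∣-∣ (x * y))

nonNeg-² : ∀ x → NonNegative (x ²)
nonNeg-² x = nonNeg-resp (∣x∣²≃x² x) (nonNeg-* (nonNeg-∣-∣ x) (nonNeg-∣-∣ x))

nonNeg-fromℚ : ∀ {p} → 0ℚ ℚ.≤ p → NonNegative (fromℚ p)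
nonNeg-fromℚ 0≤p = nonNeg-pointwise λ _ → 0≤p

nonNeg-literal : ∀ p {{_ : ℚ.NonNegative p}} → NonNegative (fromℚ p)
nonNeg-literal p = nonNeg-fromℚ (ℚ.nonNegative⁻¹ p)

≤-by : ∀ {x y z} → NonNegative z → z ≃ y - x → x ≤ y
≤-by z≥0 eq = mk≤ (nonNeg-resp eq z≥0)

≤-pointwise : ∀ {x y} → (∀ n → seq x n ℚ.≤ seq y n) → x ≤ y
≤-pointwise {x} {y} h = mk≤ (nonNeg-pointwise λ n →
  subst (ℚ._≤ seq y n ℚ.- seq x n) (ℚ.+-inverseʳ (seq x n))
    (ℚ.+-monoˡ-≤ (ℚ.- seq x n) (h n)))

≤-reflexive : ∀ {x y} → x ≃ y → x ≤ y
≤-reflexive {x} {y} eq = ≤-by (nonNeg-fromℚ ℚ.≤-refl)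
  (≃-trans (solve 1 (λ x → con 0ℚ := x :- x) ≃-refl x) (+-cong eq ≃-refl))

≤-trans : ∀ {x y z} → x ≤ y → y ≤ z → x ≤ z
≤-trans {x} {y} {z} p q = ≤-by (nonNeg-+ (difference p) (difference q))
  (solve 3 (λ x y z → (y :- x) :+ (z :- y) := z :- x) ≃-refl x y z)

+-mono-≤ : ∀ {x y u v} → x ≤ y → u ≤ v → x + u ≤ y + v
+-mono-≤ {x} {y} {u} {v} p q = ≤-by (nonNeg-+ (difference p) (difference q))
  (solve 4 (λ x y u v → (y :- x) :+ (v :- u) := (y :+ v) :- (x :+ u)) ≃-refl x y u v)

nonNeg⇒0≤ : ∀ {x} → NonNegative x → 0ℝ ≤ x
nonNeg⇒0≤ {x} p = ≤-by p (solve 1 (λ x → x := x :- con 0ℚ) ≃-refl x)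

0≤⇒nonNeg : ∀ {x} → 0ℝ ≤ x → NonNegative x
0≤⇒nonNeg {x} p = nonNeg-resp (solve 1 (λ x → x :- con 0ℚ := x) ≃-refl x) (difference p)

nonNeg-≤ : ∀ {x y} → NonNegative x → x ≤ y → NonNegative y
nonNeg-≤ p q = 0≤⇒nonNeg (≤-trans (nonNeg⇒0≤ p) q)

*-mono-≤ : ∀ {x y u v} → NonNegative x → NonNegative u → x ≤ y → u ≤ v → x * u ≤ y * v
*-mono-≤ {x} {y} {u} {v} x≥0 u≥0 p q =
  ≤-by (nonNeg-+ (nonNeg-* (nonNeg-≤ x≥0 p) (difference q)) (nonNeg-* u≥0 (difference p)))
    (solve 4 (λ x y u v → y :* (v :- u) :+ u :* (y :- x) := y :* v :- x :* u) ≃-refl x y u v)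

∣x+y∣≤∣x∣+∣y∣ : ∀ x y → ∣ x + y ∣ ≤ ∣ x ∣ + ∣ y ∣
∣x+y∣≤∣x∣+∣y∣ x y = ≤-pointwise λ n → ℚ.∣p+q∣≤∣p∣+∣q∣ (seq x n) (seq y n)

fromℚ-mono-≤ : ∀ {p q} → p ℚ.≤ q → fromℚ p ≤ fromℚ q
fromℚ-mono-≤ p≤q = ≤-pointwise λ _ → p≤q

<⇒≤ : ∀ {x y} → x < y → x ≤ y
<⇒≤ {x} {y} (mk< (ε , ε>0 , N , h)) = mk≤ (mkNonNegative (mk≃ λ δ δ>0 → N , λ n N≤n →
  subst (λ r → ℚ.∣ r ∣ ℚ.< δ)
    (sym (trans (cong (ℚ._- (seq y n ℚ.- seq x n)) (ℚ.0≤p⇒∣p∣≡p (gap n N≤n)))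
      (ℚ.+-inverseʳ (seq y n ℚ.- seq x n)))) δ>0))
  where
  gap : ∀ n → N ℕ.≤ n → 0ℚ ℚ.≤ seq y n ℚ.- seq x n
  gap n N≤n = subst (ℚ._≤ seq y n ℚ.- seq x n) (ℚ.+-inverseʳ (seq x n))
    (ℚ.+-monoˡ-≤ (ℚ.- seq x n) (ℚ.≤-trans
      (subst (ℚ._≤ seq x n ℚ.+ ε) (ℚ.+-identityʳ (seq x n))
        (ℚ.+-monoʳ-≤ (seq x n) (ℚ.<⇒≤ ε>0)))
      (ℚ.<⇒≤ (h n N≤n))))

-- For the termwise differences d of y and x, the hypothesis says that |d| - d tends to 0, and - d
-- is at most its absolute value.
≤⇒eventually : ∀ {x y} → x ≤ y → ∀ ε → 0ℚ ℚ.< ε →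
  ∃[ N ] (∀ n → N ℕ.≤ n → seq x n ℚ.< seq y n ℚ.+ ε)
≤⇒eventually {x} {y} (mk≤ (mkNonNegative (mk≃ v))) ε ε>0 = proj₁ V , λ n N≤n →
  let d = seq y n ℚ.- seq x n in
  subst₂ ℚ._<_ (q-[q-p]≡p (seq x n) (seq y n)) refl
    (ℚ.+-monoʳ-< (seq y n) (ℚ.≤-<-trans (bound d) (proj₂ V n N≤n)))
  where
  V = v ε ε>0
  bound : ∀ d → ℚ.- d ℚ.≤ ℚ.∣ ℚ.∣ d ∣ ℚ.- d ∣
  bound d = ℚ.≤-trans
    (subst (ℚ._≤ ℚ.∣ d ∣ ℚ.- d) (ℚ.+-identityˡ (ℚ.- d)) (ℚ.+-monoˡ-≤ (ℚ.- d) (ℚ.0≤∣p∣ d)))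
    (Lemmas.p≤∣p∣ (ℚ.∣ d ∣ ℚ.- d))

-- If q < p, the choice ε = p - q in the eventual inequality of these constant sequences reads p <
-- p.
fromℚ-cancel-≤ : ∀ {p q} → fromℚ p ≤ fromℚ q → p ℚ.≤ q
fromℚ-cancel-≤ {p} {q} le = ℚ.≮⇒≥ λ q<p →
  let N , h = ≤⇒eventually le (p ℚ.- q)
        (subst (ℚ._< p ℚ.- q) (ℚ.+-inverseʳ q) (ℚ.+-monoˡ-< (ℚ.- q) q<p))
  in ℚ.<-irrefl (sym (q+[p-q]≡p p q)) (h N ℕ.≤-refl)

-- Bridges the estimates, which are weak inequalities with rational bounds, and the strict
-- inequality in the definition of a limit.
rational-below : ∀ {ε} → 0ℝ < ε → ∃[ δ ] (0ℚ ℚ.< δ × (∀ {x} → x ≤ fromℚ δ → x < ε))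
rational-below {ε} (mk< (r , r>0 , N , h)) = δ , δ>0 , λ {x} le →
  let M , k = ≤⇒eventually le δ δ>0 in
  mk< (s , s>0 , M ℕ.⊔ N , λ n M⊔N≤n → begin-strict
    seq x n ℚ.+ s        <⟨ ℚ.+-monoˡ-< s (k n (ℕ.m⊔n≤o⇒m≤o M N M⊔N≤n)) ⟩
    δ ℚ.+ δ ℚ.+ s        ≡⟨ cong (ℚ._+ s) (Lemmas.half+half s) ⟩
    s ℚ.+ s              ≡⟨ Lemmas.half+half r ⟩
    r                    ≡⟨ ℚ.+-identityˡ r ⟨
    0ℚ ℚ.+ r             <⟨ h n (ℕ.m⊔n≤o⇒n≤o M N M⊔N≤n) ⟩
    seq ε n              ∎)
  where
  open ℚ.≤-Reasoning
  s δ : ℚ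
  s = ½ ℚ.* r
  -- A quarter of r: eventually x lies below δ + δ = s, and the other half s of r remains as the
  -- gap.
  δ = ½ ℚ.* s
  s>0 : 0ℚ ℚ.< s
  s>0 = Lemmas.half-pos r>0
  δ>0 : 0ℚ ℚ.< δ
  δ>0 = Lemmas.half-pos s>0

bounded : ∀ x → ∃[ B ] (∣ x ∣ ≤ fromℚ B)
bounded x = go (Lemmas.bound (seq x) (cauchy x))
  where
  go : ∃[ B ] (0ℚ ℚ.< B × ∃[ N ] (∀ n → N ℕ.≤ n → ℚ.∣ seq x n ∣ ℚ.≤ B)) → ∃[ B ] (∣ x ∣ ≤ fromℚ B)
  go (B , _ , N , h) = B , mk≤ (mkNonNegative (mk≃ λ δ δ>0 → N , λ n N≤n →
    let d = B ℚ.- ℚ.∣ seq x n ∣ in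
    subst (λ r → ℚ.∣ r ∣ ℚ.< δ)
      (sym (trans (cong (ℚ._- d) (ℚ.0≤p⇒∣p∣≡p
          (subst (ℚ._≤ d) (ℚ.+-inverseʳ ℚ.∣ seq x n ∣)
            (ℚ.+-monoˡ-≤ (ℚ.- ℚ.∣ seq x n ∣) (h n N≤n)))))
        (ℚ.+-inverseʳ d))) δ>0))

≤-preorder : Preorder 0ℓ 0ℓ 0ℓ
≤-preorder = record
  { Carrier = ℝ ; _≈_ = _≃_ ; _≲_ = _≤_
  ; isPreorder = record
    { isEquivalence = CommutativeRing.isEquivalence ℝ-commutativeRing
    ; reflexive = ≤-reflexive
    ; trans = ≤-trans
    }
  }

module ≤-Reasoning = Relation.Binary.Reasoning.Preorder ≤-preorder

-- Embeddings of 𝒪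

β*β≃β+1 : β * β ≃ β + 1ℝ
β*β≃β+1 = begin
  β * β
    ≈⟨ solve 1 (λ s → (con ½ :* (con 1ℚ :+ s)) :* (con ½ :* (con 1ℚ :+ s)) :=
         con (½ ℚ.* ½) :* (con 1ℚ :+ con (ι (+ 2)) :* s :+ s :* s)) ≃-refl (√ 5) ⟩
  fromℚ (½ ℚ.* ½) * (1ℝ + fromℚ (ι (+ 2)) * √ 5 + √ 5 * √ 5)
    ≈⟨ *-cong ≃-refl (+-cong ≃-refl √5*√5≃5) ⟩
  fromℚ (½ ℚ.* ½) * (1ℝ + fromℚ (ι (+ 2)) * √ 5 + fromℚ (ι (+ 5)))
    ≈⟨ solve 1 (λ s → con (½ ℚ.* ½) :* (con 1ℚ :+ con (ι (+ 2)) :* s :+ con (ι (+ 5))) :=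
         con ½ :* (con 1ℚ :+ s) :+ con 1ℚ) ≃-refl (√ 5) ⟩
  β + 1ℝ ∎
  where open ≃-Reasoning

K→ℝ-+ : ∀ x y → K→ℝ (x +ᴷ y) ≃ K→ℝ x + K→ℝ y
K→ℝ-+ ⟨ p , q ⟩ ⟨ r , s ⟩ = ≃-trans
  (+-cong {fromℚ (p ℚ.+ r)} {fromℚ p + fromℚ r} {fromℚ (q ℚ.+ s) * β} {(fromℚ q + fromℚ s) * β}
    (pointwise λ _ → refl) (*-cong (pointwise λ _ → refl) ≃-refl))
  (solve 5 (λ p q r s b → (p :+ r) :+ (q :+ s) :* b := (p :+ q :* b) :+ (r :+ s :* b))
    ≃-refl (fromℚ p) (fromℚ q) (fromℚ r) (fromℚ s) β)

K→ℝ-neg : ∀ x → K→ℝ (-ᴷ x) ≃ - K→ℝ x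
K→ℝ-neg ⟨ p , q ⟩ = ≃-trans
  (+-cong {fromℚ (ℚ.- p)} { - fromℚ p} {fromℚ (ℚ.- q) * β} { - fromℚ q * β}
    (pointwise λ _ → refl) (*-cong (pointwise λ _ → refl) ≃-refl))
  (solve 3 (λ p q b → (:- p) :+ (:- q) :* b := :- (p :+ q :* b)) ≃-refl (fromℚ p) (fromℚ q) β)

K→ℝ-* : ∀ x y → K→ℝ (x *ᴷ y) ≃ K→ℝ x * K→ℝ y
K→ℝ-* ⟨ p , q ⟩ ⟨ r , s ⟩ = begin
  fromℚ (p ℚ.* r ℚ.+ q ℚ.* s) + fromℚ (p ℚ.* s ℚ.+ q ℚ.* r ℚ.+ q ℚ.* s) * β
    ≈⟨ +-cong (pointwise λ _ → refl) (*-cong (pointwise λ _ → refl) ≃-refl) ⟩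
  (p′ * r′ + q′ * s′) + (p′ * s′ + q′ * r′ + q′ * s′) * β
    ≈⟨ solve 5 (λ p q r s b → (p :* r :+ q :* s) :+ (p :* s :+ q :* r :+ q :* s) :* b :=
         (p :* r :+ (p :* s :+ q :* r) :* b) :+ (q :* s) :* (b :+ con 1ℚ))
         ≃-refl p′ q′ r′ s′ β ⟩
  (p′ * r′ + (p′ * s′ + q′ * r′) * β) + (q′ * s′) * (β + 1ℝ)
    ≈⟨ +-cong ≃-refl (*-cong ≃-refl (≃-sym β*β≃β+1)) ⟩
  (p′ * r′ + (p′ * s′ + q′ * r′) * β) + (q′ * s′) * (β * β)
    ≈⟨ solve 5 (λ p q r s b → (p :* r :+ (p :* s :+ q :* r) :* b) :+ (q :* s) :* (b :* b) :=
         (p :+ q :* b) :* (r :+ s :* b)) ≃-refl p′ q′ r′ s′ β ⟩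
  (p′ + q′ * β) * (r′ + s′ * β) ∎
  where
  open ≃-Reasoning
  p′ q′ r′ s′ : ℝ
  p′ = fromℚ p
  q′ = fromℚ q
  r′ = fromℚ r
  s′ = fromℚ s

K→ℝ-rational : ∀ p → K→ℝ ⟨ p , 0ℚ ⟩ ≃ fromℚ p
K→ℝ-rational p = solve 2 (λ p b → p :+ con 0ℚ :* b := p) ≃-refl (fromℚ p) β

-- The orbit is analysed for an arbitrary homomorphism from 𝒪 to ℝ, so that one argument covers the
-- inclusion and its composite with σ.
Embedding : Set
Embedding = 𝒪-rawRing ACR.-Raw-AlmostCommutative⟶ ℝ-almostCommutativeRing

≡⇒≃ : ∀ {x y : ℝ} → x ≡ y → x ≃ y
≡⇒≃ refl = ≃-refl

embedding : Embedding
embedding = record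
  { ⟦_⟧    = 𝒪→ℝ
  ; +-homo = λ α γ → ≃-trans (≡⇒≃ (cong K→ℝ (𝒪→K-+ α γ))) (K→ℝ-+ (𝒪→K α) (𝒪→K γ))
  ; *-homo = λ α γ → ≃-trans (≡⇒≃ (cong K→ℝ (𝒪→K-* α γ))) (K→ℝ-* (𝒪→K α) (𝒪→K γ))
  ; -‿homo = λ α → ≃-trans (≡⇒≃ (cong K→ℝ (cong₂ ⟨_,_⟩ (ι-neg (rat α)) (ι-neg (gold α)))))
      (K→ℝ-neg (𝒪→K α))
  ; 0-homo = K→ℝ-rational 0ℚ
  ; 1-homo = K→ℝ-rational 1ℚ
  }

conjugate-embedding : Embedding
conjugate-embedding = record
  { ⟦_⟧    = λ α → 𝒪→ℝ (σ α)
  ; +-homo = λ α γ → ≃-trans (≡⇒≃ (cong 𝒪→ℝ (σ-+ α γ))) (+-homo embedding (σ α) (σ γ))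
  ; *-homo = λ α γ → ≃-trans (≡⇒≃ (cong 𝒪→ℝ (σ-* α γ))) (*-homo embedding (σ α) (σ γ))
  ; -‿homo = λ α → ≃-trans (≡⇒≃ (cong 𝒪→ℝ (σ-neg α))) (-‿homo embedding (σ α))
  ; 0-homo = 0-homo embedding
  ; 1-homo = 1-homo embedding
  }

≤-refl : ∀ {x} → x ≤ x
≤-refl = ≤-reflexive ≃-refl

1≰0 : ¬ (1ℝ ≤ 0ℝ)
1≰0 le = ℚ.<-irrefl refl (ℚ.<-≤-trans Lemmas.0<1 (fromℚ-cancel-≤ le))

𝒪→ℝ-norm : ∀ α → 𝒪→ℝ α * 𝒪→ℝ (σ α) ≃ fromℚ (ι (norm α))
𝒪→ℝ-norm α = begin
  𝒪→ℝ α * 𝒪→ℝ (σ α)         ≈⟨ *-homo embedding α (σ α) ⟨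
  𝒪→ℝ (α *ᴼ σ α)            ≈⟨ ≡⇒≃ (cong 𝒪→ℝ (*-σ α)) ⟩
  𝒪→ℝ ⟨ norm α , + 0 ⟩      ≈⟨ K→ℝ-rational (ι (norm α)) ⟩
  fromℚ (ι (norm α))        ∎
  where open ≃-Reasoning

-- The norm of α is a nonzero integer. An upper bound on one conjugate therefore keeps the other
-- away from 0.
1≤∣norm∣ : ∀ {α} → α ≢ 0# → 1ℝ ≤ ∣ 𝒪→ℝ α ∣ * ∣ 𝒪→ℝ (σ α) ∣
1≤∣norm∣ {α} α≢0 = begin
  1ℝ                               ≲⟨ ≤-pointwise (λ _ → integral (norm α)
                                        (λ N≡0 → α≢0 (norm≡0⇒≡0 α N≡0))) ⟩
  ∣ fromℚ (ι (norm α)) ∣           ≈⟨ ∣-∣-cong (𝒪→ℝ-norm α) ⟨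
  ∣ 𝒪→ℝ α * 𝒪→ℝ (σ α) ∣            ≈⟨ ∣x*y∣≃∣x∣*∣y∣ (𝒪→ℝ α) (𝒪→ℝ (σ α)) ⟩
  ∣ 𝒪→ℝ α ∣ * ∣ 𝒪→ℝ (σ α) ∣        ∎
  where
  open ≤-Reasoning
  integral : ∀ N → N ≢ + 0 → 1ℚ ℚ.≤ ℚ.∣ ι N ∣
  integral (+ zero)    N≢0 = contradiction refl N≢0
  integral (+ suc n)   N≢0 = ℚ.≤-trans (ι-mono-≤ {+ 1} {+ suc n} (ℤ.+≤+ (ℕ.s≤s ℕ.z≤n)))
    (Lemmas.p≤∣p∣ (ι (+ suc n)))
  integral (-[1+ n ])  N≢0 = ℚ.≤-trans (integral (+ suc n) λ ())
    (ℚ.≤-reflexive (sym (ℚ.∣-p∣≡∣p∣ (ι (+ suc n)))))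

-- The orbit of a quadratic polynomial

record Quadratic : Set where
  constructor quad
  field lead middle constant : 𝒪

open Quadratic

-- If x is a root of f and x = a + 1 / y, then y is a root of shift a f.
shift : 𝒪 → Quadratic → Quadratic
shift a (quad A B C) =
  quad (A *ᴼ a *ᴼ a +ᴼ B *ᴼ a +ᴼ C) ((A *ᴼ a +ᴼ A *ᴼ a) +ᴼ B) A

orbit : (ℕ → 𝒪) → Quadratic → ℕ → Quadratic
orbit a f zero    = f
orbit a f (suc n) = shift (a n) (orbit a f n)

-- previous a u v n is X (n - 1) for the recurrence with X (-1) = u and X 0 = v.
previous : (ℕ → 𝒪) → 𝒪 → 𝒪 → ℕ → 𝒪
previous a u v zero    = u
previous a u v (suc n) = recurrence a u v n

previous-step : ∀ a u v n → previous a u v (2 ℕ.+ n) ≡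
  (a (suc n) *ᴼ previous a u v (suc n)) +ᴼ previous a u v n
previous-step a u v zero    = refl
previous-step a u v (suc n) = refl

prevP prevQ : (ℕ → 𝒪) → ℕ → 𝒪
prevP a = previous a 1# (a 0)
prevQ a = previous a 0# 1#

module _ (a : ℕ → 𝒪) (f : Quadratic) where
  open QuadraticFormProperties 𝒪-commutativeRing

  private
    F : 𝒪 → 𝒪 → 𝒪
    F = form (lead f) (middle f) (constant f)

    G : 𝒪 → 𝒪 → 𝒪 → 𝒪 → 𝒪
    G = polar (lead f) (middle f) (constant f)

    p q : ℕ → 𝒪
    p = prevP a
    q = prevQ a

  -- The composed substitution has as its columns two consecutive convergent pairs, so its
  -- coefficients are the values of F at these pairs and their polar value. One step uses all three,
  -- the constant coefficient being the previous leading one; hence the joint induction.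
  orbit-coefficients : ∀ n →
    lead (orbit a f n) ≡ F (p n) (q n) ×
    lead (orbit a f (suc n)) ≡ F (p (suc n)) (q (suc n)) ×
    middle (orbit a f (suc n)) ≡ G (p (suc n)) (q (suc n)) (p n) (q n)
  orbit-coefficients zero =
    sym (form-1-0 (lead f) (middle f) (constant f)) ,
    sym (form-a-1 (lead f) (middle f) (constant f) (a 0)) ,
    sym (polar-a-1-1-0 (lead f) (middle f) (constant f) (a 0))
  orbit-coefficients (suc n) with orbit-coefficients n
  ... | A₀ , A₁ , B₁ = A₁ ,
    trans (cong₂ _+ᴼ_ (cong₂ (λ u v → u *ᴼ b *ᴼ b +ᴼ v *ᴼ b) A₁ B₁) A₀)
      (trans (sym (form-combine (lead f) (middle f) (constant f) b
               (p (suc n)) (q (suc n)) (p n) (q n)))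
        (sym (cong₂ F p-step q-step))) ,
    trans (cong₂ (λ u v → (u *ᴼ b +ᴼ u *ᴼ b) +ᴼ v) A₁ B₁)
      (trans (sym (polar-combine (lead f) (middle f) (constant f) b
               (p (suc n)) (q (suc n)) (p n) (q n)))
        (sym (cong₂ (λ u v → G u v (p (suc n)) (q (suc n))) p-step q-step)))
    where
    b = a (suc n)
    p-step = previous-step a 1# (a 0) n
    q-step = previous-step a 0# 1# n

  orbit-form : ∀ n → lead (orbit a f n) ≡ F (p n) (q n)
  orbit-form n = proj₁ (orbit-coefficients n)

-- The ring solver cannot use hypotheses; z ≃ 0 enters with an explicit cofactor c.
modulo : ∀ {x y} c {z} → z ≃ 0ℝ → x ≃ y + c * z → x ≃ y
modulo {x} {y} c {z} z≃0 eq = begin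
  x            ≈⟨ eq ⟩
  y + c * z    ≈⟨ +-cong ≃-refl (*-cong ≃-refl z≃0) ⟩
  y + c * 0ℝ   ≈⟨ solve 2 (λ y c → y :+ c :* con 0ℚ := y) ≃-refl y c ⟩
  y            ∎
  where open ≃-Reasoning

x≃y⇒x-y≃0 : ∀ {x y} → x ≃ y → x - y ≃ 0ℝ
x≃y⇒x-y≃0 {x} {y} eq = ≃-trans (+-cong eq ≃-refl)
  (solve 1 (λ y → y :- y := con 0ℚ) ≃-refl y)

-- `odd k` is 2 k + 1, so `suc (odd k)` runs through the positive even indices: even, so that η has
-- the value η 0; positive, because the bound on B n requires a preceding step.
odd : ℕ → ℕ
odd zero    = 1
odd (suc k) = suc (suc (odd k))

odd-mono-< : ∀ {i j} → i ℕ.< j → odd i ℕ.< odd j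
odd-mono-< {zero}  {suc j} _           = ℕ.s≤s (ℕ.s≤s ℕ.z≤n)
odd-mono-< {suc i} {suc j} (ℕ.s≤s i<j) = ℕ.s≤s (ℕ.s≤s (odd-mono-< i<j))

-- The orbit under one embedding.

module Dynamics (φ : Embedding) (f : Quadratic) (a : ℕ → 𝒪) (x : ℕ → ℝ)
  (ε²≤ : ∀ n → (x n - ⟦ φ ⟧ (a n)) ² ≤ fromℚ 9/10)
  (step : ∀ n → x (suc n) * (x n - ⟦ φ ⟧ (a n)) ≃ 1ℝ)
  (root : ⟦ φ ⟧ (lead f) * x 0 * x 0 + ⟦ φ ⟧ (middle f) * x 0 + ⟦ φ ⟧ (constant f) ≃ 0ℝ)
  where

  φ′ : 𝒪 → ℝ
  φ′ = ⟦ φ ⟧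

  Aₙ Bₙ Cₙ ε η p q t : ℕ → ℝ
  Aₙ n = φ′ (lead (orbit a f n))
  Bₙ n = φ′ (middle (orbit a f n))
  Cₙ n = φ′ (constant (orbit a f n))
  ε n = x n - φ′ (a n)
  η n = Aₙ n * x n + Aₙ n * x n + Bₙ n
  p n = φ′ (prevP a n)
  q n = φ′ (prevQ a n)
  t n = q n * x 0 - p n

  value : ℕ → ℝ
  value n = Aₙ n * x n * x n + Bₙ n * x n + Cₙ n

  φ-* : ∀ α γ → φ′ (α *ᴼ γ) ≃ φ′ α * φ′ γ
  φ-* = *-homo φ

  φ-*₃ : ∀ α γ δ → φ′ (α *ᴼ γ *ᴼ δ) ≃ φ′ α * φ′ γ * φ′ δ
  φ-*₃ α γ δ = ≃-trans (φ-* (α *ᴼ γ) δ) (*-cong (φ-* α γ) ≃-refl)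

  φ-form : ∀ α γ δ r s → φ′ (form α γ δ r s) ≃ formᴿ (φ′ α) (φ′ γ) (φ′ δ) (φ′ r) (φ′ s)
  φ-form α γ δ r s = ≃-trans (+-homo φ (α *ᴼ r *ᴼ r +ᴼ γ *ᴼ r *ᴼ s) (δ *ᴼ s *ᴼ s))
    (+-cong (≃-trans (+-homo φ (α *ᴼ r *ᴼ r) (γ *ᴼ r *ᴼ s))
      (+-cong (φ-*₃ α r r) (φ-*₃ γ r s))) (φ-*₃ δ s s))

  A-step : ∀ n → Aₙ (suc n) ≃ Aₙ n * φ′ (a n) * φ′ (a n) + Bₙ n * φ′ (a n) + Cₙ n
  A-step n = ≃-trans (+-homo φ (lead g *ᴼ a n *ᴼ a n +ᴼ middle g *ᴼ a n) (constant g))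
    (+-cong (≃-trans (+-homo φ (lead g *ᴼ a n *ᴼ a n) (middle g *ᴼ a n))
      (+-cong (φ-*₃ (lead g) (a n) (a n)) (φ-* (middle g) (a n)))) ≃-refl)
    where
    g : Quadratic
    g = orbit a f n

  B-step : ∀ n → Bₙ (suc n) ≃ (Aₙ n * φ′ (a n) + Aₙ n * φ′ (a n)) + Bₙ n
  B-step n = ≃-trans (+-homo φ (lead g *ᴼ a n +ᴼ lead g *ᴼ a n) (middle g))
    (+-cong (≃-trans (+-homo φ (lead g *ᴼ a n) (lead g *ᴼ a n))
      (+-cong (φ-* (lead g) (a n)) (φ-* (lead g) (a n)))) ≃-refl)
    where
    g : Quadratic
    g = orbit a f n

  yε-1≃0 : ∀ n → x (suc n) * ε n - 1ℝ ≃ 0ℝ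
  yε-1≃0 n = x≃y⇒x-y≃0 (step n)

  -- The shifted polynomial at y is y² times the old one at b + 1 / y, and b + 1 / y is x n because
  -- y (x n - b) = 1.
  value≃0 : ∀ n → value n ≃ 0ℝ
  value≃0 zero    = root
  value≃0 (suc n) = begin
    Aₙ (suc n) * y * y + Bₙ (suc n) * y + Aₙ n
      ≈⟨ +-cong (+-cong (*-cong (*-cong (A-step n) ≃-refl) ≃-refl)
           (*-cong (B-step n) ≃-refl)) ≃-refl ⟩
    (α * b * b + γ * b + δ) * y * y + ((α * b + α * b) + γ) * y + α
      ≈⟨ modulo (- (((α * b + α * b) + γ) * y + α * (1ℝ + y * ε n))) (yε-1≃0 n)
           (solve 6 (λ α γ δ b x y →
             (α :* b :* b :+ γ :* b :+ δ) :* y :* y :+ ((α :* b :+ α :* b) :+ γ) :* y :+ α :=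
             (α :* x :* x :+ γ :* x :+ δ) :* (y :* y) :+
             (:- (((α :* b :+ α :* b) :+ γ) :* y :+ α :* (con 1ℚ :+ y :* (x :- b)))) :*
               (y :* (x :- b) :- con 1ℚ)) ≃-refl α γ δ b (x n) y) ⟩
    value n * (y * y)
      ≈⟨ *-cong (value≃0 n) ≃-refl ⟩
    0ℝ * (y * y)
      ≈⟨ solve 1 (λ y → con 0ℚ :* (y :* y) := con 0ℚ) ≃-refl y ⟩
    0ℝ ∎
    where
    open ≃-Reasoning
    α γ δ b y : ℝ
    α = Aₙ n
    γ = Bₙ n
    δ = Cₙ n
    b = φ′ (a n)
    y = x (suc n)

  -- Taylor expansion at the root x n: the new leading coefficient is the old polynomial at a n = x
  -- n - ε n. The new middle coefficient is its derivative there, which gives `B-step-ε`.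
  A-step-ε : ∀ n → Aₙ (suc n) ≃ Aₙ n * (ε n * ε n) - η n * ε n
  A-step-ε n = ≃-trans (A-step n) (modulo 1ℝ (value≃0 n)
    (solve 5 (λ α γ δ b x → α :* b :* b :+ γ :* b :+ δ :=
      α :* ((x :- b) :* (x :- b)) :- (α :* x :+ α :* x :+ γ) :* (x :- b) :+
      con 1ℚ :* (α :* x :* x :+ γ :* x :+ δ)) ≃-refl (Aₙ n) (Bₙ n) (Cₙ n) (φ′ (a n)) (x n)))

  B-step-ε : ∀ n → Bₙ (suc n) ≃ η n - (Aₙ n * ε n + Aₙ n * ε n)
  B-step-ε n = ≃-trans (B-step n)
    (solve 4 (λ α γ b x → (α :* b :+ α :* b) :+ γ :=
      (α :* x :+ α :* x :+ γ) :- (α :* (x :- b) :+ α :* (x :- b))) ≃-refl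
      (Aₙ n) (Bₙ n) (φ′ (a n)) (x n))

  η-step : ∀ n → η (suc n) ≃ - η n
  η-step n = begin
    Aₙ (suc n) * y + Aₙ (suc n) * y + Bₙ (suc n)
      ≈⟨ +-cong (+-cong (*-cong (A-step-ε n) ≃-refl) (*-cong (A-step-ε n) ≃-refl)) (B-step-ε n) ⟩
    (Aₙ n * (ε n * ε n) - η n * ε n) * y + (Aₙ n * (ε n * ε n) - η n * ε n) * y
      + (η n - (Aₙ n * ε n + Aₙ n * ε n))
      ≈⟨ modulo (Aₙ n * ε n + Aₙ n * ε n - (η n + η n)) (yε-1≃0 n)
           (solve 4 (λ α e h y →
             (α :* (e :* e) :- h :* e) :* y :+ (α :* (e :* e) :- h :* e) :* y
               :+ (h :- (α :* e :+ α :* e)) :=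
             (:- h) :+ (α :* e :+ α :* e :- (h :+ h)) :* (y :* e :- con 1ℚ))
             ≃-refl (Aₙ n) (ε n) (η n) y) ⟩
    - η n ∎
    where
    open ≃-Reasoning
    y : ℝ
    y = x (suc n)

  η-step² : ∀ n → η (2 ℕ.+ n) ≃ η n
  η-step² n = ≃-trans (η-step (suc n)) (≃-trans (-‿cong (η-step n))
    (solve 1 (λ h → :- (:- h) := h) ≃-refl (η n)))

  -- η alternates in sign, so indices of equal parity are compared.
  η-odd : ∀ k → η (suc (odd k)) ≃ η 0
  η-odd zero    = η-step² 0
  η-odd (suc k) = ≃-trans (η-step² (suc (odd k))) (η-odd k)

  ∣η∣ : ∀ n → ∣ η n ∣ ≃ ∣ η 0 ∣
  ∣η∣ zero    = ≃-refl
  ∣η∣ (suc n) = ≃-trans (∣-∣-cong (η-step n)) (≃-trans (∣-x∣≃∣x∣ (η n)) (∣η∣ n))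

  -- 2 ∣ ε ∣ ≤ 1 + ε².
  ∣ε∣≤1 : ∀ n → ∣ ε n ∣ ≤ 1ℝ
  ∣ε∣≤1 n = ≤-by
    (nonNeg-* (nonNeg-literal ½) (nonNeg-+ (nonNeg-² (∣ ε n ∣ - 1ℝ))
      (nonNeg-+ (_≤_.difference ∣ε∣²≤) (nonNeg-literal 1/10))))
    (solve 1 (λ e → con ½ :* ((e :- con 1ℚ) :* (e :- con 1ℚ) :+
      ((con 9/10 :- e :* e) :+ con 1/10)) := con 1ℚ :- e) ≃-refl ∣ ε n ∣)
    where
    ∣ε∣²≤ : ∣ ε n ∣ * ∣ ε n ∣ ≤ fromℚ 9/10
    ∣ε∣²≤ = ≤-trans (≤-reflexive (∣x∣²≃x² (ε n))) (ε²≤ n)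

  -- The recursion preserves |A n| ≤ M as soon as 9/10 M + |η 0| ≤ M, that is M ≥ 10 |η 0|. The
  -- second summand makes M large enough for n = 0.
  M : ℝ
  M = fromℚ (+ 10 ℚ./ 1) * (∣ η 0 ∣ + ∣ Aₙ 0 ∣)

  ∣A∣≤M : ∀ n → ∣ Aₙ n ∣ ≤ M
  ∣A∣≤M zero = ≤-by
    (nonNeg-+ (nonNeg-* (nonNeg-literal (+ 10 ℚ./ 1)) (nonNeg-∣-∣ (η 0)))
      (nonNeg-* (nonNeg-literal (+ 9 ℚ./ 1)) (nonNeg-∣-∣ (Aₙ 0))))
    (solve 2 (λ h α → con (+ 10 ℚ./ 1) :* h :+ con (+ 9 ℚ./ 1) :* α :=
      con (+ 10 ℚ./ 1) :* (h :+ α) :- α) ≃-refl ∣ η 0 ∣ ∣ Aₙ 0 ∣)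
  ∣A∣≤M (suc n) = begin
    ∣ Aₙ (suc n) ∣
      ≈⟨ ∣-∣-cong (A-step-ε n) ⟩
    ∣ Aₙ n * (ε n * ε n) - η n * ε n ∣
      ≲⟨ ∣x+y∣≤∣x∣+∣y∣ (Aₙ n * (ε n * ε n)) (- (η n * ε n)) ⟩
    ∣ Aₙ n * (ε n * ε n) ∣ + ∣ - (η n * ε n) ∣
      ≈⟨ +-cong (≃-trans (∣x*y∣≃∣x∣*∣y∣ (Aₙ n) (ε n * ε n))
             (*-cong ≃-refl (NonNegative.∣x∣≃x (nonNeg-² (ε n)))))
           (≃-trans (∣-x∣≃∣x∣ (η n * ε n))
             (≃-trans (∣x*y∣≃∣x∣*∣y∣ (η n) (ε n)) (*-cong (∣η∣ n) ≃-refl))) ⟩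
    ∣ Aₙ n ∣ * (ε n * ε n) + ∣ η 0 ∣ * ∣ ε n ∣
      ≲⟨ +-mono-≤ (*-mono-≤ (nonNeg-∣-∣ (Aₙ n)) (nonNeg-² (ε n)) (∣A∣≤M n) (ε²≤ n))
           (*-mono-≤ (nonNeg-∣-∣ (η 0)) (nonNeg-∣-∣ (ε n)) ≤-refl (∣ε∣≤1 n)) ⟩
    M * fromℚ 9/10 + ∣ η 0 ∣ * 1ℝ
      ≲⟨ ≤-by (nonNeg-∣-∣ (Aₙ 0)) (solve 2 (λ h α → α :=
           con (+ 10 ℚ./ 1) :* (h :+ α) :-
           (con (+ 10 ℚ./ 1) :* (h :+ α) :* con 9/10 :+ h :* con 1ℚ)) ≃-refl ∣ η 0 ∣ ∣ Aₙ 0 ∣) ⟩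
    M ∎
    where open ≤-Reasoning

  ∣η∣≤M : ∣ η 0 ∣ ≤ M
  ∣η∣≤M = ≤-by
    (nonNeg-+ (nonNeg-* (nonNeg-literal (+ 9 ℚ./ 1)) (nonNeg-∣-∣ (η 0)))
      (nonNeg-* (nonNeg-literal (+ 10 ℚ./ 1)) (nonNeg-∣-∣ (Aₙ 0))))
    (solve 2 (λ h α → con (+ 9 ℚ./ 1) :* h :+ con (+ 10 ℚ./ 1) :* α :=
      con (+ 10 ℚ./ 1) :* (h :+ α) :- h) ≃-refl ∣ η 0 ∣ ∣ Aₙ 0 ∣)

  -- By `B-step-ε`, one M for |η n| and one for each of the two terms A n ε n. The initial B 0 does
  -- not come from a step, hence `suc n`.
  ∣B∣≤M+M+M : ∀ n → ∣ Bₙ (suc n) ∣ ≤ M + (M + M)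
  ∣B∣≤M+M+M n = begin
    ∣ Bₙ (suc n) ∣
      ≈⟨ ∣-∣-cong (B-step-ε n) ⟩
    ∣ η n - (Aₙ n * ε n + Aₙ n * ε n) ∣
      ≲⟨ ∣x+y∣≤∣x∣+∣y∣ (η n) (- (Aₙ n * ε n + Aₙ n * ε n)) ⟩
    ∣ η n ∣ + ∣ - (Aₙ n * ε n + Aₙ n * ε n) ∣
      ≈⟨ +-cong (∣η∣ n) (∣-x∣≃∣x∣ (Aₙ n * ε n + Aₙ n * ε n)) ⟩
    ∣ η 0 ∣ + ∣ Aₙ n * ε n + Aₙ n * ε n ∣
      ≲⟨ +-mono-≤ ∣η∣≤M (≤-trans (∣x+y∣≤∣x∣+∣y∣ (Aₙ n * ε n) (Aₙ n * ε n)) (+-mono-≤ Aε≤M Aε≤M)) ⟩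
    M + (M + M) ∎
    where
    open ≤-Reasoning
    Aε≤M : ∣ Aₙ n * ε n ∣ ≤ M
    Aε≤M = begin
      ∣ Aₙ n * ε n ∣       ≈⟨ ∣x*y∣≃∣x∣*∣y∣ (Aₙ n) (ε n) ⟩
      ∣ Aₙ n ∣ * ∣ ε n ∣   ≲⟨ *-mono-≤ (nonNeg-∣-∣ (Aₙ n)) (nonNeg-∣-∣ (ε n)) (∣A∣≤M n) (∣ε∣≤1 n) ⟩
      M * 1ℝ               ≈⟨ solve 1 (λ m → m :* con 1ℚ := m) ≃-refl M ⟩
      M                    ∎

  t-0 : t 0 ≃ - 1ℝ
  t-0 = ≃-trans (+-cong (*-cong (0-homo φ) ≃-refl) (-‿cong (1-homo φ)))
    (solve 1 (λ x → con 0ℚ :* x :- con 1ℚ := :- con 1ℚ) ≃-refl (x 0))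

  φ-previous : ∀ u v n → φ′ (previous a u v (2 ℕ.+ n)) ≃
    φ′ (a (suc n)) * φ′ (previous a u v (suc n)) + φ′ (previous a u v n)
  φ-previous u v n = begin
    φ′ (previous a u v (2 ℕ.+ n))
      ≈⟨ ≡⇒≃ (cong φ′ (previous-step a u v n)) ⟩
    φ′ ((a (suc n) *ᴼ previous a u v (suc n)) +ᴼ previous a u v n)
      ≈⟨ +-homo φ (a (suc n) *ᴼ previous a u v (suc n)) (previous a u v n) ⟩
    φ′ (a (suc n) *ᴼ previous a u v (suc n)) + φ′ (previous a u v n)
      ≈⟨ +-cong (φ-* (a (suc n)) (previous a u v (suc n))) ≃-refl ⟩
    φ′ (a (suc n)) * φ′ (previous a u v (suc n)) + φ′ (previous a u v n) ∎
    where open ≃-Reasoning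

  t-step : ∀ n → t (suc n) ≃ - (ε n * t n)
  t-step zero = begin
    φ′ 1# * x 0 - φ′ (a 0)
      ≈⟨ +-cong (*-cong (1-homo φ) ≃-refl) ≃-refl ⟩
    1ℝ * x 0 - φ′ (a 0)
      ≈⟨ solve 2 (λ x b → con 1ℚ :* x :- b := :- ((x :- b) :* (:- con 1ℚ)))
           ≃-refl (x 0) (φ′ (a 0)) ⟩
    - (ε 0 * - 1ℝ)
      ≈⟨ -‿cong (*-cong ≃-refl (≃-sym t-0)) ⟩
    - (ε 0 * t 0) ∎
    where open ≃-Reasoning
  t-step (suc n) = begin
    q (2 ℕ.+ n) * x 0 - p (2 ℕ.+ n)
      ≈⟨ +-cong (*-cong (φ-previous 0# 1# n) ≃-refl) (-‿cong (φ-previous 1# (a 0) n)) ⟩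
    (b * q (suc n) + q n) * x 0 - (b * p (suc n) + p n)
      ≈⟨ solve 6 (λ b q₁ q₀ x p₁ p₀ → (b :* q₁ :+ q₀) :* x :- (b :* p₁ :+ p₀) :=
           b :* (q₁ :* x :- p₁) :+ (q₀ :* x :- p₀))
           ≃-refl b (q (suc n)) (q n) (x 0) (p (suc n)) (p n) ⟩
    b * t (suc n) + t n
      -- Multiplying t n by y ε n = 1 produces the product ε n t n, to which the induction
      -- hypothesis applies.
      ≈⟨ modulo (- t n) (yε-1≃0 n) (solve 5 (λ b y t₁ t₀ e → b :* t₁ :+ t₀ :=
           b :* t₁ :+ y :* e :* t₀ :+ (:- t₀) :* (y :* e :- con 1ℚ))
           ≃-refl b y (t (suc n)) (t n) (ε n)) ⟩
    b * t (suc n) + y * ε n * t n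
      ≈⟨ solve 5 (λ b y t₁ t₀ e → b :* t₁ :+ y :* e :* t₀ :=
           b :* t₁ :- y :* (:- (e :* t₀))) ≃-refl b y (t (suc n)) (t n) (ε n) ⟩
    b * t (suc n) - y * - (ε n * t n)
      ≈⟨ +-cong ≃-refl (-‿cong (*-cong ≃-refl (≃-sym (t-step n)))) ⟩
    b * t (suc n) - y * t (suc n)
      ≈⟨ solve 3 (λ b y t₁ → b :* t₁ :- y :* t₁ := :- ((y :- b) :* t₁)) ≃-refl b y (t (suc n)) ⟩
    - (ε (suc n) * t (suc n)) ∎
    where
    open ≃-Reasoning
    b y : ℝ
    b = φ′ (a (suc n))
    y = x (suc n)

  t²≤decay : ∀ n → t n * t n ≤ fromℚ (decay n)
  t²≤decay zero    = ≤-reflexive (≃-trans (*-cong t-0 t-0)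
    (solve 0 ((:- con 1ℚ) :* (:- con 1ℚ) := con 1ℚ) ≃-refl))
  t²≤decay (suc n) = begin
    t (suc n) * t (suc n)              ≈⟨ *-cong (t-step n) (t-step n) ⟩
    - (ε n * t n) * - (ε n * t n)
      ≈⟨ solve 2 (λ e t → (:- (e :* t)) :* (:- (e :* t)) := (e :* e) :* (t :* t))
           ≃-refl (ε n) (t n) ⟩
    (ε n * ε n) * (t n * t n)
      ≲⟨ *-mono-≤ (nonNeg-² (ε n)) (nonNeg-² (t n)) (ε²≤ n) (t²≤decay n) ⟩
    fromℚ 9/10 * fromℚ (decay n)       ≈⟨ pointwise (λ _ → refl) ⟩
    fromℚ (decay (suc n))              ∎
    where open ≤-Reasoning

  -- Up to sign t n is the product of the earlier ε's, each of which has the next x as its inverse.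
  t≄0 : ∀ n → ¬ (t n ≃ 0ℝ)
  t≄0 zero    t≃0 = 1≰0 (≤-reflexive (begin
    1ℝ       ≈⟨ solve 0 (con 1ℚ := :- (:- con 1ℚ)) ≃-refl ⟩
    - - 1ℝ   ≈⟨ -‿cong (≃-trans (≃-sym t-0) t≃0) ⟩
    - 0ℝ     ≈⟨ solve 0 (:- con 0ℚ := con 0ℚ) ≃-refl ⟩
    0ℝ       ∎))
    where open ≃-Reasoning
  t≄0 (suc n) t≃0 = t≄0 n (begin
    t n
      ≈⟨ modulo (- t n) (yε-1≃0 n) (solve 3 (λ y e t → t :=
           (:- y) :* (:- (e :* t)) :+ (:- t) :* (y :* e :- con 1ℚ))
           ≃-refl (x (suc n)) (ε n) (t n)) ⟩
    - x (suc n) * - (ε n * t n)   ≈⟨ *-cong ≃-refl (≃-trans (≃-sym (t-step n)) t≃0) ⟩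
    - x (suc n) * 0ℝ              ≈⟨ solve 1 (λ y → (:- y) :* con 0ℚ := con 0ℚ) ≃-refl (x (suc n)) ⟩
    0ℝ                            ∎)
    where open ≃-Reasoning

  -- Substituting p = q x - t into the form gives A t² - t q η plus q² times the polynomial at its
  -- root x 0.
  A-form : ∀ n → Aₙ n ≃ Aₙ 0 * (t n * t n) - (t n * q n) * η 0
  A-form n = begin
    Aₙ n
      ≈⟨ ≡⇒≃ (cong φ′ (orbit-form a f n)) ⟩
    φ′ (form (lead f) (middle f) (constant f) (prevP a n) (prevQ a n))
      ≈⟨ φ-form (lead f) (middle f) (constant f) (prevP a n) (prevQ a n) ⟩
    formᴿ (Aₙ 0) (Bₙ 0) (Cₙ 0) (p n) (q n)
      ≈⟨ modulo (q n * q n) root (solve 6 (λ α γ δ p q x →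
           α :* p :* p :+ γ :* p :* q :+ δ :* q :* q :=
           α :* ((q :* x :- p) :* (q :* x :- p)) :-
           ((q :* x :- p) :* q) :* (α :* x :+ α :* x :+ γ) :+
           (q :* q) :* (α :* x :* x :+ γ :* x :+ δ)) ≃-refl
           (Aₙ 0) (Bₙ 0) (Cₙ 0) (p n) (q n) (x 0)) ⟩
    Aₙ 0 * (t n * t n) - (t n * q n) * η 0 ∎
    where open ≃-Reasoning

  -- If the form vanished at the convergent pair, both entries would be 0, and so would t n.
  orbit-A≢0 : Anisotropic (lead f) (middle f) (constant f) → ∀ n → lead (orbit a f n) ≢ 0#
  orbit-A≢0 aniso n A≡0 = t≄0 n (begin
    q n * x 0 - p n
      ≈⟨ +-cong (*-cong (≡⇒≃ (cong φ′ (proj₂ zeros))) ≃-refl)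
           (-‿cong (≡⇒≃ (cong φ′ (proj₁ zeros)))) ⟩
    φ′ 0# * x 0 - φ′ 0#
      ≈⟨ +-cong (*-cong (0-homo φ) ≃-refl) (-‿cong (0-homo φ)) ⟩
    0ℝ * x 0 - 0ℝ
      ≈⟨ solve 1 (λ x → con 0ℚ :* x :- con 0ℚ := con 0ℚ) ≃-refl (x 0) ⟩
    0ℝ ∎)
    where
    open ≃-Reasoning
    zeros : prevP a n ≡ 0# × prevQ a n ≡ 0#
    zeros = aniso (prevP a n) (prevQ a n) (trans (sym (orbit-form a f n)) A≡0)

  -- Convergence under one embedding.

  module Convergence (m : ℚ) (0≤m : 0ℚ ℚ.≤ m) (∣A∣≤m : ∣ Aₙ 0 ∣ ≤ fromℚ m)
    (∣η∣≤m : ∣ η 0 ∣ ≤ fromℚ m) (1≤m∣A∣ : ∀ n → 1ℝ ≤ fromℚ m * ∣ Aₙ n ∣)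
    where

    μ : ℝ
    μ = fromℚ m

    m≥0 : NonNegative μ
    m≥0 = nonNeg-fromℚ 0≤m

    -- Sets the lower bound 1 / m on |A n| against `A-form`. Once the decaying term is at most ½,
    -- the other half has to come from |t q|.
    1≤m²decay+m²∣tq∣ : ∀ n → 1ℝ ≤ μ * μ * fromℚ (decay n) + μ * μ * ∣ t n * q n ∣
    1≤m²decay+m²∣tq∣ n = begin
      1ℝ
        ≲⟨ 1≤m∣A∣ n ⟩
      μ * ∣ Aₙ n ∣
        ≲⟨ *-mono-≤ m≥0 (nonNeg-∣-∣ (Aₙ n)) ≤-refl ∣A∣≤ ⟩
      μ * (μ * fromℚ (decay n) + ∣ t n * q n ∣ * μ)
        ≈⟨ solve 3 (λ m d u → m :* (m :* d :+ u :* m) := m :* m :* d :+ m :* m :* u)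
             ≃-refl μ (fromℚ (decay n)) ∣ t n * q n ∣ ⟩
      μ * μ * fromℚ (decay n) + μ * μ * ∣ t n * q n ∣ ∎
      where
      open ≤-Reasoning
      ∣A∣≤ : ∣ Aₙ n ∣ ≤ μ * fromℚ (decay n) + ∣ t n * q n ∣ * μ
      ∣A∣≤ = begin
        ∣ Aₙ n ∣
          ≈⟨ ∣-∣-cong (A-form n) ⟩
        ∣ Aₙ 0 * (t n * t n) - (t n * q n) * η 0 ∣
          ≲⟨ ∣x+y∣≤∣x∣+∣y∣ (Aₙ 0 * (t n * t n)) (- ((t n * q n) * η 0)) ⟩
        ∣ Aₙ 0 * (t n * t n) ∣ + ∣ - ((t n * q n) * η 0) ∣
          ≈⟨ +-cong (≃-trans (∣x*y∣≃∣x∣*∣y∣ (Aₙ 0) (t n * t n))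
                 (*-cong ≃-refl (NonNegative.∣x∣≃x (nonNeg-² (t n)))))
               (≃-trans (∣-x∣≃∣x∣ ((t n * q n) * η 0)) (∣x*y∣≃∣x∣*∣y∣ (t n * q n) (η 0))) ⟩
        ∣ Aₙ 0 ∣ * (t n * t n) + ∣ t n * q n ∣ * ∣ η 0 ∣
          ≲⟨ +-mono-≤ (*-mono-≤ (nonNeg-∣-∣ (Aₙ 0)) (nonNeg-² (t n)) ∣A∣≤m (t²≤decay n))
               (*-mono-≤ (nonNeg-∣-∣ (t n * q n)) (nonNeg-∣-∣ (η 0)) ≤-refl ∣η∣≤m) ⟩
        μ * fromℚ (decay n) + ∣ t n * q n ∣ * μ ∎

    m²decay-homo : ∀ n → fromℚ (m ℚ.* m ℚ.* decay n) ≃ μ * μ * fromℚ (decay n)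
    m²decay-homo n = pointwise λ _ → refl

    ½≤m²∣tq∣ : ∀ n → m ℚ.* m ℚ.* decay n ℚ.≤ ½ → fromℚ ½ ≤ μ * μ * ∣ t n * q n ∣
    ½≤m²∣tq∣ n small = mk≤ (nonNeg-resp
      (solve 2 (λ d u → (con ½ :- d) :+ ((d :+ u) :- con 1ℚ) := u :- con ½) ≃-refl
        (μ * μ * fromℚ (decay n)) (μ * μ * ∣ t n * q n ∣))
      (nonNeg-+ (_≤_.difference (≤-trans (≤-reflexive (≃-sym (m²decay-homo n)))
          (fromℚ-mono-≤ small)))
        (_≤_.difference (1≤m²decay+m²∣tq∣ n))))

    q≢0 : ∀ n → m ℚ.* m ℚ.* decay n ℚ.≤ ½ → prevQ a n ≢ 0#
    q≢0 n small q≡0 = ℚ.<-irrefl refl (ℚ.<-≤-trans (ℚ.positive⁻¹ ½) (fromℚ-cancel-≤ (begin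
      fromℚ ½                       ≲⟨ ½≤m²∣tq∣ n small ⟩
      μ * μ * ∣ t n * q n ∣         ≈⟨ *-cong ≃-refl (∣-∣-cong (*-cong ≃-refl
                                         (≃-trans (≡⇒≃ (cong φ′ q≡0)) (0-homo φ)))) ⟩
      μ * μ * ∣ t n * 0ℝ ∣          ≈⟨ *-cong ≃-refl (∣-∣-cong
                                         (solve 1 (λ t → t :* con 0ℚ := con 0ℚ) ≃-refl (t n))) ⟩
      μ * μ * ∣ 0ℝ ∣                ≈⟨ *-cong ≃-refl (pointwise λ _ → refl) ⟩
      μ * μ * 0ℝ                    ≈⟨ solve 1 (λ m → m :* m :* con 0ℚ := con 0ℚ) ≃-refl μ ⟩
      0ℝ                            ∎)))
      where open ≤-Reasoning

    -- Since q (z - x 0) = p - q x 0 = - t, the product |t q| |z - x 0| is t². In place of a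
    -- division by |t q|, the bound 1 ≤ 2 m² |t q| is multiplied in.
    convergent-error : ∀ n z → m ℚ.* m ℚ.* decay n ℚ.≤ ½ → z * q n ≃ p n →
      ∣ z - x 0 ∣ ≤ fromℚ (ι (+ 2)) * (μ * μ * fromℚ (decay n))
    convergent-error n z small zq≃p = begin
      ∣ z - x 0 ∣
        ≈⟨ solve 1 (λ d → d := con (ι (+ 2)) :* (con ½ :* d)) ≃-refl ∣ z - x 0 ∣ ⟩
      two * (fromℚ ½ * ∣ z - x 0 ∣)
        ≲⟨ *-mono-≤ two≥0 (nonNeg-* (nonNeg-literal ½) (nonNeg-∣-∣ (z - x 0))) ≤-refl
             (*-mono-≤ (nonNeg-literal ½) (nonNeg-∣-∣ (z - x 0)) (½≤m²∣tq∣ n small) ≤-refl) ⟩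
      two * (μ * μ * ∣ t n * q n ∣ * ∣ z - x 0 ∣)
        ≈⟨ solve 4 (λ c m u d → c :* (m :* m :* u :* d) := c :* (m :* m :* (u :* d)))
             ≃-refl two μ ∣ t n * q n ∣ ∣ z - x 0 ∣ ⟩
      two * (μ * μ * (∣ t n * q n ∣ * ∣ z - x 0 ∣))
        ≈⟨ *-cong ≃-refl (*-cong ≃-refl product) ⟩
      two * (μ * μ * (t n * t n))
        ≲⟨ *-mono-≤ two≥0 (nonNeg-* (nonNeg-² μ) (nonNeg-² (t n))) ≤-refl
             (*-mono-≤ (nonNeg-² μ) (nonNeg-² (t n)) ≤-refl (t²≤decay n)) ⟩
      two * (μ * μ * fromℚ (decay n)) ∎
      where
      open ≤-Reasoning
      two : ℝ
      two = fromℚ (ι (+ 2))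
      two≥0 : NonNegative two
      two≥0 = nonNeg-literal (ι (+ 2))
      product : ∣ t n * q n ∣ * ∣ z - x 0 ∣ ≃ t n * t n
      product = ≃-trans (≃-sym (∣x*y∣≃∣x∣*∣y∣ (t n * q n) (z - x 0)))
        (≃-trans (∣-∣-cong (modulo (t n) (x≃y⇒x-y≃0 zq≃p)
          (solve 4 (λ p q x z → ((q :* x :- p) :* q) :* (z :- x) :=
            (:- ((q :* x :- p) :* (q :* x :- p))) :+ (q :* x :- p) :* (z :* q :- p))
          ≃-refl (p n) (q n) (x 0) z)))
        (≃-trans (∣-x∣≃∣x∣ (t n * t n)) (NonNegative.∣x∣≃x (nonNeg-² (t n)))))

    -- `prevQ a (suc n)` reduces to `Q a n`, and likewise for P, so this type unfolds to `HasLimit`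
    -- for each of the two embeddings.
    converges : ∀ {y} → x 0 ≃ y → ∃[ N ] ((∀ n → N ℕ.≤ n → prevQ a (suc n) ≢ 0#) ×
      (∀ z → (∀ n → N ℕ.≤ n → z n * q (suc n) ≃ p (suc n)) → z ⟶ y))
    converges x₀≃y = N , (λ n N≤n → q≢0 (suc n) (small n N≤n)) , λ z zq≃p e e>0 →
      let δ , δ>0 , below = rational-below e>0
          K , tiny = decay-small (ι (+ 2) ℚ.* (m ℚ.* m)) δ δ>0
      in K ℕ.⊔ N , λ n le →
        let N≤n = ℕ.m⊔n≤o⇒n≤o K N le
            K≤n = ℕ.m⊔n≤o⇒m≤o K N le
        in below (≤-trans (≤-reflexive (∣-∣-cong (+-cong ≃-refl (-‿cong (≃-sym x₀≃y)))))
             (≤-trans (convergent-error (suc n) (z n) (small n N≤n) (zq≃p n N≤n))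
               (≤-trans (≤-reflexive (regroup (suc n)))
                 (fromℚ-mono-≤ (tiny (suc n) (ℕ.m≤n⇒m≤1+n K≤n))))))
      where
      smallness = decay-small (m ℚ.* m) ½ (ℚ.positive⁻¹ ½)
      N : ℕ
      N = proj₁ smallness
      small : ∀ n → N ℕ.≤ n → m ℚ.* m ℚ.* decay (suc n) ℚ.≤ ½
      small n N≤n = proj₂ smallness (suc n) (ℕ.m≤n⇒m≤1+n N≤n)
      regroup : ∀ n → fromℚ (ι (+ 2)) * (μ * μ * fromℚ (decay n)) ≃
        fromℚ (ι (+ 2) ℚ.* (m ℚ.* m) ℚ.* decay n)
      regroup n = pointwise λ _ → sym (ℚ.*-assoc (ι (+ 2)) (m ℚ.* m) (decay n))

  -- At both indices 2 A x + B equals η 0; with equal A and B this linear equation is solved by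
  -- means of the inverse e of A.
  root-determined : ∀ i j → let m = suc (odd i) ; n = suc (odd j) in
    lead (orbit a f m) ≡ lead (orbit a f n) → middle (orbit a f m) ≡ middle (orbit a f n) →
    ∀ e → Aₙ m * e ≃ 1ℝ → x m ≃ x n
  root-determined i j A≡ B≡ e Ae≃1 = begin
    x m
      ≈⟨ modulo (x n - x m) (x≃y⇒x-y≃0 Ae≃1) (solve 5 (λ α e γ x y → x :=
           (y :+ con ½ :* e :* ((α :* x :+ α :* x :+ γ) :- (α :* y :+ α :* y :+ γ))) :+
           (y :- x) :* (α :* e :- con 1ℚ)) ≃-refl (Aₙ m) e (Bₙ m) (x m) (x n)) ⟩
    x n + fromℚ ½ * e * (η m - (Aₙ m * x n + Aₙ m * x n + Bₙ m))
      ≈⟨ modulo (fromℚ ½ * e) (x≃y⇒x-y≃0 same) ≃-refl ⟩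
    x n ∎
    where
    open ≃-Reasoning
    m n : ℕ
    m = suc (odd i)
    n = suc (odd j)
    same : η m ≃ Aₙ m * x n + Aₙ m * x n + Bₙ m
    same = ≃-trans (≃-trans (η-odd i) (≃-sym (η-odd j)))
      (≡⇒≃ (cong₂ (λ α γ → φ′ α * x n + φ′ α * x n + φ′ γ) (sym A≡) (sym B≡)))

-- From bounds and recurrence to periodicity.

bounded⇒box : ∀ {m : ℚ} {T} → m ℚ.* m ℚ.+ m ℚ.* m ℚ.≤ ι (+ T) → ∀ α →
  ∣ 𝒪→ℝ α ∣ ≤ fromℚ m → ∣ 𝒪→ℝ (σ α) ∣ ≤ fromℚ m → Box T α
bounded⇒box {m} {T} m²≤T α α≤m σα≤m =
  component ℤ.∣ rat α ∣ (ℕ.≤-trans (ℕ.m≤m+n _ _) (ℕ.m≤m+n _ _)) ,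
  component ℤ.∣ gold α ∣ (ℕ.≤-trans (ℕ.m≤n+m _ (ℤ.∣ rat α ∣ ℕ.* ℤ.∣ rat α ∣)) (ℕ.m≤m+n _ _))
  where
  square≤ : ∀ {x} → ∣ x ∣ ≤ fromℚ m → x * x ≤ fromℚ (m ℚ.* m)
  square≤ {x} le = ≤-trans (≤-reflexive (≃-sym (∣x∣²≃x² x)))
    (≤-trans (*-mono-≤ (nonNeg-∣-∣ x) (nonNeg-∣-∣ x) le le) (≤-reflexive (pointwise λ _ → refl)))

  sum≃ : 𝒪→ℝ α * 𝒪→ℝ α + 𝒪→ℝ (σ α) * 𝒪→ℝ (σ α) ≃ fromℚ (ι (+ sumOfSquares α))
  sum≃ = begin
    𝒪→ℝ α * 𝒪→ℝ α + 𝒪→ℝ (σ α) * 𝒪→ℝ (σ α)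
      ≈⟨ +-cong (*-homo embedding α α) (*-homo embedding (σ α) (σ α)) ⟨
    𝒪→ℝ (α *ᴼ α) + 𝒪→ℝ (σ α *ᴼ σ α)
      ≈⟨ +-homo embedding (α *ᴼ α) (σ α *ᴼ σ α) ⟨
    𝒪→ℝ (α *ᴼ α +ᴼ σ α *ᴼ σ α)
      ≈⟨ ≡⇒≃ (cong 𝒪→ℝ (α²+σα² α)) ⟩
    𝒪→ℝ ⟨ + sumOfSquares α , + 0 ⟩
      ≈⟨ K→ℝ-rational (ι (+ sumOfSquares α)) ⟩
    fromℚ (ι (+ sumOfSquares α)) ∎
    where open ≃-Reasoning

  sum≤T : sumOfSquares α ℕ.≤ T
  sum≤T = ℤ.drop‿+≤+ (ι-cancel-≤ {+ sumOfSquares α} {+ T} (ℚ.≤-trans (fromℚ-cancel-≤ (begin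
    fromℚ (ι (+ sumOfSquares α))                   ≈⟨ sum≃ ⟨
    𝒪→ℝ α * 𝒪→ℝ α + 𝒪→ℝ (σ α) * 𝒪→ℝ (σ α)          ≲⟨ +-mono-≤ (square≤ α≤m) (square≤ σα≤m) ⟩
    fromℚ (m ℚ.* m) + fromℚ (m ℚ.* m)              ≈⟨ pointwise (λ _ → refl) ⟩
    fromℚ (m ℚ.* m ℚ.+ m ℚ.* m)                    ∎)) m²≤T))
    where open ≤-Reasoning

  component : ∀ k → k ℕ.* k ℕ.≤ sumOfSquares α → k ℕ.≤ T
  component k le = ℕ.≤-trans (m≤m*m k) (ℕ.≤-trans le sum≤T)

inverse-unique : ∀ {y y′ z z′} → y * z ≃ 1ℝ → y′ * z′ ≃ 1ℝ → z ≃ z′ → y ≃ y′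
inverse-unique {y} {y′} {z} {z′} yz≃1 y′z′≃1 z≃z′ = begin
  y               ≈⟨ modulo (- y) (x≃y⇒x-y≃0 y′z′≃1) (solve 3 (λ y y′ z′ → y :=
                       y :* z′ :* y′ :+ (:- y) :* (y′ :* z′ :- con 1ℚ)) ≃-refl y y′ z′) ⟩
  y * z′ * y′     ≈⟨ *-cong (≃-trans (*-cong ≃-refl (≃-sym z≃z′)) yz≃1) ≃-refl ⟩
  1ℝ * y′         ≈⟨ solve 1 (λ y → con 1ℚ :* y := y) ≃-refl y′ ⟩
  y′              ∎
  where open ≃-Reasoning

module _ {ξ ξ′ : ℝ} {a : ℕ → 𝒪} (e : Expansion ξ ξ′ a) where
  open Expansion e

  -- Equal pairs yield equal digits by the choice rule, and equal digits yield equal next pairs, so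
  -- everything after m repeats with period n - m.
  recurrent⇒periodic : ChoiceByCurrentPair e → ∀ m n → m ℕ.< n → x m ≃ x n → x′ m ≃ x′ n →
    UltimatelyPeriodic a
  recurrent⇒periodic choice m n m<n xm≃xn x′m≃x′n = m , n ℕ.∸ m , ℕ.m<n⇒0<n∸m m<n , λ k m≤k →
    subst₂ (λ i j → a i ≡ a j)
      (begin
        (k ℕ.∸ m) ℕ.+ n                 ≡⟨ cong ((k ℕ.∸ m) ℕ.+_) (ℕ.m+[n∸m]≡n (ℕ.<⇒≤ m<n)) ⟨
        (k ℕ.∸ m) ℕ.+ (m ℕ.+ (n ℕ.∸ m)) ≡⟨ ℕ.+-assoc (k ℕ.∸ m) m (n ℕ.∸ m) ⟨
        (k ℕ.∸ m) ℕ.+ m ℕ.+ (n ℕ.∸ m)   ≡⟨ cong (ℕ._+ (n ℕ.∸ m)) (ℕ.m∸n+n≡m m≤k) ⟩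
        k ℕ.+ (n ℕ.∸ m)                 ∎)
      (ℕ.m∸n+n≡m m≤k)
      (sym (choice _ _ (proj₁ (same (k ℕ.∸ m))) (proj₂ (same (k ℕ.∸ m)))))
    where
    open ≡-Reasoning
    same : ∀ k → x (k ℕ.+ m) ≃ x (k ℕ.+ n) × x′ (k ℕ.+ m) ≃ x′ (k ℕ.+ n)
    same zero    = xm≃xn , x′m≃x′n
    same (suc k) =
      let x≃ , x′≃ = same k
          a≡ = choice _ _ x≃ x′≃
      in inverse-unique (step (k ℕ.+ m)) (step (k ℕ.+ n))
           (+-cong x≃ (-‿cong (≡⇒≃ (cong 𝒪→ℝ a≡)))) ,
         inverse-unique (step′ (k ℕ.+ m)) (step′ (k ℕ.+ n))
           (+-cong x′≃ (-‿cong (≡⇒≃ (cong (λ α → 𝒪→ℝ (σ α)) a≡))))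

-- Quotients and limits of convergents.

𝒪→ℝ-inverse : ∀ α → α ≢ 0# → ∃[ y ] (𝒪→ℝ α * y ≃ 1ℝ)
𝒪→ℝ-inverse α α≢0 = let y , αy≡1 = 𝒪→K-inverse α α≢0 in
  K→ℝ y , ≃-trans (≃-sym (K→ℝ-* (𝒪→K α) y)) (≃-trans (≡⇒≃ (cong K→ℝ αy≡1)) (K→ℝ-rational 1ℚ))

-- Junk value 0 at denominator 0.
quotient : 𝒪 → 𝒪 → ℝ
quotient α γ with γ ≟ᴼ 0#
... | yes _   = 0ℝ
... | no  γ≢0 = 𝒪→ℝ α * proj₁ (𝒪→ℝ-inverse γ γ≢0)

quotient-* : ∀ α γ → γ ≢ 0# → quotient α γ * 𝒪→ℝ γ ≃ 𝒪→ℝ α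
quotient-* α γ γ≢0 with γ ≟ᴼ 0#
... | yes γ≡0 = contradiction γ≡0 γ≢0
... | no  γ≢0 = modulo (𝒪→ℝ α) (x≃y⇒x-y≃0 (proj₂ (𝒪→ℝ-inverse γ γ≢0)))
  (solve 3 (λ α y γ → α :* y :* γ := α :+ α :* (γ :* y :- con 1ℚ)) ≃-refl (𝒪→ℝ α)
    (proj₁ (𝒪→ℝ-inverse γ γ≢0)) (𝒪→ℝ γ))

-- No sequence of quotients is fixed here, so that a limit can be transported along σ.
HasLimit : (𝒪 → ℝ) → (ℕ → 𝒪) → ℝ → Set
HasLimit φ a y = ∃[ N ] ((∀ n → N ℕ.≤ n → Q a n ≢ 0#) ×
  (∀ z → (∀ n → N ℕ.≤ n → z n * φ (Q a n) ≃ φ (P a n)) → z ⟶ y))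

hasLimit⇒convergesTo : ∀ {a y} → HasLimit 𝒪→ℝ a y → ConvergesTo a y
hasLimit⇒convergesTo {a} (N , Q≢0 , limit) = N , Q≢0 , z , zQ≃P , limit z zQ≃P
  where
  z : ℕ → ℝ
  z n = quotient (P a n) (Q a n)
  zQ≃P : ∀ n → N ℕ.≤ n → z n * 𝒪→ℝ (Q a n) ≃ 𝒪→ℝ (P a n)
  zQ≃P n N≤n = quotient-* (P a n) (Q a n) (Q≢0 n N≤n)

hasLimit-σ : ∀ {a y} → HasLimit (𝒪→ℝ ∘ σ) a y → HasLimit 𝒪→ℝ (σ ∘ a) y
hasLimit-σ {a} (N , Q≢0 , limit) =
  N , (λ n N≤n Qσ≡0 → Q≢0 n N≤n (σ≡0⇒≡0 (Q a n) (trans (sym (Q-σ n)) Qσ≡0))) ,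
  λ z zQ≃P → limit z λ n N≤n →
    subst₂ (λ α γ → z n * 𝒪→ℝ α ≃ 𝒪→ℝ γ) (Q-σ n) (P-σ n) (zQ≃P n N≤n)
  where
  P-σ : ∀ n → P (σ ∘ a) n ≡ σ (P a n)
  P-σ = recurrence-σ a 1# (a 0)
  Q-σ : ∀ n → Q (σ ∘ a) n ≡ σ (Q a n)
  Q-σ = recurrence-σ a 0# 1#

value-at : ∀ {x ξ} A B C → x ≃ ξ → eval 𝒪→ℝ (quadratic A B C) ξ ≃ 0ℝ →
  𝒪→ℝ A * x * x + 𝒪→ℝ B * x + 𝒪→ℝ C ≃ 0ℝ
value-at {x} {ξ} A B C x≃ξ eval≃0 = begin
  𝒪→ℝ A * x * x + 𝒪→ℝ B * x + 𝒪→ℝ C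
    ≈⟨ +-cong (+-cong (*-cong (*-cong ≃-refl x≃ξ) x≃ξ) (*-cong ≃-refl x≃ξ)) ≃-refl ⟩
  𝒪→ℝ A * ξ * ξ + 𝒪→ℝ B * ξ + 𝒪→ℝ C
    ≈⟨ solve 4 (λ A B C x → A :* x :* x :+ B :* x :+ C :=
         C :+ x :* (B :+ x :* (A :+ x :* con 0ℚ))) ≃-refl (𝒪→ℝ A) (𝒪→ℝ B) (𝒪→ℝ C) ξ ⟩
  eval 𝒪→ℝ (quadratic A B C) ξ
    ≈⟨ eval≃0 ⟩
  0ℝ ∎
  where open ≃-Reasoning

ε²-bound : ∀ {x y c} → ∣ x ∣ ² + ∣ y ∣ ² < c → x ² ≤ c
ε²-bound {x} {y} {c} lt = ≤-trans
  (≤-by (nonNeg-² ∣ y ∣) (≃-trans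
    (solve 2 (λ x y → y :* y := (x :* x :+ y :* y) :- x :* x) ≃-refl ∣ x ∣ ∣ y ∣)
    (+-cong ≃-refl (-‿cong (∣x∣²≃x² x)))))
  (<⇒≤ lt)

ε²-bound′ : ∀ {x y c} → ∣ x ∣ ² + ∣ y ∣ ² < c → y ² ≤ c
ε²-bound′ {x} {y} {c} lt = ≤-trans
  (≤-by (nonNeg-² ∣ x ∣) (≃-trans
    (solve 2 (λ x y → x :* x := (x :* x :+ y :* y) :- y :* y) ≃-refl ∣ x ∣ ∣ y ∣)
    (+-cong ≃-refl (-‿cong (∣x∣²≃x² y)))))
  (<⇒≤ lt)

-- The two embeddings together.

module Orbits {ξ ξ′ : ℝ} {a : ℕ → 𝒪} (e : Expansion ξ ξ′ a) (A B C : 𝒪)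
  (anisotropic : Anisotropic A B C)
  (root  : eval 𝒪→ℝ (quadratic A B C) ξ ≃ 0ℝ)
  (root′ : eval 𝒪→ℝ (quadratic (σ A) (σ B) (σ C)) ξ′ ≃ 0ℝ)
  where

  open Expansion e

  f : Quadratic
  f = quad A B C

  module D = Dynamics embedding f a x
    (λ n → ε²-bound {x n - 𝒪→ℝ (a n)} {x′ n - 𝒪→ℝ (σ (a n))} (close n)) step
    (value-at A B C start root)

  module D′ = Dynamics conjugate-embedding f a x′
    (λ n → ε²-bound′ {x n - 𝒪→ℝ (a n)} {x′ n - 𝒪→ℝ (σ (a n))} (close n)) step′
    (value-at (σ A) (σ B) (σ C) start′ root′)

  Aₙ≢0 : ∀ n → lead (orbit a f n) ≢ 0#
  Aₙ≢0 = D.orbit-A≢0 anisotropic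

  -- Dominates the bounds on A, B and η under both embeddings, so a single rational m above it
  -- serves for the boxes and for both convergence arguments.
  W : ℝ
  W = (D.M + (D.M + D.M)) + (D′.M + (D′.M + D′.M))

  M≥0 : NonNegative D.M
  M≥0 = nonNeg-≤ (nonNeg-∣-∣ (D.Aₙ 0)) (D.∣A∣≤M 0)

  M′≥0 : NonNegative D′.M
  M′≥0 = nonNeg-≤ (nonNeg-∣-∣ (D′.Aₙ 0)) (D′.∣A∣≤M 0)

  m : ℚ
  m = proj₁ (bounded W)

  W≤m : W ≤ fromℚ m
  W≤m = ≤-trans (≤-reflexive (≃-sym (NonNegative.∣x∣≃x W≥0))) (proj₂ (bounded W))
    where
    W≥0 : NonNegative W
    W≥0 = nonNeg-+ (nonNeg-+ M≥0 (nonNeg-+ M≥0 M≥0)) (nonNeg-+ M′≥0 (nonNeg-+ M′≥0 M′≥0))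

  3M≤m : D.M + (D.M + D.M) ≤ fromℚ m
  3M≤m = ≤-trans (≤-by (nonNeg-+ M′≥0 (nonNeg-+ M′≥0 M′≥0))
    (solve 2 (λ u v → v := (u :+ v) :- u) ≃-refl (D.M + (D.M + D.M)) (D′.M + (D′.M + D′.M)))) W≤m

  3M′≤m : D′.M + (D′.M + D′.M) ≤ fromℚ m
  3M′≤m = ≤-trans (≤-by (nonNeg-+ M≥0 (nonNeg-+ M≥0 M≥0))
    (solve 2 (λ u v → u := (u :+ v) :- v) ≃-refl (D.M + (D.M + D.M)) (D′.M + (D′.M + D′.M)))) W≤m

  M≤m : D.M ≤ fromℚ m
  M≤m = ≤-trans (≤-by (nonNeg-+ M≥0 M≥0)
    (solve 1 (λ u → u :+ u := (u :+ (u :+ u)) :- u) ≃-refl D.M)) 3M≤m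

  M′≤m : D′.M ≤ fromℚ m
  M′≤m = ≤-trans (≤-by (nonNeg-+ M′≥0 M′≥0)
    (solve 1 (λ u → u :+ u := (u :+ (u :+ u)) :- u) ≃-refl D′.M)) 3M′≤m

  0≤m : 0ℚ ℚ.≤ m
  0≤m = fromℚ-cancel-≤ (≤-trans (nonNeg⇒0≤ M≥0) M≤m)

  -- The embeddings interact here: the product of the two conjugates is at least 1 in absolute
  -- value, and the conjugate factor is at most m.
  1≤m∣A∣ : ∀ n → 1ℝ ≤ fromℚ m * ∣ D.Aₙ n ∣
  1≤m∣A∣ n = begin
    1ℝ                              ≲⟨ 1≤∣norm∣ (Aₙ≢0 n) ⟩
    ∣ D.Aₙ n ∣ * ∣ D′.Aₙ n ∣        ≲⟨ *-mono-≤ (nonNeg-∣-∣ (D.Aₙ n)) (nonNeg-∣-∣ (D′.Aₙ n)) ≤-refl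
                                         (≤-trans (D′.∣A∣≤M n) M′≤m) ⟩
    ∣ D.Aₙ n ∣ * fromℚ m
      ≈⟨ solve 2 (λ x y → x :* y := y :* x) ≃-refl ∣ D.Aₙ n ∣ (fromℚ m) ⟩
    fromℚ m * ∣ D.Aₙ n ∣            ∎
    where open ≤-Reasoning

  1≤m∣A′∣ : ∀ n → 1ℝ ≤ fromℚ m * ∣ D′.Aₙ n ∣
  1≤m∣A′∣ n = begin
    1ℝ                              ≲⟨ 1≤∣norm∣ (Aₙ≢0 n) ⟩
    ∣ D.Aₙ n ∣ * ∣ D′.Aₙ n ∣        ≲⟨ *-mono-≤ (nonNeg-∣-∣ (D.Aₙ n)) (nonNeg-∣-∣ (D′.Aₙ n))
                                         (≤-trans (D.∣A∣≤M n) M≤m) ≤-refl ⟩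
    fromℚ m * ∣ D′.Aₙ n ∣           ∎
    where open ≤-Reasoning

  module C = D.Convergence m 0≤m (≤-trans (D.∣A∣≤M 0) M≤m) (≤-trans D.∣η∣≤M M≤m) 1≤m∣A∣
  module C′ = D′.Convergence m 0≤m (≤-trans (D′.∣A∣≤M 0) M′≤m) (≤-trans D′.∣η∣≤M M′≤m) 1≤m∣A′∣

  converges : HasLimit 𝒪→ℝ a ξ
  converges = C.converges start

  converges′ : HasLimit (𝒪→ℝ ∘ σ) a ξ′
  converges′ = C′.converges start′

  T : ℕ
  T = proj₁ (natural-bound (m ℚ.* m ℚ.+ m ℚ.* m))

  A-box : ∀ n → Box T (lead (orbit a f n))
  A-box n = bounded⇒box {m} {T} (proj₂ (natural-bound (m ℚ.* m ℚ.+ m ℚ.* m))) (lead (orbit a f n))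
    (≤-trans (D.∣A∣≤M n) M≤m) (≤-trans (D′.∣A∣≤M n) M′≤m)

  B-box : ∀ n → Box T (middle (orbit a f (suc n)))
  B-box n = bounded⇒box {m} {T} (proj₂ (natural-bound (m ℚ.* m ℚ.+ m ℚ.* m)))
    (middle (orbit a f (suc n)))
    (≤-trans (D.∣B∣≤M+M+M n) 3M≤m) (≤-trans (D′.∣B∣≤M+M+M n) 3M′≤m)

  periodic : ChoiceByCurrentPair e → UltimatelyPeriodic a
  periodic choice = go (repetition {T} (λ k → lead (g k)) (λ k → middle (g k))
      (λ k → A-box (suc (odd k))) (λ k → B-box (odd k)))
    where
    g : ℕ → Quadratic
    g k = orbit a f (suc (odd k))

    go : ∃[ i ] ∃[ j ] (i ℕ.< j × lead (g i) ≡ lead (g j) × middle (g i) ≡ middle (g j)) →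
         UltimatelyPeriodic a
    -- The coincidence takes place in 𝒪, so the same two indices serve both embeddings and the whole
    -- pair recurs.
    go (i , j , i<j , A≡ , B≡) = recurrent⇒periodic e choice m′ n′ (ℕ.s≤s (odd-mono-< i<j))
      (D.root-determined i j A≡ B≡ (proj₁ y) (proj₂ y))
      (D′.root-determined i j A≡ B≡ (proj₁ y′) (proj₂ y′))
      where
      m′ n′ : ℕ
      m′ = suc (odd i)
      n′ = suc (odd j)
      y = 𝒪→ℝ-inverse (lead (g i)) (Aₙ≢0 m′)
      y′ = 𝒪→ℝ-inverse (σ (lead (g i))) (λ σA≡0 → Aₙ≢0 m′ (σ≡0⇒≡0 (lead (g i)) σA≡0))

theorem4 : (ξ : ℝ) → IsQuarticIrrational ξ → AllConjugatesReal ξ →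
    (L : Pred ℝ 0ℓ) → IsQuadraticExtension L → ξ ∈ L →
    (A B C : 𝒪) → IsMinimalQuadratic A B C ξ →
    (ξ′ : ℝ) → eval 𝒪→ℝ (quadratic (σ A) (σ B) (σ C)) ξ′ ≃ 0ℝ →
    (a : ℕ → 𝒪) (e : Expansion ξ ξ′ a) →
    (ChoiceByCurrentPair e → UltimatelyPeriodic a) ×
    ConvergesTo a ξ ×
    ConvergesTo (σ ∘ a) ξ′
theorem4 ξ _ _ L _ _ A B C minimal ξ′ root′ a e =
  periodic , hasLimit⇒convergesTo converges , hasLimit⇒convergesTo (hasLimit-σ converges′)
  where
  open Orbits e A B C (minimal⇒anisotropic {A} {B} {C} {ξ} minimal)
    (OverK.IsMinimalPolynomial.root (IsMinimalQuadratic.isMinimal minimal)) root′
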